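{- Let $r(K_3,Q_n)$ denote the smallest integer $N$ such that every red-blue colouring of the edges of the complete graph $K_N$ contains either a red copy of the $n$-dimensional hypercube $Q_n$ or a blue triangle. Then \[ r(K_3,Q_n) = \big(1+o(1)\big)\,2^{n+1} \quad \text{as } n\to\infty. \]
   Context: $Q_n$ is the graph with vertex set $\{0,1\}^n$ in which two vertices are adjacent if and only if they differ in exactly one coordinate. -}

module Defs where

open import Data.Nat using (ℕ; zero; suc; _+_; _*_; _^_; _<_; _≤_; _≥_; ∣_-_∣)
open import Data.Bool using (Bool; true; false)
open import Data.Fin using (Fin)
open import Data.Vec using (Vec; []; _∷_)
open import Data.Product using (Σ; ∃; _×_; _,_)
open import Data.Sum using (_⊎_)
open import Relation.Binary.PropositionalEquality using (_≡_; _≢_)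
open import Relation.Nullary using (¬_)
open import Function.Definitions using (Injective)

diffCount : ∀ {n} → Vec Bool n → Vec Bool n → ℕ
diffCount [] [] = 0
diffCount (true  ∷ u) (true  ∷ v) = diffCount u v
diffCount (false ∷ u) (false ∷ v) = diffCount u v
diffCount (true  ∷ u) (false ∷ v) = suc (diffCount u v)
diffCount (false ∷ u) (true  ∷ v) = suc (diffCount u v)

QAdj : ∀ {n} → Vec Bool n → Vec Bool n → Set
QAdj u v = diffCount u v ≡ 1

-- A red-blue edge colouring of K_N: a symmetric map on pairs of vertices
-- (true = red, false = blue; the diagonal values are irrelevant).
Colouring : ℕ → Set
Colouring N = Σ (Fin N → Fin N → Bool) λ c → ∀ i j → c i j ≡ c j i

RedQ : ∀ {N} → ℕ → (Fin N → Fin N → Bool) → Set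
RedQ {N} n c = Σ (Vec Bool n → Fin N) λ f →
  Injective _≡_ _≡_ f × (∀ u v → QAdj u v → c (f u) (f v) ≡ true)

BlueTriangle : ∀ {N} → (Fin N → Fin N → Bool) → Set
BlueTriangle {N} c = Σ (Fin N) λ i → Σ (Fin N) λ j → Σ (Fin N) λ k →
  (i ≢ j) × (j ≢ k) × (i ≢ k) ×
  (c i j ≡ false) × (c j k ≡ false) × (c i k ≡ false)

Arrows : ℕ → ℕ → Set
Arrows n N = (col : Colouring N) →
  let (c , _) = col in RedQ n c ⊎ BlueTriangle c

IsRamseyK3Q : ℕ → ℕ → Set
IsRamseyK3Q n N = Arrows n N × (∀ M → M < N → ¬ Arrows n M)

{-# OPTIONS --safe #-}

-- Two red cliques on 2ⁿ − 1 vertices joined by blue edges give the lower bound.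
--
-- For the upper bound let the blue graph be triangle-free on (2 + ε)2ⁿ vertices; blue neighbourhoods are red
-- cliques. Remove disjoint cliques of size at least 2^(n−b) from neighbourhoods; a pigeonhole over scales gives a b for
-- which, after discarding few vertices, all degrees into the rest R are far below 2^(n−b). Call two pieces (cliques,
-- or R) linked if they contain large parts that are sparse to each other. A vertex with many neighbours in two cliques
-- yields parts without any edge between them, so no three pieces are pairwise unlinked and two paths of links cover all
-- pieces; the longer one has (1 + ε/2)2ⁿ vertices. The cube is laid out along this path by the weight of the first K
-- coordinates, the layers being thin enough to pass from piece to piece through the sparse parts.
--
-- To realise the layout, cut the pieces into chunks, red cliques of about 2^(n−a) vertices taken from neighbourhoods
-- as coarse as possible, and allocate them from coarse to fine to subcubes of codimension a so that adjacent chunks are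
-- sparse to each other. If a vertex p of the cube is missed, every discarded chunk is dense to the chunk allocated at
-- some neighbour of p. A neighbour in direction i belonging to another chunk has codimension greater than i, hence few
-- blue edges to the chunks still to come, and summing over i shows that too little was discarded. Finally the vertices
-- are chosen greedily inside the chunks.

module Submission where

open import Defs
open import Data.Nat
open import Data.Nat.Properties
open import Data.Nat.DivMod using (m/n*n≤m; m*n/n≡m; /-mono-≤)
open import Data.Nat.Solver using (module +-*-Solver)
open import Data.Bool using (Bool; true; false; _∧_; _∨_; not; if_then_else_)
import Data.Bool.Properties as Bool
open import Data.Empty using (⊥; ⊥-elim)
open import Data.Fin using (Fin; toℕ)
import Data.Fin.Properties as Fin
open import Data.List using (List; _ʳ++_; []; _∷_; _++_; map; length; cartesianProduct)
open import Data.List.Properties using (length-map)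
open import Data.List.Membership.Propositional using (_∈_)
open import Data.List.Membership.Propositional.Properties using (∈-++⁻; ∈-map⁺; ∈-map⁻; ∈-cartesianProduct⁺)
open import Data.List.Relation.Unary.Any using (here; there)
open import Data.List.Relation.Unary.All as All using (All; []; _∷_)
import Data.List.Relation.Unary.All.Properties as Allₚ
open import Data.List.Relation.Unary.AllPairs using (AllPairs; []; _∷_)
import Data.List.Relation.Unary.AllPairs.Properties as AllPairsₚ
open import Data.List.Relation.Unary.Linked using ([]; [-]; _∷_) renaming (Linked to Chain)
open import Data.Maybe using (Maybe; just; nothing; is-just)
open import Data.Product using (Σ; ∃-syntax; _×_; _,_; proj₁; proj₂)
open import Data.Sum using (_⊎_; inj₁; inj₂)
open import Data.Unit using (tt)
open import Data.Vec using (Vec; []; _∷_; replicate)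
import Data.Vec.Properties as Vec
open import Data.Product.Properties using () renaming (≡-dec to ×-≡-dec)
open import Function using (_∘_; case_of_)
open import Function.Definitions using (Injective)
open import Relation.Binary.Definitions using (DecidableEquality)
open import Relation.Binary.PropositionalEquality
open import Relation.Nullary using (¬_; Dec; yes; no; does; contradiction)
open import Relation.Nullary.Decidable using (dec-true; dec-false; _×-dec_; _→-dec_; _⊎-dec_; ¬?; map′)
open +-*-Solver using (solve; _:=_; _:+_; _:*_; con)

-- Finite sums

-- The constants chase one another. Linked parts of size about 2^(n-f) are crossed only by layers
-- thinner than this, so the weight must range over K coordinates with √K well above 2^f. The cells
-- then have 2^(n-K) vertices, and neighbouring chunks are compatible only if the degrees between
-- the parts are far below that, at 2^(n-φ f). Degrees between 2^(n-φ f) and 2^(n-f) help neither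
-- side: they are too large for sparse parts and too small for a vertex with two large
-- neighbourhoods. Hence a scale f is sought at which they are rare. The number of candidates
-- depends on the scale b of the cliques, itself found by pigeonhole, so the two searches are nested
-- and the constants form towers. Neighbourhoods in R are smaller than a chunk of codimension K, and
-- its chunks shrink down to single vertices; this is why cells of varying codimension have to be
-- packed. All quantities are natural numbers: sets are Boolean predicates, cardinalities are sums
-- of indicators, and the ratio 1 + 2⁻ᵉ appears as 1 + 2^e against 2^e.

⟦_⟧ : Bool → ℕ
⟦ true ⟧ = 1
⟦ false ⟧ = 0

⟦⟧≤1 : ∀ b → ⟦ b ⟧ ≤ 1
⟦⟧≤1 true = ≤-refl
⟦⟧≤1 false = z≤n

<⟦⟧ : ∀ {m b} → m < ⟦ b ⟧ → (b ≡ true) × (m ≡ 0)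
<⟦⟧ {zero} {true} _ = refl , refl
<⟦⟧ {suc _} {true} (s≤s ())

⟦∧⟧ : ∀ a b → ⟦ a ∧ b ⟧ ≡ ⟦ a ⟧ * ⟦ b ⟧
⟦∧⟧ true b = sym (+-identityʳ _)
⟦∧⟧ false b = refl

⟦⟧-mono : ∀ {a b} → (a ≡ true → b ≡ true) → ⟦ a ⟧ ≤ ⟦ b ⟧
⟦⟧-mono {false} h = z≤n
⟦⟧-mono {true} h rewrite h refl = ≤-refl

⟦⟧*-mono : ∀ b {m n} → (b ≡ true → m ≤ n) → ⟦ b ⟧ * m ≤ ⟦ b ⟧ * n
⟦⟧*-mono false h = z≤n
⟦⟧*-mono true h = *-monoʳ-≤ 1 (h refl)

⟦⟧*≤ : ∀ b m → ⟦ b ⟧ * m ≤ m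
⟦⟧*≤ false m = z≤n
⟦⟧*≤ true m = ≤-reflexive (+-identityʳ m)

∧-true : ∀ {a b} → a ∧ b ≡ true → (a ≡ true) × (b ≡ true)
∧-true {true} {true} _ = refl , refl

¬true : ∀ {b} → ¬ b ≡ true → b ≡ false
¬true {false} _ = refl
¬true {true} h = contradiction refl h

true≢false : ∀ {b} {A : Set} → b ≡ true → b ≡ false → A
true≢false refl ()

≤ᵇ-true : ∀ {m n} → (m ≤ᵇ n) ≡ true → m ≤ n
≤ᵇ-true {m} {n} h = ≤ᵇ⇒≤ m n (subst Data.Bool.T (sym h) tt)

≤ᵇ-intro : ∀ {m n} → m ≤ n → (m ≤ᵇ n) ≡ true
≤ᵇ-intro {m} {n} h with m ≤ᵇ n | ≤⇒≤ᵇ h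
... | true | _ = refl

≤ᵇ-false : ∀ {m n} → (m ≤ᵇ n) ≡ false → n < m
≤ᵇ-false {m} {n} h = ≰⇒> λ le → true≢false (≤ᵇ-intro le) h

∑ : {A : Set} → List A → (A → ℕ) → ℕ
∑ [] f = 0
∑ (x ∷ xs) f = f x + ∑ xs f

∑-cong : {A : Set} (xs : List A) {f g : A → ℕ} → (∀ x → f x ≡ g x) → ∑ xs f ≡ ∑ xs g
∑-cong [] h = refl
∑-cong (x ∷ xs) h = cong₂ _+_ (h x) (∑-cong xs h)

∑-mono∈ : {A : Set} (xs : List A) {f g : A → ℕ} → (∀ {x} → x ∈ xs → f x ≤ g x) → ∑ xs f ≤ ∑ xs g
∑-mono∈ [] h = z≤n
∑-mono∈ (x ∷ xs) h = +-mono-≤ (h (here refl)) (∑-mono∈ xs (h ∘ there))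

∑-mono : {A : Set} (xs : List A) {f g : A → ℕ} → (∀ x → f x ≤ g x) → ∑ xs f ≤ ∑ xs g
∑-mono xs h = ∑-mono∈ xs λ {x} _ → h x

∑-zero : {A : Set} (xs : List A) {f : A → ℕ} → (∀ {x} → x ∈ xs → f x ≡ 0) → ∑ xs f ≡ 0
∑-zero [] h = refl
∑-zero (x ∷ xs) h rewrite h (here refl) = ∑-zero xs (h ∘ there)

∑-const : {A : Set} (xs : List A) (c : ℕ) → ∑ xs (λ _ → c) ≡ length xs * c
∑-const [] c = refl
∑-const (x ∷ xs) c = cong (c +_) (∑-const xs c)

∑-+ : {A : Set} (xs : List A) (f g : A → ℕ) → ∑ xs (λ x → f x + g x) ≡ ∑ xs f + ∑ xs g
∑-+ [] f g = refl
∑-+ (x ∷ xs) f g rewrite ∑-+ xs f g =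
  solve 4 (λ a b c d → (a :+ b) :+ (c :+ d) := (a :+ c) :+ (b :+ d)) refl (f x) (g x) (∑ xs f) (∑ xs g)

∑-*ˡ : {A : Set} (xs : List A) (c : ℕ) (f : A → ℕ) → ∑ xs (λ x → c * f x) ≡ c * ∑ xs f
∑-*ˡ [] c f = sym (*-zeroʳ c)
∑-*ˡ (x ∷ xs) c f = trans (cong (c * f x +_) (∑-*ˡ xs c f)) (sym (*-distribˡ-+ c (f x) _))

∑-*ʳ : {A : Set} (xs : List A) (f : A → ℕ) (c : ℕ) → ∑ xs (λ x → f x * c) ≡ ∑ xs f * c
∑-*ʳ xs f c = trans (∑-cong xs λ x → *-comm (f x) c) (trans (∑-*ˡ xs c f) (*-comm c _))

∑-swap : {A B : Set} (xs : List A) (ys : List B) (f : A → B → ℕ) →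
  ∑ xs (λ x → ∑ ys (f x)) ≡ ∑ ys (λ y → ∑ xs (λ x → f x y))
∑-swap [] ys f = sym (∑-zero ys λ _ → refl)
∑-swap (x ∷ xs) ys f = trans (cong (∑ ys (f x) +_) (∑-swap xs ys f))
  (sym (∑-+ ys (f x) (λ y → ∑ xs (λ x → f x y))))

∑-++ : {A : Set} (xs ys : List A) (f : A → ℕ) → ∑ (xs ++ ys) f ≡ ∑ xs f + ∑ ys f
∑-++ [] ys f = refl
∑-++ (x ∷ xs) ys f = trans (cong (f x +_) (∑-++ xs ys f)) (sym (+-assoc (f x) _ _))

∑-map : {A B : Set} (h : A → B) (xs : List A) (f : B → ℕ) → ∑ (map h xs) f ≡ ∑ xs (f ∘ h)
∑-map h [] f = refl
∑-map h (x ∷ xs) f = cong (f (h x) +_) (∑-map h xs f)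

∑-∈ : {A : Set} {xs : List A} {x : A} (f : A → ℕ) → x ∈ xs → f x ≤ ∑ xs f
∑-∈ f (here refl) = m≤m+n _ _
∑-∈ f (there i) = ≤-trans (∑-∈ f i) (m≤n+m _ _)

∑-< : {A : Set} (xs : List A) {f g : A → ℕ} → ∑ xs f < ∑ xs g → ∃[ x ] (x ∈ xs) × f x < g x
∑-< (x ∷ xs) {f} {g} lt with f x <? g x
... | yes p = x , here refl , p
... | no np with ∑-< xs {f} {g} (≰⇒> λ le → <⇒≱ lt (+-mono-≤ (≮⇒≥ np) le))
... | y , i , p = y , there i , p

pigeonhole : {A : Set} (xs : List A) (f : A → ℕ) (c : ℕ) → 0 < length xs →
  ∑ xs f ≤ length xs * c → ∃[ x ] (x ∈ xs) × f x ≤ c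
pigeonhole xs f c pos le
  with ∑-< xs {f} {λ _ → suc c} (subst (∑ xs f <_) (sym (∑-const xs (suc c)))
         (≤-<-trans le (*-monoʳ-< (length xs) {{>-nonZero pos}} (n<1+n c))))
... | x , i , s≤s p = x , i , p

search : {A : Set} {P R : A → Set} → (∀ x → P x ⊎ R x) → (xs : List A) →
  (∀ {x} → x ∈ xs → P x) ⊎ (∃[ x ] (x ∈ xs) × R x)
search d [] = inj₁ λ ()
search d (x ∷ xs) with d x | search d xs
... | inj₂ r | _ = inj₂ (x , here refl , r)
... | inj₁ _ | inj₂ (y , i , r) = inj₂ (y , there i , r)
... | inj₁ p | inj₁ h = inj₁ λ { (here refl) → p ; (there i) → h i }

range : ℕ → List ℕ
range zero = []
range (suc n) = 0 ∷ map suc (range n)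

∈-range⁺ : ∀ {n i} → i < n → i ∈ range n
∈-range⁺ {suc n} {zero} _ = here refl
∈-range⁺ {suc n} {suc i} (s≤s h) = there (∈-map⁺ suc (∈-range⁺ h))

∈-range⁻ : ∀ {n i} → i ∈ range n → i < n
∈-range⁻ {suc n} (here refl) = s≤s z≤n
∈-range⁻ {suc n} (there h) with ∈-map⁻ suc h
... | j , hj , refl = s≤s (∈-range⁻ hj)

length-range : ∀ n → length (range n) ≡ n
length-range zero = refl
length-range (suc n) = cong suc (trans (length-map suc (range n)) (length-range n))

∑-range-suc : ∀ n f → ∑ (range (suc n)) f ≡ ∑ (range n) f + f n
∑-range-suc zero f = +-comm (f 0) 0
∑-range-suc (suc n) f = trans (cong (f 0 +_) (trans (∑-map suc (range (suc n)) f)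
  (trans (∑-range-suc n (f ∘ suc)) (cong (_+ f (suc n)) (sym (∑-map suc (range n) f))))))
  (sym (+-assoc (f 0) _ _))

-- ⌊i/4⌋, by recursion in steps of four so that `geometric-sum` can peel off one block at a time.
-- The rate 1/4 keeps tᵢ² 2^(q4 i), of order 2^(3i/4), below the order of 2^i.
q4 : ℕ → ℕ
q4 (suc (suc (suc (suc i)))) = suc (q4 i)
q4 _ = 0

4*q4≤ : ∀ i → 4 * q4 i ≤ i
4*q4≤ 0 = z≤n
4*q4≤ 1 = z≤n
4*q4≤ 2 = z≤n
4*q4≤ 3 = z≤n
4*q4≤ (suc (suc (suc (suc i)))) = subst (_≤ 4 + i) (sym (*-suc 4 (q4 i))) (+-monoʳ-≤ 4 (4*q4≤ i))

drop-power : ∀ m q {X} → m * 2 ^ q ≤ X → m ≤ X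
drop-power m q h = ≤-trans (m≤m*n m (2 ^ q) {{m^n≢0 2 q}}) h

-- Each block of four indices contributes at most four times a bound that halves from block to
-- block: 4X + 4X/2 + ... ≤ 8X. Rounding is harmless, as an integer with `m * 2 ≤ X` is at most
-- `X / 2`.
geometric-sum : ∀ n (κ : ℕ → ℕ) X → (∀ {i} → i < n → κ i * 2 ^ q4 i ≤ X) → ∑ (range n) κ ≤ 8 * X
geometric-sum 0 κ X h = z≤n
geometric-sum 1 κ X h = +-mono-≤ (drop-power (κ 0) 0 (h (s≤s z≤n))) z≤n
geometric-sum 2 κ X h = +-mono-≤ (drop-power (κ 0) 0 (h (s≤s z≤n))) (+-mono-≤ (drop-power (κ 1) 0 (h (s≤s (s≤s z≤n)))) z≤n)
geometric-sum 3 κ X h = +-mono-≤ (drop-power (κ 0) 0 (h (s≤s z≤n))) (+-mono-≤ (drop-power (κ 1) 0 (h (s≤s (s≤s z≤n))))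
  (+-mono-≤ (drop-power (κ 2) 0 (h (s≤s (s≤s (s≤s z≤n))))) z≤n))
geometric-sum (suc (suc (suc (suc n)))) κ X h = begin
  κ 0 + ∑ (map suc (range (3 + n))) κ ≡⟨ cong (κ 0 +_) (∑-map suc (range (3 + n)) κ) ⟩
  κ 0 + (κ 1 + ∑ (map suc (range (2 + n))) (κ ∘ suc)) ≡⟨ cong (λ z → κ 0 + (κ 1 + z)) (∑-map suc (range (2 + n)) (κ ∘ suc)) ⟩
  κ 0 + (κ 1 + (κ 2 + ∑ (map suc (range (1 + n))) (λ i → κ (2 + i)))) ≡⟨ cong (λ z → κ 0 + (κ 1 + (κ 2 + z))) (∑-map suc (range (1 + n)) (λ i → κ (2 + i))) ⟩
  κ 0 + (κ 1 + (κ 2 + (κ 3 + ∑ (map suc (range n)) (λ i → κ (3 + i))))) ≡⟨ cong (λ z → κ 0 + (κ 1 + (κ 2 + (κ 3 + z)))) (∑-map suc (range n) (λ i → κ (3 + i))) ⟩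
  κ 0 + (κ 1 + (κ 2 + (κ 3 + ∑ (range n) (λ i → κ (4 + i))))) ≤⟨ +-mono-≤ (small 0 (s≤s z≤n) refl) (+-mono-≤ (small 1 (s≤s (s≤s z≤n)) refl) (+-mono-≤ (small 2 (s≤s (s≤s (s≤s z≤n))) refl) (+-mono-≤ (small 3 (s≤s (s≤s (s≤s (s≤s z≤n)))) refl) rest))) ⟩
  X + (X + (X + (X + 8 * (X / 2)))) ≡⟨ solve 2 (λ x y → x :+ (x :+ (x :+ (x :+ con 8 :* y))) := con 4 :* x :+ con 4 :* (y :* con 2)) refl X (X / 2) ⟩
  4 * X + 4 * (X / 2 * 2) ≤⟨ +-monoʳ-≤ (4 * X) (*-monoʳ-≤ 4 (m/n*n≤m X 2)) ⟩
  4 * X + 4 * X ≡⟨ solve 1 (λ x → con 4 :* x :+ con 4 :* x := con 8 :* x) refl X ⟩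
  8 * X ∎
  where
  open ≤-Reasoning
  small : ∀ i → i < 4 + n → q4 i ≡ 0 → κ i ≤ X
  small i lt e = subst (_≤ X) (*-identityʳ (κ i)) (subst (λ z → κ i * 2 ^ z ≤ X) e (h lt))
  half : ∀ {m} → m * 2 ≤ X → m ≤ X / 2
  half {m} le = subst (_≤ X / 2) (m*n/n≡m m 2) (/-mono-≤ le (≤-refl {2}))
  rest : ∑ (range n) (λ i → κ (4 + i)) ≤ 8 * (X / 2)
  rest = geometric-sum n (λ i → κ (4 + i)) (X / 2) λ {i} lt →
    half (≤-trans (≤-reflexive (solve 2 (λ a b → (a :* b) :* con 2 := a :* (con 2 :* b)) refl (κ (4 + i)) (2 ^ q4 i)))
      (h (s≤s (s≤s (s≤s (s≤s lt))))))

-- Finite sets and greedy choices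

-- Completeness and absence of repetitions in one equation, in the form used by double counting.
Enumerates : {V : Set} → DecidableEquality V → List V → Set
Enumerates _≟_ vs = ∀ x → ∑ vs (λ y → ⟦ does (x ≟ y) ⟧) ≡ 1

infixr 7 _∩_
infixl 7 _∖_

_∩_ _∖_ : {V : Set} → (V → Bool) → (V → Bool) → V → Bool
(P ∩ R) x = P x ∧ R x
(P ∖ R) x = P x ∧ not (R x)

infix 4 _⊆_
_⊆_ : {V : Set} → (V → Bool) → (V → Bool) → Set
P ⊆ R = ∀ x → P x ≡ true → R x ≡ true

Disjoint : {V : Set} → (V → Bool) → (V → Bool) → Set
Disjoint P R = ∀ x → P x ≡ true → R x ≡ true → ⊥

∖-split : {V : Set} (P R : V → Bool) → R ⊆ P → ∀ x → ⟦ P x ⟧ ≡ ⟦ (P ∖ R) x ⟧ + ⟦ R x ⟧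
∖-split P R sub x with P x in eP | R x in eR
... | true | true = refl
... | true | false = refl
... | false | false = refl
... | false | true = true≢false (sub x eR) eP

∩-split : {V : Set} (P R : V → Bool) → ∀ x → ⟦ P x ⟧ ≡ ⟦ (P ∖ R) x ⟧ + ⟦ (P ∩ R) x ⟧
∩-split P R x with P x | R x
... | true | true = refl
... | true | false = refl
... | false | _ = refl

module FiniteSet {V : Set} (_≟ᵥ_ : DecidableEquality V) (vs : List V) (enum : Enumerates _≟ᵥ_ vs) where

  ≟-sym : ∀ x y → does (x ≟ᵥ y) ≡ does (y ≟ᵥ x)
  ≟-sym x y with x ≟ᵥ y
  ... | yes refl = sym (dec-true (x ≟ᵥ x) refl)
  ... | no ne = sym (dec-false (y ≟ᵥ x) (ne ∘ sym))

  ∈-all : ∀ x → x ∈ vs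
  ∈-all x with ∑-< vs {λ _ → 0} {λ y → ⟦ does (x ≟ᵥ y) ⟧}
                 (subst₂ _<_ (sym (∑-zero vs λ _ → refl)) (sym (enum x)) (s≤s z≤n))
  ... | y , i , lt with x ≟ᵥ y
  ... | yes refl = i
  ∈-all x | y , i , () | no _

  ∑-point : ∀ x (f : V → ℕ) → ∑ vs (λ y → ⟦ does (x ≟ᵥ y) ⟧ * f y) ≡ f x
  ∑-point x f = trans (∑-cong vs eq) (trans (∑-*ʳ vs _ (f x)) (trans (cong (_* f x) (enum x)) (*-identityˡ (f x))))
    where
    eq : ∀ y → ⟦ does (x ≟ᵥ y) ⟧ * f y ≡ ⟦ does (x ≟ᵥ y) ⟧ * f x
    eq y with x ≟ᵥ y
    ... | yes refl = refl
    ... | no _ = refl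

  # : (V → Bool) → ℕ
  # P = ∑ vs λ x → ⟦ P x ⟧

  #-mono : ∀ {P R} → P ⊆ R → # P ≤ # R
  #-mono sub = ∑-mono vs λ x → ⟦⟧-mono (sub x)

  #-∖ : ∀ P R → R ⊆ P → # P ≡ # (P ∖ R) + # R
  #-∖ P R sub = trans (∑-cong vs (∖-split P R sub)) (∑-+ vs _ _)

  #-∩ : ∀ P R → # P ≡ # (P ∖ R) + # (P ∩ R)
  #-∩ P R = trans (∑-cong vs (∩-split P R)) (∑-+ vs _ _)

  #-inhabited : ∀ P → 0 < # P → ∃[ x ] P x ≡ true
  #-inhabited P pos with ∑-< vs {λ _ → 0} {λ x → ⟦ P x ⟧} (subst (_< # P) (sym (∑-zero vs λ _ → refl)) pos)
  ... | x , _ , lt = x , proj₁ (<⟦⟧ lt)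

  singleton : V → V → Bool
  singleton x y = does (x ≟ᵥ y)

  singleton-⊆ : ∀ {P x} → P x ≡ true → singleton x ⊆ P
  singleton-⊆ {P} {x} px y h with x ≟ᵥ y
  ... | yes refl = px
  singleton-⊆ px y () | no _

  shrink : ∀ k P h → # P ≡ k + h → ∃[ R ] (R ⊆ P) × # R ≡ h
  shrink zero P h eq = P , (λ _ p → p) , eq
  shrink (suc k) P h eq with #-inhabited P (subst (0 <_) (sym eq) (s≤s z≤n))
  ... | x , px with shrink k (P ∖ singleton x) h
                      (suc-injective (trans (sym (trans (#-∖ P (singleton x) (singleton-⊆ px))
                        (trans (cong (# (P ∖ singleton x) +_) (enum x)) (+-comm _ 1)))) eq))
  ... | R , sub , c = R , (λ y r → proj₁ (∧-true (sub y r))) , c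

  pick : ∀ P h → h ≤ # P → ∃[ R ] (R ⊆ P) × # R ≡ h
  pick P h le = shrink (# P ∸ h) P h (sym (m∸n+n≡m le))

  -- The indicator equation says at once that the pieces are disjoint, lie in `P` and, together with
  -- `left`, exhaust it. `maximal` refers to the final `left`: no further piece can be cut from any
  -- `F i`.
  record Extraction {I : Set} (F : I → V → Bool) (is : List I) (h : ℕ) (P : V → Bool) : Set where
    field
      pieces : List (I × (V → Bool))
      left : V → Bool
      partition : ∀ x → ⟦ P x ⟧ ≡ ⟦ left x ⟧ + ∑ pieces (λ C → ⟦ proj₂ C x ⟧)
      piece : ∀ {C} → C ∈ pieces → (# (proj₂ C) ≡ h) × (proj₂ C ⊆ F (proj₁ C)) × proj₁ C ∈ is
      maximal : ∀ {i} → i ∈ is → # (F i ∩ left) < h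

  -- `k` bounds the vertices still present and serves as fuel, since each piece removes `h > 0` of
  -- them.
  extract : {I : Set} (F : I → V → Bool) (is : List I) (h : ℕ) → 0 < h → ∀ k P → # P ≤ k → Extraction F is h P
  extract {I} F is h pos k P le with search step is
    where
    step : ∀ i → (# (F i ∩ P) < h) ⊎ (h ≤ # (F i ∩ P))
    step i with # (F i ∩ P) <? h
    ... | yes p = inj₁ p
    ... | no np = inj₂ (≮⇒≥ np)
  ... | inj₁ small = record
    { pieces = [] ; left = P ; partition = λ x → sym (+-identityʳ _) ; piece = λ () ; maximal = small }
  ... | inj₂ (i , i∈ , big) with pick (F i ∩ P) h big
  ... | C , sub , sz = add k le
    where
    C⊆P : C ⊆ P
    C⊆P x c = proj₂ (∧-true (sub x c))
    smaller : # (P ∖ C) < # P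
    smaller = subst (# (P ∖ C) <_) (sym (trans (#-∖ P C C⊆P) (cong (# (P ∖ C) +_) sz)))
      (m<m+n (# (P ∖ C)) pos)
    add : ∀ k → # P ≤ k → Extraction F is h P
    add zero le = contradiction smaller (subst (λ z → ¬ # (P ∖ C) < z) (sym (n≤0⇒n≡0 le)) λ ())
    add (suc k) le = record
      { pieces = (i , C) ∷ pieces
      ; left = left
      ; partition = λ x → trans (∖-split P C C⊆P x) (trans (cong (_+ ⟦ C x ⟧) (partition x))
          (trans (+-assoc ⟦ left x ⟧ _ _) (cong (⟦ left x ⟧ +_) (+-comm _ ⟦ C x ⟧))))
      ; piece = λ { (here refl) → sz , (λ x c → proj₁ (∧-true (sub x c))) , i∈ ; (there m) → piece m }
      ; maximal = maximal }
      where open Extraction (extract F is h pos k (P ∖ C) (≤-pred (<-≤-trans smaller le)))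

module Greedy {Q V : Set} (_≟q_ : DecidableEquality Q) (qs : List Q) (enumQ : Enumerates _≟q_ qs) (vs : List V)
  (ok : Q → V → Bool) (conf : Q → V → Q → V → Bool) (kills : Q → Q → ℕ) where

  different : Q → Q → Bool
  different p q = not (does (p ≟q q))

  -- `few` holds for every admissible `y` at `q`, so any order of choices works: those made before
  -- `p` exclude fewer candidates than `room` provides.
  greedy :
    (∀ p q x y → conf p x q y ≡ conf q y p x) →
    (∀ p q y → different p q ≡ true → ok q y ≡ true → ∑ vs (λ x → ⟦ ok p x ∧ conf p x q y ⟧) ≤ kills p q) →
    (∀ p → ∑ qs (λ q → ⟦ different p q ⟧ * kills p q) < ∑ vs (λ x → ⟦ ok p x ⟧)) →
    ∃[ f ] (∀ p → ok p (f p) ≡ true) × (∀ p q → different p q ≡ true → conf p (f p) q (f q) ≡ false)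
  greedy conf-sym few room = finish (run qs)
    where
    open FiniteSet _≟q_ qs enumQ using (∈-all)
    State : (Q → Bool) → Set
    State D = Σ (Q → V) λ f → (∀ p → ok p (f p) ≡ true) ×
      (∀ p q → D p ≡ true → D q ≡ true → different p q ≡ true → conf p (f p) q (f q) ≡ false)
    -- Choices outside `D` are admissible placeholders that are replaced later.
    start : State (λ _ → false)
    start = (λ p → proj₁ (w p)) , (λ p → proj₂ (w p)) , λ _ _ ()
      where
      w : ∀ p → ∃[ x ] ok p x ≡ true
      w p with ∑-< vs {λ _ → 0} {λ x → ⟦ ok p x ⟧} (subst (_< ∑ vs (λ x → ⟦ ok p x ⟧)) (sym (∑-zero vs λ _ → refl)) (≤-<-trans z≤n (room p)))
      ... | x , _ , lt = x , proj₁ (<⟦⟧ lt)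
    step : ∀ D p → State D → ∃[ D′ ] State D′ × (∀ q → D q ≡ true → D′ q ≡ true) × (D′ p ≡ true)
    step D p (f , fok , fc) with D p in dp
    ... | true = D , (f , fok , fc) , (λ _ h → h) , dp
    ... | false = D′ , (f′ , ok′ , c′) , (λ q h → D⊆ q h) , D′p
      where
      D′ : Q → Bool
      D′ q = D q ∨ does (p ≟q q)
      D⊆ : ∀ q → D q ≡ true → D′ q ≡ true
      D⊆ q h rewrite h = refl
      D′p : D′ p ≡ true
      D′p rewrite dp | dec-true (p ≟q p) refl = refl
      killed : V → ℕ
      killed x = ∑ qs λ q → ⟦ D q ⟧ * ⟦ ok p x ∧ conf p x q (f q) ⟧
      Dq⇒≢ : ∀ q → D q ≡ true → different p q ≡ true
      Dq⇒≢ q dq with p ≟q q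
      ... | yes refl = true≢false dq dp
      ... | no _ = refl
      killed-few : ∑ vs killed ≤ ∑ qs (λ q → ⟦ different p q ⟧ * kills p q)
      killed-few = subst (_≤ _) (∑-swap qs vs _) (∑-mono qs λ q → subst (_≤ _) (sym (∑-*ˡ vs ⟦ D q ⟧ _)) (bound q))
        where
        bound : ∀ q → ⟦ D q ⟧ * ∑ vs (λ x → ⟦ ok p x ∧ conf p x q (f q) ⟧) ≤ ⟦ different p q ⟧ * kills p q
        bound q with D q in dq
        ... | false = z≤n
        ... | true rewrite Dq⇒≢ q dq = *-monoʳ-≤ 1 (few p q (f q) (Dq⇒≢ q dq) (fok q))
      found : ∃[ x ] (ok p x ≡ true) × (killed x ≡ 0)
      found with ∑-< vs (≤-<-trans killed-few (room p))
      ... | x , _ , lt = x , <⟦⟧ lt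
      x₀ : V
      x₀ = proj₁ found
      free : ∀ q → D q ≡ true → conf p x₀ q (f q) ≡ false
      free q dq = ¬true λ c → case ≤-trans (≤-reflexive (val c)) (≤-trans (∑-∈ (λ q → ⟦ D q ⟧ * ⟦ ok p x₀ ∧ conf p x₀ q (f q) ⟧) (∈-all q)) (≤-reflexive (proj₂ (proj₂ found)))) of λ ()
        where
        val : conf p x₀ q (f q) ≡ true → 1 ≡ ⟦ D q ⟧ * ⟦ ok p x₀ ∧ conf p x₀ q (f q) ⟧
        val c rewrite dq | proj₁ (proj₂ found) | c = refl
      f′ : Q → V
      f′ q = if does (p ≟q q) then x₀ else f q
      ok′ : ∀ q → ok q (f′ q) ≡ true
      ok′ q with p ≟q q
      ... | yes refl = proj₁ (proj₂ found)
      ... | no _ = fok q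
      strip : ∀ b → b ∨ false ≡ true → b ≡ true
      strip true _ = refl
      c′ : ∀ q r → D′ q ≡ true → D′ r ≡ true → different q r ≡ true → conf q (f′ q) r (f′ r) ≡ false
      c′ q r dq dr ne with p ≟q q | p ≟q r
      ... | yes refl | yes refl rewrite dec-true (p ≟q p) refl = case ne of λ ()
      ... | yes refl | no _ = free r (strip _ dr)
      ... | no _ | yes refl = trans (conf-sym q p (f q) x₀) (free q (strip _ dq))
      ... | no _ | no _ = fc q r (strip _ dq) (strip _ dr) ne
    run : ∀ ps → ∃[ D ] State D × (∀ {p} → p ∈ ps → D p ≡ true)
    run [] = _ , start , λ ()
    run (p ∷ ps) with run ps
    ... | D , s , h with step D p s
    ... | D′ , s′ , sub , dp = D′ , s′ , λ { (here refl) → dp ; (there i) → sub _ (h i) }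
    finish : (∃[ D ] State D × (∀ {p} → p ∈ qs → D p ≡ true)) → _
    finish (D , (f , fok , fc) , all) = f , fok , λ p q ne → fc p q (all (∈-all p)) (all (∈-all q)) ne

-- The cube and its layers

infix 7 _==_
_==_ : Bool → Bool → Bool
true == b = b
false == b = not b

==-refl : ∀ x → x == x ≡ true
==-refl true = refl
==-refl false = refl

==⇒≡ : ∀ x y → x == y ≡ true → x ≡ y
==⇒≡ true true _ = refl
==⇒≡ false false _ = refl

_≟q_ : ∀ {n} → DecidableEquality (Vec Bool n)
_≟q_ = Vec.≡-dec Bool._≟_

cube : ∀ n → List (Vec Bool n)
cube zero = [] ∷ []
cube (suc n) = map (false ∷_) (cube n) ++ map (true ∷_) (cube n)

∑-cube-suc : ∀ n (f : Vec Bool (suc n) → ℕ) →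
  ∑ (cube (suc n)) f ≡ ∑ (cube n) (λ p → f (false ∷ p)) + ∑ (cube n) (λ p → f (true ∷ p))
∑-cube-suc n f = trans (∑-++ (map (false ∷_) (cube n)) _ f)
  (cong₂ _+_ (∑-map (false ∷_) (cube n) f) (∑-map (true ∷_) (cube n) f))

cube-enum : ∀ n → Enumerates _≟q_ (cube n)
cube-enum zero [] = refl
cube-enum (suc n) (false ∷ p) = trans (∑-cube-suc n (λ q → ⟦ does ((false ∷ p) ≟q q) ⟧))
  (cong₂ _+_ (cube-enum n p) (∑-zero (cube n) λ _ → refl))
cube-enum (suc n) (true ∷ p) = trans (∑-cube-suc n (λ q → ⟦ does ((true ∷ p) ≟q q) ⟧))
  (cong₂ _+_ (∑-zero (cube n) {λ q → ⟦ does ((true ∷ p) ≟q (false ∷ q)) ⟧} λ _ → refl) (cube-enum n p))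

∈-cube : ∀ {n} (p : Vec Bool n) → p ∈ cube n
∈-cube {n} = FiniteSet.∈-all _≟q_ (cube n) (cube-enum n)

∑-cube-1 : ∀ n → ∑ (cube n) (λ _ → 1) ≡ 2 ^ n
∑-cube-1 zero = refl
∑-cube-1 (suc n) = trans (∑-cube-suc n (λ _ → 1)) (trans (cong₂ _+_ (∑-cube-1 n) (∑-cube-1 n))
  (cong (2 ^ n +_) (sym (+-identityʳ (2 ^ n)))))

-- The vertices agreeing with `p` up to `a` form a cell, a subcube of codimension `a`. Two cells are
-- nested or disjoint, on which packing from coarse to fine relies.
agree : ∀ {n} → ℕ → Vec Bool n → Vec Bool n → Bool
agree zero _ _ = true
agree (suc a) [] [] = true
agree (suc a) (x ∷ p) (y ∷ q) = x == y ∧ agree a p q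

flip : ∀ {n} → ℕ → Vec Bool n → Vec Bool n
flip _ [] = []
flip zero (x ∷ p) = not x ∷ p
flip (suc i) (x ∷ p) = x ∷ flip i p

wt : ∀ {n} → ℕ → Vec Bool n → ℕ
wt zero _ = 0
wt (suc K) [] = 0
wt (suc K) (x ∷ p) = ⟦ x ⟧ + wt K p

agree-refl : ∀ {n} a (p : Vec Bool n) → agree a p p ≡ true
agree-refl zero p = refl
agree-refl (suc a) [] = refl
agree-refl (suc a) (x ∷ p) rewrite ==-refl x = agree-refl a p

agree-sym : ∀ {n} a (p q : Vec Bool n) → agree a p q ≡ agree a q p
agree-sym zero p q = refl
agree-sym (suc a) [] [] = refl
agree-sym (suc a) (x ∷ p) (y ∷ q) = cong₂ _∧_ (==-sym x y) (agree-sym a p q)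
  where
  ==-sym : ∀ x y → x == y ≡ y == x
  ==-sym true true = refl
  ==-sym true false = refl
  ==-sym false true = refl
  ==-sym false false = refl

agree-trans : ∀ {n} a {p q r : Vec Bool n} → agree a p q ≡ true → agree a q r ≡ true → agree a p r ≡ true
agree-trans zero _ _ = refl
agree-trans (suc a) {[]} {[]} {[]} _ _ = refl
agree-trans (suc a) {x ∷ p} {y ∷ q} {z ∷ r} h k
  with ==⇒≡ x y (proj₁ (∧-true h)) | ==⇒≡ y z (proj₁ (∧-true {y == z} k))
... | refl | refl rewrite ==-refl x = agree-trans a h k

agree-mono : ∀ {n} {a b} (p q : Vec Bool n) → a ≤ b → agree b p q ≡ true → agree a p q ≡ true
agree-mono p q z≤n h = refl
agree-mono [] [] (s≤s le) h = refl
agree-mono (x ∷ p) (y ∷ q) (s≤s le) h with x == y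
... | true = agree-mono p q le h

agree-all : ∀ {n} (p q : Vec Bool n) → agree n p q ≡ true → p ≡ q
agree-all [] [] _ = refl
agree-all (x ∷ p) (y ∷ q) h = cong₂ _∷_ (==⇒≡ x y (proj₁ (∧-true h))) (agree-all p q (proj₂ (∧-true {x == y} h)))

agree-flip : ∀ {n} a i (p q : Vec Bool n) → agree a p q ≡ true → agree a (flip i p) (flip i q) ≡ true
agree-flip zero i p q h = refl
agree-flip (suc a) i [] [] h = refl
agree-flip (suc a) zero (x ∷ p) (y ∷ q) h with ==⇒≡ x y (proj₁ (∧-true h))
... | refl rewrite ==-refl x | ==-refl (not x) = h
agree-flip (suc a) (suc i) (x ∷ p) (y ∷ q) h with x == y
... | true = agree-flip a i p q h

agree-flip-≥ : ∀ {n} {a i} (p : Vec Bool n) → a ≤ i → agree a p (flip i p) ≡ true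
agree-flip-≥ p z≤n = refl
agree-flip-≥ [] (s≤s le) = refl
agree-flip-≥ (x ∷ p) (s≤s le) rewrite ==-refl x = agree-flip-≥ p le

flip-involutive : ∀ {n} i (p : Vec Bool n) → flip i (flip i p) ≡ p
flip-involutive i [] = refl
flip-involutive zero (x ∷ p) = cong (_∷ p) (Bool.not-involutive x)
flip-involutive (suc i) (x ∷ p) = cong (x ∷_) (flip-involutive i p)

diffCount-0 : ∀ {n} (u v : Vec Bool n) → diffCount u v ≡ 0 → u ≡ v
diffCount-0 [] [] _ = refl
diffCount-0 (true ∷ u) (true ∷ v) h = cong (true ∷_) (diffCount-0 u v h)
diffCount-0 (false ∷ u) (false ∷ v) h = cong (false ∷_) (diffCount-0 u v h)

QAdj⇒flip : ∀ {n} (u v : Vec Bool n) → QAdj u v → ∃[ i ] (i < n) × v ≡ flip i u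
QAdj⇒flip [] [] ()
QAdj⇒flip (true ∷ u) (true ∷ v) h with QAdj⇒flip u v h
... | i , lt , refl = suc i , s≤s lt , refl
QAdj⇒flip (false ∷ u) (false ∷ v) h with QAdj⇒flip u v h
... | i , lt , refl = suc i , s≤s lt , refl
QAdj⇒flip (true ∷ u) (false ∷ v) h = 0 , s≤s z≤n , cong (false ∷_) (sym (diffCount-0 u v (suc-injective h)))
QAdj⇒flip (false ∷ u) (true ∷ v) h = 0 , s≤s z≤n , cong (true ∷_) (sym (diffCount-0 u v (suc-injective h)))

diffCount-refl : ∀ {n} (u : Vec Bool n) → diffCount u u ≡ 0
diffCount-refl [] = refl
diffCount-refl (true ∷ u) = diffCount-refl u
diffCount-refl (false ∷ u) = diffCount-refl u

flip⇒QAdj : ∀ {n} i (u : Vec Bool n) → i < n → QAdj u (flip i u)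
flip⇒QAdj zero (true ∷ u) _ = cong suc (diffCount-refl u)
flip⇒QAdj zero (false ∷ u) _ = cong suc (diffCount-refl u)
flip⇒QAdj (suc i) (true ∷ u) (s≤s lt) = flip⇒QAdj i u lt
flip⇒QAdj (suc i) (false ∷ u) (s≤s lt) = flip⇒QAdj i u lt

#-agree : ∀ n a (p : Vec Bool n) → ∑ (cube n) (λ q → ⟦ agree a p q ⟧) ≡ 2 ^ (n ∸ a)
#-agree n zero p = ∑-cube-1 n
#-agree zero (suc a) [] = refl
#-agree (suc n) (suc a) (false ∷ p) = trans (∑-cube-suc n (λ q → ⟦ agree (suc a) (false ∷ p) q ⟧))
  (trans (cong₂ _+_ (#-agree n a p) (∑-zero (cube n) λ _ → refl)) (+-identityʳ _))
#-agree (suc n) (suc a) (true ∷ p) = trans (∑-cube-suc n (λ q → ⟦ agree (suc a) (true ∷ p) q ⟧))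
  (cong₂ _+_ (∑-zero (cube n) {λ q → ⟦ agree (suc a) (true ∷ p) (false ∷ q) ⟧} λ _ → refl) (#-agree n a p))

-- Binomial coefficients and the size of a layer

bin : ℕ → ℕ → ℕ
bin _ zero = 1
bin zero (suc w) = 0
bin (suc K) (suc w) = bin K w + bin K (suc w)

#-wt : ∀ n K w → K ≤ n → ∑ (cube n) (λ p → ⟦ wt K p ≡ᵇ w ⟧) ≡ bin K w * 2 ^ (n ∸ K)
#-wt n zero zero le = trans (∑-cube-1 n) (sym (+-identityʳ _))
#-wt n zero (suc w) le = ∑-zero (cube n) λ _ → refl
#-wt (suc n) (suc K) zero (s≤s le) = trans (∑-cube-suc n (λ p → ⟦ wt (suc K) p ≡ᵇ 0 ⟧))
  (trans (cong₂ _+_ (#-wt n K 0 le) (∑-zero (cube n) λ _ → refl)) (+-identityʳ _))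
#-wt (suc n) (suc K) (suc w) (s≤s le) = trans (∑-cube-suc n (λ p → ⟦ wt (suc K) p ≡ᵇ suc w ⟧))
  (trans (cong₂ _+_ (#-wt n K (suc w) le) (#-wt n K w le))
    (trans (+-comm (bin K (suc w) * 2 ^ (n ∸ K)) _) (sym (*-distribʳ-+ (2 ^ (n ∸ K)) (bin K w) _))))

wt≤ : ∀ {n} K (p : Vec Bool n) → wt K p ≤ K
wt≤ zero p = z≤n
wt≤ (suc K) [] = z≤n
wt≤ (suc K) (x ∷ p) = +-mono-≤ (⟦⟧≤1 x) (wt≤ K p)

agree⇒wt : ∀ {n} K (p q : Vec Bool n) → agree K p q ≡ true → wt K p ≡ wt K q
agree⇒wt zero p q h = refl
agree⇒wt (suc K) [] [] h = refl
agree⇒wt (suc K) (x ∷ p) (y ∷ q) h =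
  cong₂ (λ a b → ⟦ a ⟧ + b) (==⇒≡ x y (proj₁ (∧-true h))) (agree⇒wt K p q (proj₂ (∧-true {x == y} h)))

Consecutive : ℕ → ℕ → Set
Consecutive u v = (v ≡ u) ⊎ (v ≡ suc u) ⊎ (u ≡ suc v)

wt-flip : ∀ {n} K i (p : Vec Bool n) → Consecutive (wt K p) (wt K (flip i p))
wt-flip zero i p = inj₁ refl
wt-flip (suc K) i [] = inj₁ refl
wt-flip (suc K) zero (true ∷ p) = inj₂ (inj₂ refl)
wt-flip (suc K) zero (false ∷ p) = inj₂ (inj₁ refl)
wt-flip (suc K) (suc i) (x ∷ p) with wt-flip K i p
... | inj₁ e = inj₁ (cong (⟦ x ⟧ +_) e)
... | inj₂ (inj₁ e) = inj₂ (inj₁ (trans (cong (⟦ x ⟧ +_) e) (+-suc ⟦ x ⟧ _)))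
... | inj₂ (inj₂ e) = inj₂ (inj₂ (trans (cong (⟦ x ⟧ +_) e) (+-suc ⟦ x ⟧ _)))

range-enum : ∀ m v → v < m → ∑ (range m) (λ w → ⟦ v ≡ᵇ w ⟧) ≡ 1
range-enum (suc m) zero _ = cong suc (trans (∑-map suc (range m) _) (∑-zero (range m) λ _ → refl))
range-enum (suc m) (suc v) (s≤s lt) = trans (∑-map suc (range m) _) (range-enum m v lt)

-- Absorption; monotonicity on both sides of the middle and the ratio of central coefficients follow
-- from it without factorials.
bin-absorb : ∀ K w → suc w * bin (suc K) (suc w) ≡ suc K * bin K w
bin-absorb zero zero = refl
bin-absorb zero (suc w) = *-zeroʳ (suc (suc w))
bin-absorb (suc K) zero = trans (cong suc (trans (+-identityʳ _) (trans (sym (*-identityˡ _)) (bin-absorb K 0)))) refl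
bin-absorb (suc K) (suc w) = begin
  suc (suc w) * (A + B) ≡⟨ solve 3 (λ w a b → (con 1 :+ w) :* (a :+ b) := a :+ (w :* a :+ (con 1 :+ w) :* b)) refl (suc w) A B ⟩
  A + (suc w * A + suc (suc w) * B) ≡⟨ cong₂ (λ x y → A + (x + y)) (bin-absorb K w) (bin-absorb K (suc w)) ⟩
  A + (suc K * bin K w + suc K * bin K (suc w)) ≡⟨ cong (A +_) (sym (*-distribˡ-+ (suc K) (bin K w) _)) ⟩
  suc (suc K) * A ∎
  where
  open ≡-Reasoning
  A = bin (suc K) (suc w)
  B = bin (suc K) (suc (suc w))

-- Absorption gives `(w + 1) * (b + b′) = (2m + 1) * b`, so `b ≤ b′` follows from
-- `2 * (w + 1) ≤ 2m + 1`; `bin-fall` is the opposite case.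
bin-rise : ∀ m w → w < m → bin (2 * m) w ≤ bin (2 * m) (suc w)
bin-rise m w lt = *-cancelˡ-≤ (suc w) (+-cancelˡ-≤ (suc w * b) _ _ (begin
  suc w * b + suc w * b ≡⟨ solve 2 (λ x y → x :* y :+ x :* y := (con 2 :* x) :* y) refl (suc w) b ⟩
  (2 * suc w) * b ≤⟨ *-monoˡ-≤ b (≤-trans (*-monoʳ-≤ 2 lt) (n≤1+n (2 * m))) ⟩
  suc (2 * m) * b ≡⟨ sym (bin-absorb (2 * m) w) ⟩
  suc w * (b + b′) ≡⟨ *-distribˡ-+ (suc w) b b′ ⟩
  suc w * b + suc w * b′ ∎))
  where
  open ≤-Reasoning
  b = bin (2 * m) w
  b′ = bin (2 * m) (suc w)

bin-fall : ∀ m w → m ≤ w → bin (2 * m) (suc w) ≤ bin (2 * m) w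
bin-fall m w le = *-cancelˡ-≤ (suc w) (+-cancelˡ-≤ (suc w * b) _ _ (begin
  suc w * b + suc w * b′ ≡⟨ sym (*-distribˡ-+ (suc w) b b′) ⟩
  suc w * (b + b′) ≡⟨ bin-absorb (2 * m) w ⟩
  suc (2 * m) * b ≤⟨ *-monoˡ-≤ b (≤-trans (s≤s (*-monoʳ-≤ 2 le)) (≤-trans (n≤1+n _) (≤-reflexive (sym (*-suc 2 w))))) ⟩
  (2 * suc w) * b ≡⟨ solve 2 (λ x y → (con 2 :* x) :* y := x :* y :+ x :* y) refl (suc w) b ⟩
  suc w * b + suc w * b ∎))
  where
  open ≤-Reasoning
  b = bin (2 * m) w
  b′ = bin (2 * m) (suc w)

bin-peak : ∀ m w → bin (2 * m) w ≤ bin (2 * m) m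
bin-peak m w with ≤-total w m
... | inj₁ le = up (m ∸ w) w (m∸n+n≡m le)
  where
  up : ∀ d w → d + w ≡ m → bin (2 * m) w ≤ bin (2 * m) m
  up zero w refl = ≤-refl
  up (suc d) w e = ≤-trans (bin-rise m w (subst (suc w ≤_) e (s≤s (m≤n+m w d))))
    (up d (suc w) (trans (+-suc d w) e))
... | inj₂ le = subst (λ z → bin (2 * m) z ≤ bin (2 * m) m) (m∸n+n≡m le) (down (w ∸ m))
  where
  down : ∀ d → bin (2 * m) (d + m) ≤ bin (2 * m) m
  down zero = ≤-refl
  down (suc d) = ≤-trans (bin-fall m (d + m) (m≤n+m m d)) (down d)

central-step : ∀ m → suc m * bin (2 * suc m) (suc m) ≡ 2 * (suc (2 * m) * bin (2 * m) m)
central-step m = begin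
  suc m * bin (2 * suc m) (suc m) ≡⟨ cong (λ z → suc m * bin z (suc m)) (*-suc 2 m) ⟩
  suc m * (x + y) ≡⟨ cong (λ z → suc m * (z + y)) x≡y ⟩
  suc m * (y + y) ≡⟨ solve 2 (λ a b → a :* (b :+ b) := con 2 :* (a :* b)) refl (suc m) y ⟩
  2 * (suc m * y) ≡⟨ cong (2 *_) (bin-absorb (2 * m) m) ⟩
  2 * (suc (2 * m) * bin (2 * m) m) ∎
  where
  open ≡-Reasoning
  x = bin (suc (2 * m)) m
  y = bin (suc (2 * m)) (suc m)
  -- The two middle coefficients agree, again by absorption: `(m + 1) * (x + y) = (2m + 2) * x`.
  x≡y : x ≡ y
  x≡y = *-cancelˡ-≡ x y (suc m) (+-cancelˡ-≡ (suc m * x) _ _ (sym (trans (sym (*-distribˡ-+ (suc m) x y))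
    (trans (bin-absorb (suc (2 * m)) m)
      (solve 2 (λ a b → (con 2 :+ con 2 :* a) :* b := (con 1 :+ a) :* b :+ (con 1 :+ a) :* b) refl m x)))))

-- C(2m,m) ≤ 4^m/√(2m+1), squared. The ratio of consecutive left sides is 4(2m+1)(2m+3)/(m+1)²,
-- which is below 16 because (2m+1)(2m+3) + 1 = (2m+2)².
central-bound : ∀ m → bin (2 * m) m * bin (2 * m) m * suc (2 * m) ≤ 16 ^ m
central-bound zero = ≤-refl
central-bound (suc m) = *-cancelˡ-≤ (suc m * suc m) (begin
  (suc m * suc m) * (C * C * suc (2 * suc m)) ≡⟨ solve 3 (λ a c d → (a :* a) :* (c :* c :* d) := (a :* c) :* (a :* c) :* d) refl (suc m) C (suc (2 * suc m)) ⟩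
  (suc m * C) * (suc m * C) * suc (2 * suc m) ≡⟨ cong (λ z → z * z * suc (2 * suc m)) (central-step m) ⟩
  (2 * (suc (2 * m) * c)) * (2 * (suc (2 * m) * c)) * suc (2 * suc m)
    ≡⟨ solve 2 (λ m c → (con 2 :* ((con 1 :+ con 2 :* m) :* c)) :* (con 2 :* ((con 1 :+ con 2 :* m) :* c)) :* (con 1 :+ con 2 :* (con 1 :+ m))
         := (con 4 :* ((con 1 :+ con 2 :* m) :* (con 3 :+ con 2 :* m))) :* (c :* c :* (con 1 :+ con 2 :* m))) refl m c ⟩
  (4 * (suc (2 * m) * (3 + 2 * m))) * (c * c * suc (2 * m)) ≤⟨ *-monoʳ-≤ (4 * (suc (2 * m) * (3 + 2 * m))) (central-bound m) ⟩
  (4 * (suc (2 * m) * (3 + 2 * m))) * 16 ^ m ≤⟨ *-monoˡ-≤ (16 ^ m) (≤-trans (m≤m+n _ 4) (≤-reflexive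
    (solve 1 (λ m → (con 4 :* ((con 1 :+ con 2 :* m) :* (con 3 :+ con 2 :* m))) :+ con 4 := ((con 1 :+ m) :* (con 1 :+ m)) :* con 16) refl m))) ⟩
  ((suc m * suc m) * 16) * 16 ^ m ≡⟨ *-assoc (suc m * suc m) 16 (16 ^ m) ⟩
  (suc m * suc m) * 16 ^ suc m ∎)
  where
  open ≤-Reasoning
  C = bin (2 * suc m) (suc m)
  c = bin (2 * m) m

^-distribʳ-* : ∀ a b m → (a * b) ^ m ≡ a ^ m * b ^ m
^-distribʳ-* a b zero = refl
^-distribʳ-* a b (suc m) = trans (cong (a * b *_) (^-distribʳ-* a b m)) ([m*n]*[o*p]≡[m*o]*[n*p] a b (a ^ m) (b ^ m))

square-cancel-≤ : ∀ {a b} → a * a ≤ b * b → a ≤ b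
square-cancel-≤ {a} {b} h = ≮⇒≥ λ lt → <⇒≱ (*-mono-< lt lt) h

-- With m = 4^g the root of m is the integer 2^g, so the claim can be checked on squares; this
-- dictates the shape of `K`.
bin-small : ∀ g w → bin (2 * 4 ^ g) w * 2 ^ g ≤ 2 ^ (2 * 4 ^ g)
bin-small g w = square-cancel-≤ (begin
  (bin (2 * m) w * 2 ^ g) * (bin (2 * m) w * 2 ^ g)
    ≤⟨ *-mono-≤ (*-monoˡ-≤ (2 ^ g) (bin-peak m w)) (*-monoˡ-≤ (2 ^ g) (bin-peak m w)) ⟩
  (c * 2 ^ g) * (c * 2 ^ g) ≡⟨ solve 2 (λ c t → (c :* t) :* (c :* t) := c :* c :* (t :* t)) refl c (2 ^ g) ⟩
  c * c * (2 ^ g * 2 ^ g) ≡⟨ cong (c * c *_) (sym (^-distribʳ-* 2 2 g)) ⟩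
  c * c * m ≤⟨ *-monoʳ-≤ (c * c) (≤-trans (m≤m+n m _) (n≤1+n (2 * m))) ⟩
  c * c * suc (2 * m) ≤⟨ central-bound m ⟩
  16 ^ m ≡⟨ ^-distribʳ-* 4 4 m ⟩
  4 ^ m * 4 ^ m ≡⟨ cong₂ _*_ (^-*-assoc 2 2 m) (^-*-assoc 2 2 m) ⟩
  2 ^ (2 * m) * 2 ^ (2 * m) ∎)
  where
  open ≤-Reasoning
  m = 4 ^ g
  c = bin (2 * m) m

-- Packing chunks into subcubes

just-injective : {A : Set} {x y : A} → just x ≡ just y → x ≡ y
just-injective refl = refl

≡ᵇ-true : ∀ {m n} → (m ≡ᵇ n) ≡ true → m ≡ n
≡ᵇ-true {m} {n} h = ≡ᵇ⇒≡ m n (subst Data.Bool.T (sym h) tt)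

≡ᵇ-refl : ∀ m → (m ≡ᵇ m) ≡ true
≡ᵇ-refl zero = refl
≡ᵇ-refl (suc m) = ≡ᵇ-refl m

-- Chunks arrive from coarse to fine, so an unallocated vertex always lies in an entirely unallocated
-- cell of the current codimension; Blocked records why a discarded chunk did not fit there.
module Packing {Chunk : Set} (n K : ℕ) (cod cls : Chunk → ℕ)
  (Cmp : ℕ → Chunk → Chunk → Bool) (cmp-sym : ∀ i C D → Cmp i C D ≡ Cmp i D C)
  (Disj : Chunk → Chunk → Set) (disj-sym : ∀ {C D} → Disj C D → Disj D C)
  (cl : Vec Bool n → ℕ) (cl-agree : ∀ p q → agree K p q ≡ true → cl p ≡ cl q) where

  weight : ℕ → Chunk → ℕ
  weight j C = ⟦ cls C ≡ᵇ j ⟧ * 2 ^ (n ∸ cod C)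

  occupied : (Vec Bool n → Maybe Chunk) → ℕ → Vec Bool n → Bool
  occupied al j p = is-just (al p) ∧ (cl p ≡ᵇ j)

  Blocked : (Vec Bool n → Maybe Chunk) → Chunk → Vec Bool n → Set
  Blocked al C p = al p ≡ nothing → cl p ≡ cls C →
    ∃[ i ] ∃[ D ] (i < n) × (al (flip i p) ≡ just D) × (Cmp i D C ≡ false) × (i < cod D) × (cod D ≤ cod C)

  record State (L todo : List Chunk) : Set where
    field
      al : Vec Bool n → Maybe Chunk
      discarded : List Chunk
      al-∈ : ∀ {p C} → al p ≡ just C → C ∈ L
      al-cell : ∀ {p q C} → al p ≡ just C → agree (cod C) p q ≡ true → al q ≡ just C
      al-cls : ∀ {p C} → al p ≡ just C → cls C ≡ cl p
      al-todo : ∀ {p C} → al p ≡ just C → All (Disj C) todo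
      al-disj : ∀ {p q C D} → al p ≡ just C → al q ≡ just D → agree (cod C) p q ≡ false → Disj C D
      -- Only neighbours across the boundary of a cell are constrained; within a cell the chunk will
      -- have no blue edges.
      al-cmp : ∀ {i p C D} → i < n → al p ≡ just C → al (flip i p) ≡ just D →
        agree (cod C) p (flip i p) ≡ false → Cmp i C D ≡ true
      al-cod : ∀ {p C} → al p ≡ just C → All (λ D → cod C ≤ cod D) todo
      discarded-∈ : ∀ {C} → C ∈ discarded → C ∈ L
      blocked : ∀ {C} → C ∈ discarded → ∀ p → Blocked al C p
      discarded-sub : ∀ (g : Chunk → ℕ) → ∑ discarded g + ∑ todo g ≤ ∑ L g
      total : ∀ j → ∑ L (weight j) ≤
        ∑ todo (weight j) + (∑ (cube n) (λ p → ⟦ occupied al j p ⟧) + ∑ discarded (weight j))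

  Coarser : Chunk → Chunk → Set
  Coarser C D = cod C ≤ cod D

  initial : ∀ L → State L L
  initial L = record
    { al = λ _ → nothing ; discarded = []
    ; al-∈ = λ () ; al-cell = λ () ; al-cls = λ () ; al-todo = λ () ; al-disj = λ () ; al-cmp = λ _ ()
    ; al-cod = λ () ; discarded-∈ = λ () ; blocked = λ () ; discarded-sub = λ g → ≤-refl
    ; total = λ j → m≤m+n _ _ }

  step : ∀ {L C todo} → C ∈ L → K ≤ cod C → All (Coarser C) todo → All (Disj C) todo → State L (C ∷ todo) → State L todo
  step {L} {C} {todo} C∈L K≤ coarser disj st = result
    where
    open State st
    a = cod C
    Fit : Vec Bool n → Set
    Fit p = (cl p ≡ cls C) × (∀ q → agree a p q ≡ true → al q ≡ nothing) ×
      (∀ q i → i < n → agree a p q ≡ true → ∀ D → al (flip i q) ≡ just D → Cmp i D C ≡ true)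
    old : ∀ {p D} → al p ≡ just D → cod D ≤ a
    old e = All.head (al-cod e)
    Conflict : Vec Bool n → Vec Bool n → ℕ → Set
    Conflict p q i = (agree a p q ≡ true) × ∃[ D ] (al (flip i q) ≡ just D) × (Cmp i D C ≡ false)
    try-cell : ∀ p → Blocked al C p ⊎ Fit p
    try-cell p with cl p ≟ cls C
    ... | no ne = inj₁ λ _ e → contradiction e ne
    ... | yes e with search free? (cube n)
      where
      free? : ∀ q → (agree a p q ≡ true → al q ≡ nothing) ⊎ ((agree a p q ≡ true) × ∃[ D ] al q ≡ just D)
      free? q with agree a p q | al q
      ... | false | _ = inj₁ λ ()
      ... | true | nothing = inj₁ λ _ → refl
      ... | true | just D = inj₂ (refl , D , refl)
    -- `D` is no finer than `C`, so its cell through `q` contains `p`, which is therefore not free.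
    ... | inj₂ (q , _ , ag , D , alq) = inj₁ λ free _ → case trans (sym free)
            (al-cell alq (agree-mono q p (old alq) (trans (agree-sym a q p) ag))) of λ ()
    ... | inj₁ free with search compat? (cube n)
      where
      compat-i? : ∀ q i → (agree a p q ≡ true → ∀ D → al (flip i q) ≡ just D → Cmp i D C ≡ true) ⊎ Conflict p q i
      compat-i? q i with agree a p q
      ... | false = inj₁ λ ()
      ... | true with al (flip i q)
      ... | nothing = inj₁ λ _ _ ()
      ... | just D with Cmp i D C in e
      ... | true = inj₁ λ { _ D refl → e }
      ... | false = inj₂ (refl , D , refl , e)
      compat? : ∀ q → (∀ {i} → i ∈ range n → agree a p q ≡ true → ∀ D → al (flip i q) ≡ just D → Cmp i D C ≡ true) ⊎
                      (∃[ i ] (i ∈ range n) × Conflict p q i)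
      compat? q = search (compat-i? q) (range n)
    ... | inj₁ ok = inj₂ (e , (λ q → free (∈-cube q)) ,
                         λ q i lt → ok (∈-cube q) (∈-range⁺ lt))
    -- The conflict met at `q` is one at `p`: the cell of `D` through `flip i q` also contains
    -- `flip i p`. If `i ≥ cod D`, that cell would contain the free vertex `q`.
    ... | inj₂ (q , q∈ , i , i∈ , ag , D , alD , bad) = inj₁ λ _ _ → i , D , ∈-range⁻ i∈ ,
            al-cell alD (agree-mono (flip i q) (flip i p) (old alD) (agree-flip a i q p (trans (agree-sym a q p) ag))) ,
            bad ,
            ≰⇒> (λ le → case trans (sym (free q∈ ag)) (al-cell alD
              (subst (λ z → agree (cod D) (flip i q) z ≡ true) (flip-involutive i q) (agree-flip-≥ (flip i q) le))) of λ ()) ,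
            old alD
    result : State L todo
    result with search try-cell (cube n)
    ... | inj₁ none = record
      { al = al ; discarded = C ∷ discarded ; al-∈ = al-∈ ; al-cell = al-cell ; al-cls = al-cls
      ; al-todo = λ e → All.tail (al-todo e) ; al-disj = al-disj ; al-cmp = al-cmp
      ; al-cod = λ e → All.tail (al-cod e)
      ; discarded-∈ = λ { (here refl) → C∈L ; (there m) → discarded-∈ m }
      ; blocked = λ { (here refl) p → none (∈-cube p) ; (there m) → blocked m }
      ; discarded-sub = λ g → ≤-trans (≤-reflexive (solve 3 (λ c d t → (c :+ d) :+ t := d :+ (c :+ t)) refl (g C) (∑ discarded g) (∑ todo g))) (discarded-sub g)
      ; total = λ j → ≤-trans (total j) (≤-reflexive (solve 4 (λ c t o d → (c :+ t) :+ (o :+ d) := t :+ (o :+ (c :+ d))) refl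
          (weight j C) (∑ todo (weight j)) (∑ (cube n) (λ p → ⟦ occupied al j p ⟧)) (∑ discarded (weight j)))) }
    ... | inj₂ (p , _ , clp , free , compat) = record
      { al = al′ ; discarded = discarded ; al-∈ = ∈′ ; al-cell = cell′ ; al-cls = cls′ ; al-todo = todo′
      ; al-disj = disj′ ; al-cmp = cmp′ ; al-cod = cod′
      ; discarded-∈ = discarded-∈
      -- Allocations are never revoked, so an old witness stays valid.
      ; blocked = λ m q n′ c → case blocked m q (nothing′ n′) c of λ { (i , D , lt , e , r) → i , D , lt , extends e , r }
      ; discarded-sub = λ g → ≤-trans (+-monoʳ-≤ (∑ discarded g) (m≤n+m _ (g C))) (discarded-sub g)
      ; total = λ j → ≤-trans (total j) (≤-trans (≤-reflexive (solve 4 (λ c t o d → (c :+ t) :+ (o :+ d) := t :+ ((c :+ o) :+ d)) refl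
          (weight j C) (∑ todo (weight j)) (∑ (cube n) (λ p → ⟦ occupied al j p ⟧)) (∑ discarded (weight j))))
          (+-monoʳ-≤ (∑ todo (weight j)) (+-monoˡ-≤ (∑ discarded (weight j)) (more j)))) }
      where
      al′ : Vec Bool n → Maybe Chunk
      al′ q = if agree a p q then just C else al q
      Old New : Vec Bool n → Chunk → Set
      New q D = (agree a p q ≡ true) × (C ≡ D)
      Old q D = (agree a p q ≡ false) × (al q ≡ just D)
      split : ∀ {q D} → al′ q ≡ just D → New q D ⊎ Old q D
      split {q} e with agree a p q
      ... | true = inj₁ (refl , just-injective e)
      ... | false = inj₂ (refl , e)
      inside : ∀ {q} → agree a p q ≡ true → al′ q ≡ just C
      inside h rewrite h = refl
      extends : ∀ {q D} → al q ≡ just D → al′ q ≡ just D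
      extends {q} e with agree a p q in h
      ... | true = case trans (sym (free q h)) e of λ ()
      ... | false = e
      nothing′ : ∀ {q} → al′ q ≡ nothing → al q ≡ nothing
      nothing′ {q} e with agree a p q
      ... | false = e
      ∈′ : ∀ {q D} → al′ q ≡ just D → D ∈ L
      ∈′ e with split e
      ... | inj₁ (_ , refl) = C∈L
      ... | inj₂ (_ , o) = al-∈ o
      cell′ : ∀ {q r D} → al′ q ≡ just D → agree (cod D) q r ≡ true → al′ r ≡ just D
      cell′ e h with split e
      ... | inj₁ (ag , refl) = inside (agree-trans a ag h)
      ... | inj₂ (_ , o) = extends (al-cell o h)
      cls′ : ∀ {q D} → al′ q ≡ just D → cls D ≡ cl q
      cls′ {q} e with split e
      ... | inj₁ (ag , refl) = trans (sym clp) (cl-agree p q (agree-mono p q K≤ ag))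
      ... | inj₂ (_ , o) = al-cls o
      todo′ : ∀ {q D} → al′ q ≡ just D → All (Disj D) todo
      todo′ e with split e
      ... | inj₁ (_ , refl) = disj
      ... | inj₂ (_ , o) = All.tail (al-todo o)
      disj′ : ∀ {q r D E} → al′ q ≡ just D → al′ r ≡ just E → agree (cod D) q r ≡ false → Disj D E
      disj′ {q} e f h with split e | split f
      ... | inj₁ (ag , refl) | inj₁ (ag′ , _) =
        true≢false (agree-trans a (trans (agree-sym a q p) ag) ag′) h
      ... | inj₁ (_ , refl) | inj₂ (_ , o) = disj-sym (All.head (al-todo o))
      ... | inj₂ (_ , o) | inj₁ (_ , refl) = All.head (al-todo o)
      ... | inj₂ (_ , o) | inj₂ (_ , o′) = al-disj o o′ h
      cmp′ : ∀ {i q D E} → i < n → al′ q ≡ just D → al′ (flip i q) ≡ just E → agree (cod D) q (flip i q) ≡ false → Cmp i D E ≡ true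
      cmp′ {i} {q} {D} {E} lt e f h with split e | split f
      ... | inj₁ (ag , refl) | inj₁ (ag′ , _) =
        true≢false (agree-trans a (trans (agree-sym a q p) ag) ag′) h
      ... | inj₁ (ag , refl) | inj₂ (_ , o) = trans (cmp-sym i C E) (compat q i lt ag E o)
      ... | inj₂ (_ , o) | inj₁ (ag , refl) = compat (flip i q) i lt ag D (trans (cong al (flip-involutive i q)) o)
      ... | inj₂ (_ , o) | inj₂ (_ , o′) = al-cmp lt o o′ h
      cod′ : ∀ {q D} → al′ q ≡ just D → All (Coarser D) todo
      cod′ e with split e
      ... | inj₁ (_ , refl) = coarser
      ... | inj₂ (_ , o) = All.tail (al-cod o)
      more : ∀ j → weight j C + ∑ (cube n) (λ q → ⟦ occupied al j q ⟧) ≤ ∑ (cube n) (λ q → ⟦ occupied al′ j q ⟧)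
      more j = subst (λ z → z + ∑ (cube n) (λ q → ⟦ occupied al j q ⟧) ≤ ∑ (cube n) (λ q → ⟦ occupied al′ j q ⟧))
        (trans (∑-*ˡ (cube n) ⟦ cls C ≡ᵇ j ⟧ _) (cong (⟦ cls C ≡ᵇ j ⟧ *_) (#-agree n a p)))
        (≤-trans (≤-reflexive (sym (∑-+ (cube n) _ _))) (∑-mono (cube n) pointwise))
        where
        pointwise : ∀ q → ⟦ cls C ≡ᵇ j ⟧ * ⟦ agree a p q ⟧ + ⟦ occupied al j q ⟧ ≤ ⟦ occupied al′ j q ⟧
        pointwise q with agree a p q in h
        ... | false rewrite *-zeroʳ ⟦ cls C ≡ᵇ j ⟧ = ≤-refl
        ... | true rewrite free q h | sym (cl-agree p q (agree-mono p q K≤ h)) | clp =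
          ≤-reflexive (trans (+-identityʳ _) (*-identityʳ _))

  pack : ∀ L → All (λ C → K ≤ cod C) L → AllPairs Coarser L → AllPairs Disj L → State L []
  pack L ks cs ds = go L (λ m → m) ks cs ds (initial L)
    where
    go : ∀ todo → (∀ {C} → C ∈ todo → C ∈ L) → All (λ C → K ≤ cod C) todo → AllPairs Coarser todo → AllPairs Disj todo → State L todo → State L []
    go [] sub _ _ _ st = st
    go (C ∷ todo) sub (k ∷ ks) (c ∷ cs) (d ∷ ds) st = go todo (sub ∘ there) ks cs ds (step (sub (here refl)) k c d st)

-- Choosing vertices inside chunks

-- The host is the blue graph.
record Host : Set₁ where
  infix 4 _≟ᵥ_
  field
    V : Set
    _≟ᵥ_ : DecidableEquality V
    vs : List V
    enum : Enumerates _≟ᵥ_ vs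
    adj : V → V → Bool
    adj-sym : ∀ x y → adj x y ≡ adj y x
    triangle-free : ∀ {x y z} → adj x y ≡ true → adj x z ≡ true → adj y z ≡ true → ⊥

∨-false : ∀ {a b} → a ∨ b ≡ false → (a ≡ false) × (b ≡ false)
∨-false {false} {false} _ = refl , refl

diffCount-sym : ∀ {n} (u v : Vec Bool n) → diffCount u v ≡ diffCount v u
diffCount-sym [] [] = refl
diffCount-sym (true ∷ u) (true ∷ v) = diffCount-sym u v
diffCount-sym (true ∷ u) (false ∷ v) = cong suc (diffCount-sym u v)
diffCount-sym (false ∷ u) (true ∷ v) = cong suc (diffCount-sym u v)
diffCount-sym (false ∷ u) (false ∷ v) = diffCount-sym u v

module Degrees (H : Host) where
  open Host H public
  open FiniteSet _≟ᵥ_ vs enum public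

  deg : V → (V → Bool) → ℕ
  deg x P = ∑ vs λ y → ⟦ P y ⟧ * ⟦ adj x y ⟧

  edges : (V → Bool) → (V → Bool) → ℕ
  edges P R = ∑ vs λ x → ⟦ P x ⟧ * deg x R

  edges-sym : ∀ P R → edges P R ≡ edges R P
  edges-sym P R = begin
    ∑ vs (λ x → ⟦ P x ⟧ * ∑ vs (λ y → ⟦ R y ⟧ * ⟦ adj x y ⟧)) ≡⟨ ∑-cong vs (λ x → sym (∑-*ˡ vs ⟦ P x ⟧ _)) ⟩
    ∑ vs (λ x → ∑ vs (λ y → ⟦ P x ⟧ * (⟦ R y ⟧ * ⟦ adj x y ⟧))) ≡⟨ ∑-swap vs vs _ ⟩
    ∑ vs (λ y → ∑ vs (λ x → ⟦ P x ⟧ * (⟦ R y ⟧ * ⟦ adj x y ⟧))) ≡⟨ ∑-cong vs (λ y → ∑-cong vs λ x →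
      trans (solve 3 (λ a b c → a :* (b :* c) := b :* (a :* c)) refl ⟦ P x ⟧ ⟦ R y ⟧ ⟦ adj x y ⟧)
        (cong (λ z → ⟦ R y ⟧ * (⟦ P x ⟧ * ⟦ z ⟧)) (adj-sym x y))) ⟩
    ∑ vs (λ y → ∑ vs (λ x → ⟦ R y ⟧ * (⟦ P x ⟧ * ⟦ adj y x ⟧))) ≡⟨ ∑-cong vs (λ y → ∑-*ˡ vs ⟦ R y ⟧ _) ⟩
    ∑ vs (λ y → ⟦ R y ⟧ * deg y P) ∎
    where open ≡-Reasoning

  deg-mono : ∀ x {P R} → P ⊆ R → deg x P ≤ deg x R
  deg-mono x sub = ∑-mono vs λ y → *-monoˡ-≤ ⟦ adj x y ⟧ (⟦⟧-mono (sub y))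

  deg-∩ : ∀ x P → deg x P ≡ # (adj x ∩ P)
  deg-∩ x P = ∑-cong vs λ y → trans (*-comm ⟦ P y ⟧ _) (sym (⟦∧⟧ (adj x y) (P y)))

  edges-≤ : ∀ P R d → (∀ x → P x ≡ true → deg x R ≤ d) → edges P R ≤ # P * d
  edges-≤ P R d h = ≤-trans (∑-mono vs λ x → ⟦⟧*-mono (P x) (h x)) (≤-reflexive (∑-*ʳ vs _ d))

  Independent : (V → Bool) → Set
  Independent P = ∀ {x y} → P x ≡ true → P y ≡ true → adj x y ≡ false

  neighbourhood-independent : ∀ {v P} → P ⊆ adj v → Independent P
  neighbourhood-independent sub px py = ¬true λ a → triangle-free (sub _ px) (sub _ py) a

  deg-independent : ∀ {P x} → Independent P → P x ≡ true → deg x P ≡ 0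
  deg-independent {P} {x} ind px = ∑-zero vs λ {y} _ → zero′ y
    where
    zero′ : ∀ y → ⟦ P y ⟧ * ⟦ adj x y ⟧ ≡ 0
    zero′ y with P y in py
    ... | false = refl
    ... | true rewrite ind px py = refl

  -- A cube without blue edges, hence a red one.
  FreeCube : ℕ → Set
  FreeCube n = ∃[ f ] Injective _≡_ _≡_ f × (∀ i (p : Vec Bool n) → i < n → adj (f p) (f (flip i p)) ≡ false)

  record Chunk : Set where
    constructor chunk
    field
      cod cls : ℕ
      set : V → Bool
  open Chunk public

  module EmbedInChunks (n τ : ℕ) (al : Vec Bool n → Chunk) where
    C : Vec Bool n → V → Bool
    C p = set (al p)

    same : Vec Bool n → Vec Bool n → Bool
    same p q = agree (cod (al p)) p q

    t : ℕ → ℕ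
    t i = 2 ^ (τ + q4 i)

    instance
      t≢0 : ∀ {i} → NonZero (t i)
      t≢0 {i} = m^n≢0 2 (τ + q4 i)

    -- A vertex of a chunk is bad in direction i if it sees more than a fraction 1/tᵢ of the chunk
    -- across. As the density is at most 1/tᵢ², Markov's inequality leaves at most |C p|/tᵢ bad
    -- vertices (`κ₁`). A good choice at the neighbour in turn excludes at most |C p|/tᵢ vertices
    -- (`κ₂`), and the other vertices of the cell use up the rest of the room.
    embed :
      (∀ p q → same p q ≡ true → al q ≡ al p) →
      (∀ p q → same p q ≡ false → Disjoint (C p) (C q)) →
      (∀ i p → i < n → same p (flip i p) ≡ false → edges (C p) (C (flip i p)) * (t i * t i) ≤ # (C p) * # (C (flip i p))) →
      (∀ p → Independent (C p)) →
      (∀ p → 0 < # (C p)) →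
      (∀ p κ₁ κ₂ → (∀ {i} → i < n → κ₁ i * t i ≤ # (C p)) → (∀ {i} → i < n → κ₂ i * t i ≤ # (C p)) →
        2 ^ (n ∸ cod (al p)) + (∑ (range n) κ₁ + ∑ (range n) κ₂) ≤ # (C p)) →
      FreeCube n
    embed cell disj sparse indep nonempty room = conclude (greedy conf-sym few enough)
      where
      good : ℕ → Vec Bool n → V → Bool
      good i p x = deg x (C (flip i p)) * t i ≤ᵇ # (C (flip i p))
      bad : ℕ → Vec Bool n → V → Bool
      bad i p x = C p x ∧ (not (same p (flip i p)) ∧ not (good i p x))
      badness : Vec Bool n → V → ℕ
      badness p x = ∑ (range n) λ i → ⟦ bad i p x ⟧
      ok : Vec Bool n → V → Bool
      ok p x = C p x ∧ (badness p x ≡ᵇ 0)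
      κ₁ κ₂ : Vec Bool n → ℕ → ℕ
      κ₁ p i = # (bad i p)
      κ₂ p i = # (C p) / t i
      conf : Vec Bool n → V → Vec Bool n → V → Bool
      conf p x q y = does (x ≟ᵥ y) ∨ ((diffCount p q ≡ᵇ 1) ∧ adj x y)
      kills : Vec Bool n → Vec Bool n → ℕ
      kills p q = ⟦ same p q ⟧ + ∑ (range n) (λ i → ⟦ does (flip i p ≟q q) ⟧ * κ₂ p i)
      open Greedy _≟q_ (cube n) (cube-enum n) vs ok conf kills
      same-sym : ∀ p q → same p q ≡ true → same q p ≡ true
      same-sym p q h rewrite cell p q h = trans (agree-sym (cod (al p)) q p) h
      conf-sym : ∀ p q x y → conf p x q y ≡ conf q y p x
      conf-sym p q x y rewrite ≟-sym x y | diffCount-sym p q | adj-sym x y = refl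
      ok-C : ∀ {p x} → ok p x ≡ true → C p x ≡ true
      ok-C h = proj₁ (∧-true h)
      ok-good : ∀ {p x} i → i < n → ok p x ≡ true → same p (flip i p) ≡ false → good i p x ≡ true
      ok-good {p} {x} i lt h out with good i p x in eq
      ... | true = refl
      ... | false = case ≤-trans (≤-reflexive one) (≤-trans (∑-∈ (λ i → ⟦ bad i p x ⟧) (∈-range⁺ lt))
              (≤-reflexive (≡ᵇ-true (proj₂ (∧-true {C p x} h))))) of λ ()
        where
        one : 1 ≡ ⟦ bad i p x ⟧
        one rewrite ok-C {p} h | out | eq = refl
      few : ∀ p q y → different p q ≡ true → ok q y ≡ true → ∑ vs (λ x → ⟦ ok p x ∧ conf p x q y ⟧) ≤ kills p q
      few p q y _ oky = ≤-trans (≤-trans (∑-mono vs pointwise) (≤-reflexive (∑-+ vs _ _))) (+-mono-≤ used edge)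
        where
        pointwise : ∀ x → ⟦ ok p x ∧ conf p x q y ⟧ ≤ ⟦ C p x ∧ does (x ≟ᵥ y) ⟧ + ⟦ diffCount p q ≡ᵇ 1 ⟧ * (⟦ C p x ⟧ * ⟦ adj y x ⟧)
        pointwise x rewrite adj-sym y x with C p x | badness p x ≡ᵇ 0 | does (x ≟ᵥ y) | diffCount p q ≡ᵇ 1 | adj x y
        ... | false | _ | _ | _ | _ = z≤n
        ... | true | false | _ | _ | _ = z≤n
        ... | true | true | true | _ | _ = s≤s z≤n
        ... | true | true | false | false | _ = z≤n
        ... | true | true | false | true | false = z≤n
        ... | true | true | false | true | true = ≤-refl
        used : ∑ vs (λ x → ⟦ C p x ∧ does (x ≟ᵥ y) ⟧) ≤ ⟦ same p q ⟧
        used with same p q in s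
        ... | true = ≤-trans (∑-mono vs le) (≤-reflexive (enum y))
          where
          le : ∀ x → ⟦ C p x ∧ does (x ≟ᵥ y) ⟧ ≤ ⟦ does (y ≟ᵥ x) ⟧
          le x = ≤-trans (⟦⟧-mono {C p x ∧ does (x ≟ᵥ y)} (λ h → proj₂ (∧-true {C p x} h))) (≤-reflexive (cong ⟦_⟧ (≟-sym x y)))
        ... | false = ≤-reflexive (∑-zero vs λ {x} _ → none x)
          where
          none : ∀ x → ⟦ C p x ∧ does (x ≟ᵥ y) ⟧ ≡ 0
          none x with C p x in cx | x ≟ᵥ y
          ... | false | _ = refl
          ... | true | no _ = refl
          ... | true | yes refl = ⊥-elim (disj p q s x cx (ok-C oky))
        edge : ∑ vs (λ x → ⟦ diffCount p q ≡ᵇ 1 ⟧ * (⟦ C p x ⟧ * ⟦ adj y x ⟧)) ≤ ∑ (range n) (λ i → ⟦ does (flip i p ≟q q) ⟧ * κ₂ p i)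
        edge with diffCount p q ≡ᵇ 1 in dc
        ... | false = ≤-trans (≤-reflexive (∑-zero vs λ _ → refl)) z≤n
        ... | true with QAdj⇒flip p q (≡ᵇ-true dc)
        ... | i , lt , refl = ≤-trans (≤-reflexive (∑-cong vs λ x → +-identityʳ _)) (≤-trans small (≤-trans
                (≤-reflexive (sym (trans (cong (λ z → ⟦ z ⟧ * κ₂ p i) (dec-true (flip i p ≟q flip i p) refl)) (+-identityʳ _))))
                (∑-∈ (λ j → ⟦ does (flip j p ≟q flip i p) ⟧ * κ₂ p j) (∈-range⁺ lt))))
          where
          small : deg y (C p) ≤ κ₂ p i
          small with same p (flip i p) in s
          ... | true = ≤-trans (≤-reflexive (deg-independent (indep p) (subst (λ z → set z y ≡ true) (cell p (flip i p) s) (ok-C {flip i p} oky)))) z≤n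
          ... | false = subst (_≤ κ₂ p i) (m*n/n≡m (deg y (C p)) (t i)) (/-mono-≤
                (subst (λ z → deg y (C z) * t i ≤ # (C z)) (flip-involutive i p)
                  (≤ᵇ-true (ok-good {flip i p} i lt oky (¬true λ h → true≢false
                    (subst (λ z → same z (flip i p) ≡ true) (flip-involutive i p) (same-sym (flip i p) (flip i (flip i p)) h)) s)))) (≤-refl {t i}))
      κ₁-small : ∀ p {i} → i < n → κ₁ p i * t i ≤ # (C p)
      κ₁-small p {i} lt with same p (flip i p) in s
      ... | true = ≤-trans (≤-reflexive (cong (_* t i) (∑-zero vs λ {x} _ → none x))) z≤n
        where
        none : ∀ x → ⟦ C p x ∧ false ⟧ ≡ 0
        none x with C p x
        ... | true = refl
        ... | false = refl
      ... | false = *-cancelʳ-≤ _ _ (# D) {{>-nonZero (nonempty (flip i p))}} (begin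
          (b * t i) * # D ≡⟨ solve 3 (λ a b c → (a :* b) :* c := (a :* c) :* b) refl b (t i) (# D) ⟩
          (b * # D) * t i ≤⟨ *-monoˡ-≤ (t i) markov ⟩
          (edges (C p) D * t i) * t i ≡⟨ *-assoc (edges (C p) D) (t i) (t i) ⟩
          edges (C p) D * (t i * t i) ≤⟨ sparse i p lt s ⟩
          # (C p) * # D ∎)
        where
        open ≤-Reasoning
        D = C (flip i p)
        b = # (λ x → C p x ∧ not (good i p x))
        pointwise : ∀ x → ⟦ C p x ∧ not (good i p x) ⟧ * # D ≤ (⟦ C p x ⟧ * deg x D) * t i
        pointwise x with C p x | good i p x in g
        ... | false | _ = z≤n
        ... | true | true = z≤n
        ... | true | false = ≤-trans (≤-reflexive (+-identityʳ _)) (≤-trans (<⇒≤ (≤ᵇ-false g))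
                (≤-reflexive (cong (_* t i) (sym (+-identityʳ (deg x D))))))
        markov : b * # D ≤ edges (C p) D * t i
        markov = ≤-trans (≤-reflexive (sym (∑-*ʳ vs _ (# D)))) (≤-trans (∑-mono vs pointwise) (≤-reflexive (∑-*ʳ vs _ (t i))))
      enough : ∀ p → ∑ (cube n) (λ q → ⟦ different p q ⟧ * kills p q) < ∑ vs (λ x → ⟦ ok p x ⟧)
      enough p = +-cancelʳ-≤ (∑ (range n) (κ₁ p)) _ _ (begin
        suc (∑ (cube n) (λ q → ⟦ different p q ⟧ * kills p q)) + ∑ (range n) (κ₁ p) ≤⟨ +-monoˡ-≤ _ kill-sum ⟩
        (2 ^ (n ∸ cod (al p)) + ∑ (range n) (κ₂ p)) + ∑ (range n) (κ₁ p)
          ≡⟨ solve 3 (λ a b c → (a :+ b) :+ c := a :+ (c :+ b)) refl (2 ^ (n ∸ cod (al p))) (∑ (range n) (κ₂ p)) _ ⟩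
        2 ^ (n ∸ cod (al p)) + (∑ (range n) (κ₁ p) + ∑ (range n) (κ₂ p))
          ≤⟨ room p (κ₁ p) (κ₂ p) (κ₁-small p) (λ {i} _ → m/n*n≤m (# (C p)) (t i)) ⟩
        # (C p) ≤⟨ ∑-mono vs pointwise ⟩
        ∑ vs (λ x → ⟦ ok p x ⟧ + badness p x) ≡⟨ ∑-+ vs _ _ ⟩
        ∑ vs (λ x → ⟦ ok p x ⟧) + ∑ vs (badness p) ≡⟨ cong (∑ vs (λ x → ⟦ ok p x ⟧) +_) (∑-swap vs (range n) _) ⟩
        ∑ vs (λ x → ⟦ ok p x ⟧) + ∑ (range n) (κ₁ p) ∎)
        where
        open ≤-Reasoning
        pointwise : ∀ x → ⟦ C p x ⟧ ≤ ⟦ ok p x ⟧ + badness p x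
        pointwise x with C p x | badness p x
        ... | false | _ = z≤n
        ... | true | zero = ≤-refl
        ... | true | suc _ = s≤s z≤n
        -- The vertex `p` does not compete with itself; this saved unit gives the strict inequality
        -- that `greedy` asks for.
        cell-sum : suc (∑ (cube n) (λ q → ⟦ different p q ⟧ * ⟦ same p q ⟧)) ≡ 2 ^ (n ∸ cod (al p))
        cell-sum = trans (trans (+-comm 1 _) (trans (cong (∑ (cube n) (λ q → ⟦ different p q ⟧ * ⟦ same p q ⟧) +_) (sym (cube-enum n p)))
          (trans (sym (∑-+ (cube n) (λ q → ⟦ different p q ⟧ * ⟦ same p q ⟧) _)) (∑-cong (cube n) eq)))) (#-agree n (cod (al p)) p)
          where
          eq : ∀ q → ⟦ different p q ⟧ * ⟦ same p q ⟧ + ⟦ does (p ≟q q) ⟧ ≡ ⟦ same p q ⟧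
          eq q with p ≟q q
          ... | yes refl rewrite agree-refl (cod (al p)) p = refl
          ... | no _ = trans (+-identityʳ _) (+-identityʳ _)
        kill-sum : suc (∑ (cube n) (λ q → ⟦ different p q ⟧ * kills p q)) ≤ 2 ^ (n ∸ cod (al p)) + ∑ (range n) (κ₂ p)
        kill-sum = begin
          suc (∑ (cube n) (λ q → ⟦ different p q ⟧ * kills p q))
            ≤⟨ s≤s (∑-mono (cube n) λ q → ≤-trans (≤-reflexive (*-distribˡ-+ ⟦ different p q ⟧ _ _)) (+-monoʳ-≤ _ (⟦⟧*≤ (different p q) _))) ⟩
          suc (∑ (cube n) (λ q → ⟦ different p q ⟧ * ⟦ same p q ⟧ + ∑ (range n) (λ i → ⟦ does (flip i p ≟q q) ⟧ * κ₂ p i)))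
            ≡⟨ cong suc (∑-+ (cube n) _ _) ⟩
          suc (∑ (cube n) (λ q → ⟦ different p q ⟧ * ⟦ same p q ⟧)) + ∑ (cube n) (λ q → ∑ (range n) (λ i → ⟦ does (flip i p ≟q q) ⟧ * κ₂ p i))
            ≡⟨ cong₂ _+_ cell-sum (trans (∑-swap (cube n) (range n) _) (∑-cong (range n) λ i →
                 FiniteSet.∑-point _≟q_ (cube n) (cube-enum n) (flip i p) (λ _ → κ₂ p i))) ⟩
          2 ^ (n ∸ cod (al p)) + ∑ (range n) (κ₂ p) ∎
      conclude : (∃[ f ] (∀ p → ok p (f p) ≡ true) × (∀ p q → different p q ≡ true → conf p (f p) q (f q) ≡ false)) →
        FreeCube n
      conclude (f , _ , clear) = f , inj , free
        where
        inj : Injective _≡_ _≡_ f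
        inj {p} {q} e with p ≟q q in d
        ... | yes h = h
        ... | no _ = true≢false (dec-true (f p ≟ᵥ f q) e) (proj₁ (∨-false (clear p q (cong (not ∘ does) d))))
        free : ∀ i p → i < n → adj (f p) (f (flip i p)) ≡ false
        free i p lt with p ≟q flip i p in d
        ... | yes h = case trans (sym (diffCount-refl p)) (trans (cong (diffCount p) h) (flip⇒QAdj i p lt)) of λ ()
        ... | no _ = subst (λ z → (z ≡ᵇ 1) ∧ adj (f p) (f (flip i p)) ≡ false) (flip⇒QAdj i p lt)
                (proj₂ (∨-false (clear p (flip i p) (cong (not ∘ does) d))))

-- Slots and chunks

-- Cells have codimension at least K, q is the unit of slot sizes, d bounds the degrees between consecutive
-- slots, and chunks exceed their cells by a factor 1 + 2⁻ᵉ.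
record Parameters : Set where
  field
    n K′ e q d : ℕ
  -- A multiple of four, so that `i < K` gives `q4 i < K′`.
  K : ℕ
  K = 4 * K′
  -- The 6 makes the two sums of |C|/tᵢ together at most half the surplus of a chunk.
  τ : ℕ
  τ = e + 6
  field
    e≥1 : 1 ≤ e
    K+e<n : K + e < n
    cell≤q : 2 ^ (n ∸ K) ≤ q
    -- The left side bounds the weight discarded from a remainder slot while a cube vertex of its
    -- class stays unallocated.
    waste≤q : 8 * 2 ^ (n + (2 * τ + 2) ∸ K′) + n * 2 ^ e ≤ q
    -- The squared power bounds tᵢ² for i < K, and 2^(n-K) is a lower bound for the chunks of clique
    -- slots.
    d-small : d * (2 ^ (τ + K′) * 2 ^ (τ + K′)) ≤ 2 ^ (n ∸ K)

module WithHost (H : Host) where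
  open Degrees H public

  Sparse : ℕ → (V → Bool) → (V → Bool) → Set
  Sparse d P R = ∀ x → P x ≡ true → deg x R ≤ d

  -- A slot is a set together with a flag telling whether it lies in the low-degree remainder;
  -- an unflagged slot lies in a blue neighbourhood.
  Slot : Set
  Slot = (V → Bool) × Bool

  -- Sparseness has to point into a clique slot: chunks there have at least 2^(n-K) vertices,
  -- against which `d` is negligible, whereas chunks of the remainder may be single vertices.
  -- Between two slots of the remainder nothing is asked; there the packing has to discard chunks.
  Linked : ℕ → Slot → Slot → Set
  Linked d (P , r) (P′ , r′) =
    ((r ≡ true) × (r′ ≡ true)) ⊎ (Sparse d P P′ × r′ ≡ false) ⊎ (Sparse d P′ P × r ≡ false)

  record Slots (π : Parameters) : Set where
    open Parameters π
    field
      S : ℕ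
      slot : ℕ → Slot
    W : ℕ → V → Bool
    W j = proj₁ (slot j)
    isR : ℕ → Bool
    isR j = proj₂ (slot j)
    field
      disjoint-slots : ∀ x → ∑ (range S) (λ j → ⟦ W j x ⟧) ≤ 1
      clique-slot : ∀ {j} → j < S → isR j ≡ false → ∃[ v ] W j ⊆ adj v
      rest-slot : ∀ {j} → j < S → isR j ≡ true → ∀ v → deg v (W j) ≤ 2 ^ (n ∸ K)
      linked : ∀ {j} → suc j < S → Linked d (slot j) (slot (suc j))

  module Production {π : Parameters} (sl : Slots π) where
    open Parameters π
    open Slots sl

    size : ℕ → ℕ
    size a = 2 ^ (n ∸ a) + 2 ^ (n ∸ (a + e))

    size≤ : ∀ a → size a ≤ 2 * 2 ^ (n ∸ a)
    size≤ a = +-mono-≤ ≤-refl (≤-trans (^-monoʳ-≤ 2 (∸-monoʳ-≤ n (m≤m+n a e))) (≤-reflexive (sym (+-identityʳ _))))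

    2^e*2^ : ∀ a → a + e ≤ n → 2 ^ e * 2 ^ (n ∸ (a + e)) ≡ 2 ^ (n ∸ a)
    2^e*2^ a le = trans (sym (^-distribˡ-+-* 2 e _)) (cong (2 ^_) (trans (cong (e +_) (sym (∸-+-assoc n a e)))
      (m+[n∸m]≡n (m+n≤o⇒m≤o∸n e (subst (_≤ n) (+-comm a e) le)))))

    -- Beyond codimension `n ∸ e` the surplus 2^(n-a-e) would fall below one vertex; what remains
    -- then is allocated vertex by vertex, to cells of codimension `n`.
    Regular Single : Chunk → Set
    Regular C = (# (set C) ≡ size (cod C)) × (cod C + e ≤ n) × ∃[ v ] set C ⊆ adj v
    Single C = (# (set C) ≡ 1) × (cod C ≡ n) × (isR (cls C) ≡ true) × (∀ {x y} → set C x ≡ true → set C y ≡ true → x ≡ y)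

    record Valid (C : Chunk) : Set where
      field
        cls< : cls C < S
        inside : set C ⊆ W (cls C)
        K≤cod : K ≤ cod C
        kind : Regular C ⊎ Single C
        A-cod : isR (cls C) ≡ false → cod C ≡ K
    open Valid

    slot-unique : ∀ {i j x} → i < S → j < S → W i x ≡ true → W j x ≡ true → i ≡ j
    slot-unique {i} {j} {x} i< j< wi wj with i ≟ j
    ... | yes e = e
    ... | no ne = contradiction (disjoint-slots x) (<⇒≱ two)
      where
      pointwise : ∀ k → ⟦ i ≡ᵇ k ⟧ + ⟦ j ≡ᵇ k ⟧ ≤ ⟦ W k x ⟧
      pointwise k with i ≡ᵇ k in ik | j ≡ᵇ k in jk
      ... | true | true = contradiction (trans (≡ᵇ-true ik) (sym (≡ᵇ-true jk))) ne
      ... | true | false rewrite sym (≡ᵇ-true {i} ik) | wi = ≤-refl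
      ... | false | true rewrite sym (≡ᵇ-true {j} jk) | wj = ≤-refl
      ... | false | false = z≤n
      two : 1 < ∑ (range S) (λ j → ⟦ W j x ⟧)
      two = ≤-trans (≤-reflexive (sym (trans (∑-+ (range S) _ _) (cong₂ _+_ (range-enum S i i<) (range-enum S j j<)))))
        (∑-mono (range S) pointwise)

    coverage : List Chunk → V → ℕ
    coverage L x = ∑ L λ C → ⟦ set C x ⟧

    classCoverage : ∀ j (P : V → Bool) L → All Valid L → (∀ x → coverage L x ≤ ⟦ P x ⟧) →
      ∀ x → ∑ L (λ C → ⟦ cls C ≡ᵇ j ⟧ * ⟦ set C x ⟧) ≤ ⟦ (W j ∩ P) x ⟧
    classCoverage j P L valid cov x with W j x in wx
    ... | true = ≤-trans (∑-mono L λ C → ⟦⟧*≤ (cls C ≡ᵇ j) _) (cov x)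
    ... | false = ≤-reflexive (∑-zero L λ {C} m → none C (All.lookup valid m))
      where
      none : ∀ C → Valid C → ⟦ cls C ≡ᵇ j ⟧ * ⟦ set C x ⟧ ≡ 0
      none C val with cls C ≡ᵇ j in c | set C x in sx
      ... | false | _ = refl
      ... | true | false = refl
      ... | true | true = true≢false (subst (λ z → W z x ≡ true) (≡ᵇ-true c) (inside val x sx)) wx

    -- Only codimensions from `a` on count, since a chunk of codimension `a` can block no coarser
    -- one. The order from coarse to fine makes this degree small.
    degreeInClass : ℕ → ℕ → List Chunk → V → ℕ
    degreeInClass j a L v = ∑ L λ C → ⟦ (cls C ≡ᵇ j) ∧ (a ≤ᵇ cod C) ⟧ * deg v (set C)

    degreeInClass-≤ : ∀ j a (P : V → Bool) L → All Valid L → (∀ x → coverage L x ≤ ⟦ P x ⟧) →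
      ∀ v → degreeInClass j a L v ≤ deg v (W j ∩ P)
    degreeInClass-≤ j a P L valid cov v = begin
      ∑ L (λ C → ⟦ (cls C ≡ᵇ j) ∧ (a ≤ᵇ cod C) ⟧ * deg v (set C))
        ≤⟨ ∑-mono L (λ C → *-monoˡ-≤ (deg v (set C)) (⟦⟧-mono λ h → proj₁ (∧-true {cls C ≡ᵇ j} h))) ⟩
      ∑ L (λ C → ⟦ cls C ≡ᵇ j ⟧ * ∑ vs (λ y → ⟦ set C y ⟧ * ⟦ adj v y ⟧)) ≡⟨ ∑-cong L (λ C → sym (∑-*ˡ vs ⟦ cls C ≡ᵇ j ⟧ _)) ⟩
      ∑ L (λ C → ∑ vs (λ y → ⟦ cls C ≡ᵇ j ⟧ * (⟦ set C y ⟧ * ⟦ adj v y ⟧))) ≡⟨ ∑-swap L vs _ ⟩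
      ∑ vs (λ y → ∑ L (λ C → ⟦ cls C ≡ᵇ j ⟧ * (⟦ set C y ⟧ * ⟦ adj v y ⟧)))
        ≡⟨ ∑-cong vs (λ y → trans (∑-cong L λ C → sym (*-assoc ⟦ cls C ≡ᵇ j ⟧ ⟦ set C y ⟧ _)) (∑-*ʳ L _ ⟦ adj v y ⟧)) ⟩
      ∑ vs (λ y → ∑ L (λ C → ⟦ cls C ≡ᵇ j ⟧ * ⟦ set C y ⟧) * ⟦ adj v y ⟧)
        ≤⟨ ∑-mono vs (λ y → *-monoˡ-≤ ⟦ adj v y ⟧ (classCoverage j P L valid cov y)) ⟩
      deg v (W j ∩ P) ∎
      where open ≤-Reasoning

    degreeInClass-fine : ∀ j a L v → All (λ C → cod C < a) L → degreeInClass j a L v ≡ 0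
    degreeInClass-fine j a L v coarse = ∑-zero L λ {C} m → none C (All.lookup coarse m)
      where
      none : ∀ C → cod C < a → ⟦ (cls C ≡ᵇ j) ∧ (a ≤ᵇ cod C) ⟧ * deg v (set C) ≡ 0
      none C lt with cls C ≡ᵇ j | a ≤ᵇ cod C in le
      ... | false | _ = refl
      ... | true | false = refl
      ... | true | true = contradiction (≤ᵇ-true le) (<⇒≱ lt)

    degreeInClass-skip : ∀ j {a b L} → All (λ C → cod C ≡ b) L → b < a → ∀ L′ v → degreeInClass j a (L ++ L′) v ≤ degreeInClass j a L′ v
    degreeInClass-skip j {a} {b} {L} cods b<a L′ v = ≤-reflexive (trans (∑-++ L L′ _) (cong (_+ degreeInClass j a L′ v)
      (degreeInClass-fine j a L v (All.map (λ e → subst (_< a) (sym e) b<a) cods))))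

    family : V × ℕ → V → Bool
    family (v , j) = adj v ∩ W j

    indices : List (V × ℕ)
    indices = cartesianProduct vs (range S)

    record Level (a : ℕ) (P : V → Bool) : Set where
      field
        chunks : List Chunk
        left : V → Bool
        -- The hypothesis ensures that clique slots are cut at codimension `K` only, so that all
        -- their chunks are large.
        valid : (∀ x j → j < S → P x ≡ true → W j x ≡ true → isR j ≡ false → a ≡ K) → All Valid chunks
        cods : All (λ C → cod C ≡ a) chunks
        partition : ∀ x → ⟦ P x ⟧ ≡ ⟦ left x ⟧ + coverage chunks x
        low : ∀ v {j} → j < S → deg v (W j ∩ left) < size a

    level : ∀ a P → K ≤ a → a + e ≤ n → Level a P
    level a P K≤a a+e≤n = record
      { chunks = map toChunk pieces
      ; left = left
      ; valid = λ isK → allMap pieces (λ m → m) λ m → valid₁ isK m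
      ; cods = allMap pieces (λ m → m) λ _ → refl
      ; partition = λ x → trans (partition x) (cong (⟦ left x ⟧ +_) (sym (∑-map toChunk pieces _)))
      ; low = λ v {j} j< → subst (_< size a) (trans (∑-cong vs λ x → regroup v j x) (sym (deg-∩ v (W j ∩ left))))
          (maximal {v , j} (∈-cartesianProduct⁺ (∈-all v) (∈-range⁺ j<))) }
      where
      toChunk : (V × ℕ) × (V → Bool) → Chunk
      toChunk ((v , j) , C) = chunk a j C
      size>0 : 0 < size a
      size>0 = ≤-trans (m^n>0 2 (n ∸ a)) (m≤m+n _ _)
      open Extraction (extract family indices (size a) size>0 (# P) P ≤-refl)
      regroup : ∀ v j x → ⟦ (family (v , j) ∩ left) x ⟧ ≡ ⟦ (adj v ∩ (W j ∩ left)) x ⟧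
      regroup v j x = cong ⟦_⟧ (Bool.∧-assoc (adj v x) (W j x) (left x))
      allMap : ∀ {R : Chunk → Set} ps → (∀ {C} → C ∈ ps → C ∈ pieces) → (∀ {C} → C ∈ pieces → R (toChunk C)) → All R (map toChunk ps)
      allMap [] sub h = []
      allMap (C ∷ ps) sub h = h (sub (here refl)) ∷ allMap ps (sub ∘ there) h
      range-∈ : ∀ {v j} us → (v , j) ∈ cartesianProduct us (range S) → j < S
      range-∈ (u ∷ us) m with ∈-++⁻ (map (u ,_) (range S)) m
      ... | inj₂ m′ = range-∈ us m′
      ... | inj₁ m′ with ∈-map⁻ (u ,_) m′
      ... | _ , k , refl = ∈-range⁻ k
      inP : ∀ {C} → C ∈ pieces → proj₂ C ⊆ P
      inP {C} m x cx with P x | partition x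
      ... | true | _ = refl
      ... | false | eq = case ≤-trans (≤-trans (≤-reflexive (cong ⟦_⟧ (sym cx))) (∑-∈ (λ C → ⟦ proj₂ C x ⟧) m))
            (≤-trans (m≤n+m _ ⟦ left x ⟧) (≤-reflexive (sym eq))) of λ ()
      valid₁ : (∀ x j → j < S → P x ≡ true → W j x ≡ true → isR j ≡ false → a ≡ K) → ∀ {C} → C ∈ pieces → Valid (toChunk C)
      valid₁ isK {(v , j) , C} m = record
        { cls< = j<
        ; inside = λ x cx → proj₂ (∧-true {adj v x} (sub x cx))
        ; K≤cod = K≤a
        ; kind = inj₁ (proj₁ (piece m) , a+e≤n , v , λ x cx → proj₁ (∧-true (sub x cx)))
        ; A-cod = λ isA → isK (proj₁ w) j j< (inP m (proj₁ w) (proj₂ w)) (proj₂ (∧-true {adj v (proj₁ w)} (sub (proj₁ w) (proj₂ w)))) isA }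
        where
        j< = range-∈ vs (proj₂ (proj₂ (piece m)))
        sub : C ⊆ family (v , j)
        sub = proj₁ (proj₂ (piece m))
        w : ∃[ x ] C x ≡ true
        w = #-inhabited C (subst (0 <_) (sym (proj₁ (piece m))) size>0)

AllPairs-++ : {A : Set} {R : A → A → Set} {xs ys : List A} → AllPairs R xs → AllPairs R ys →
  (∀ {x y} → x ∈ xs → y ∈ ys → R x y) → AllPairs R (xs ++ ys)
AllPairs-++ ps qs h = AllPairsₚ.++⁺ ps qs (All.tabulate λ i → All.tabulate (h i))

AllPairs-all : {A : Set} {R : A → A → Set} {xs : List A} → (∀ {x y} → x ∈ xs → y ∈ xs → R x y) → AllPairs R xs
AllPairs-all {xs = []} h = []
AllPairs-all {xs = x ∷ xs} h = All.tabulate (λ m → h (here refl) (there m)) ∷ AllPairs-all (λ a b → h (there a) (there b))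

-- Cutting the slots into chunks

module ChunkSystems (H : Host) {π : Parameters} (sl : WithHost.Slots H π) where
  open WithHost H
  open Parameters π
  open Slots sl
  open Production sl

  CoarserC : Chunk → Chunk → Set
  CoarserC C D = cod C ≤ cod D

  chunk-size : ∀ {C} → Valid C → 2 ^ (n ∸ cod C) ≤ # (set C)
  chunk-size {C} v with Valid.kind v
  ... | inj₁ (sz , le , _) = subst (2 ^ (n ∸ cod C) ≤_) (sym sz) (m≤m+n _ _)
  ... | inj₂ (sz , refl , _) rewrite sz | n∸n≡0 n = ≤-refl

  record ChunkSystem : Set where
    field
      L : List Chunk
      L-valid : All Valid L
      L-sorted : AllPairs CoarserC L
      L-disjoint : AllPairs (λ C D → Disjoint (set C) (set D)) L
      -- For `a > K` these chunks come from what was left at codimension `a − 1`, where degrees are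
      -- below `size (a − 1)`, at most 4·2^(n-a). For `a = K` the slot itself has small degrees.
      L-degrees : ∀ v {j a} → j < S → isR j ≡ true → K ≤ a → a + e ≤ n → degreeInClass j a L v ≤ 4 * 2 ^ (n ∸ a)
      L-degrees-single : ∀ v {j} → j < S → degreeInClass j n L v ≤ 2 ^ e

    classWeight : ℕ → ℕ
    classWeight j = ∑ L λ C → ⟦ cls C ≡ᵇ j ⟧ * 2 ^ (n ∸ cod C)

    field
      -- Scaled by 2^e. A remainder slot is covered entirely; a clique slot loses its leftover at
      -- codimension `K`, at most `2 * q`.
      capacity : ∀ {j} → j < S → 2 ^ e * # (W j) ≤ classWeight j * suc (2 ^ e) + 2 ^ e * (⟦ not (isR j) ⟧ * (2 * q))

module ChunkList (H : Host) {π : Parameters} (sl : WithHost.Slots H π) where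
  open WithHost H
  open Parameters π
  open Slots sl
  open Production sl
  open ChunkSystems H sl using (CoarserC; ChunkSystem)
  open Valid

  RestSet : (V → Bool) → Set
  RestSet P = ∀ x → P x ≡ true → ∃[ j ] (j < S) × (W j x ≡ true) × (isR j ≡ true)

  record Rest (a : ℕ) (P : V → Bool) : Set where
    field
      chunks : List Chunk
      valid : All Valid chunks
      cods : All (λ C → a ≤ cod C) chunks
      sorted : AllPairs CoarserC chunks
      cover : ∀ x → coverage chunks x ≡ ⟦ P x ⟧
      degrees : ∀ v {j a′} → j < S → a ≤ a′ → a′ + e ≤ n → degreeInClass j a′ chunks v ≤ 4 * 2 ^ (n ∸ a′)
      degrees-single : ∀ v {j} → j < S → degreeInClass j n chunks v ≤ 2 ^ e

  singletons : ∀ {P} → RestSet P → (xs : List V) → ∃[ L ]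
    All (λ C → Valid C × cod C ≡ n) L × (∀ y → coverage L y ≡ ∑ xs (λ x → ⟦ P x ⟧ * ⟦ does (y ≟ᵥ x) ⟧))
  singletons r [] = [] , [] , λ _ → refl
  singletons {P} r (x ∷ xs) with P x in px | singletons {P} r xs
  ... | false | L , v , c = L , v , c
  ... | true | L , v , c with r x px
  ... | j , j< , wx , isr = chunk n j (singleton x) ∷ L , (record
      { cls< = j<
      ; inside = singleton-⊆ {W j} wx
      ; K≤cod = ≤-trans (m≤m+n K e) (<⇒≤ K+e<n)
      ; kind = inj₂ (enum x , refl , isr , λ {y} {z} hy hz → trans (sym (same hy)) (same hz))
      ; A-cod = λ isA → true≢false isr isA } , refl) ∷ v ,
      λ y → cong₂ _+_ (trans (cong ⟦_⟧ (≟-sym x y)) (sym (+-identityʳ _))) (c y)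
    where
    same : ∀ {y} → singleton x y ≡ true → x ≡ y
    same {y} h with x ≟ᵥ y
    ... | yes e = e
    ... | no _ = case h of λ ()

  pow-step : ∀ a → suc a ≤ n → 2 * 2 ^ (n ∸ a) ≡ 4 * 2 ^ (n ∸ suc a)
  pow-step a le = trans (cong (λ z → 2 * 2 ^ z) (+-∸-assoc 1 le)) (sym (*-assoc 2 2 (2 ^ (n ∸ suc a))))

  deg-⊆ʳ : ∀ v {P R T : V → Bool} → R ⊆ T → deg v (P ∩ R) ≤ deg v (P ∩ T)
  deg-⊆ʳ v {P} sub = deg-mono v λ x h → case ∧-true {P x} h of λ { (a , b) → cong₂ _∧_ a (sub x b) }

  -- `k` counts the codimensions still to come before `n ∸ e`. The last hypothesis is the maximality
  -- of the previous level, and each level supplies it to the next.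
  rest : ∀ k a P → K ≤ a → k + (a + e) ≡ n → RestSet P →
    (∀ v {j} → j < S → deg v (W j ∩ P) ≤ 4 * 2 ^ (n ∸ a)) → Rest a P
  rest k a P K≤a eq r low₀ = record
    { chunks = chunks ++ T.chunks
    ; valid = Allₚ.++⁺ valid′ T.valid
    ; cods = Allₚ.++⁺ (All.map (λ e → ≤-reflexive (sym e)) cods) (All.map (≤-trans (n≤1+n a)) T.cods)
    ; sorted = AllPairs-++ (AllPairs-all λ m m′ → ≤-reflexive (trans (All.lookup cods m) (sym (All.lookup cods m′)))) T.sorted
        λ m m′ → ≤-trans (≤-reflexive (All.lookup cods m)) (≤-trans (n≤1+n a) (All.lookup T.cods m′))
    ; cover = cover′
    ; degrees = degrees′
    ; degrees-single = λ v {j} j< → ≤-trans (degreeInClass-skip j cods a<n T.chunks v) (T.degrees-single v j<) }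
    where
    a+e≤n : a + e ≤ n
    a+e≤n = subst (a + e ≤_) eq (m≤n+m (a + e) k)
    a<n : a < n
    a<n = ≤-trans (≤-trans (≤-reflexive (+-comm 1 a)) (+-monoʳ-≤ a e≥1)) a+e≤n
    open Level (level a P K≤a a+e≤n)
    valid′ : All Valid chunks
    valid′ = valid λ x j j< px wx isA → case r x px of λ { (i , i< , wi , isr) →
      true≢false (subst (λ z → isR z ≡ true) (slot-unique i< j< wi wx) isr) isA }
    left⊆ : left ⊆ P
    left⊆ x lx with P x | partition x
    ... | true | _ = refl
    ... | false | h rewrite lx = case h of λ ()
    left-rest : RestSet left
    left-rest x lx = r x (left⊆ x lx)
    tail : ∀ k → k + (a + e) ≡ n → Rest (suc a) left
    tail (suc k) eq = rest k (suc a) left (≤-trans K≤a (n≤1+n a)) (trans (+-suc k (a + e)) eq) left-rest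
      λ v j< → ≤-trans (<⇒≤ (low v j<)) (≤-trans (size≤ a) (≤-reflexive (pow-step a a<n)))
    -- Here `a + e = n` and `size a` is 2^e + 1, so every vertex has at most 2^e neighbours in what
    -- is left of a slot; this is split into single vertices.
    tail zero eq = record
      { chunks = L
      ; valid = All.map proj₁ vL
      ; cods = All.map (λ c → subst (suc a ≤_) (sym (proj₂ c)) a<n) vL
      ; sorted = AllPairs-all λ m m′ → ≤-reflexive (trans (proj₂ (All.lookup vL m)) (sym (proj₂ (All.lookup vL m′))))
      ; cover = coverL
      ; degrees = λ v j< a<a′ le → contradiction (≤-trans (+-monoˡ-≤ e a<a′) le) (<⇒≱ (s≤s (≤-reflexive (sym eq))))
      ; degrees-single = λ v {j} j< → ≤-trans (degreeInClass-≤ j n left L (All.map proj₁ vL) (λ x → ≤-reflexive (coverL x)) v)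
          (≤-pred (subst (deg v (W j ∩ left) <_) size-last (low v j<))) }
      where
      Ls = singletons left-rest vs
      L = proj₁ Ls
      vL = proj₁ (proj₂ Ls)
      coverL : ∀ x → coverage L x ≡ ⟦ left x ⟧
      coverL x = trans (proj₂ (proj₂ Ls) x) (trans (∑-cong vs λ y → *-comm ⟦ left y ⟧ _) (∑-point x (⟦_⟧ ∘ left)))
      size-last : size a ≡ suc (2 ^ e)
      size-last = trans (cong₂ (λ x y → 2 ^ x + 2 ^ y) (trans (cong (_∸ a) (sym eq)) (m+n∸m≡n a e)) (trans (cong (_∸ (a + e)) (sym eq)) (n∸n≡0 (a + e)))) (+-comm (2 ^ e) 1)
    module T = Rest (tail k eq)
    cover′ : ∀ x → coverage (chunks ++ T.chunks) x ≡ ⟦ P x ⟧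
    cover′ x = trans (∑-++ chunks T.chunks _) (trans (+-comm (coverage chunks x) _)
      (trans (cong (_+ coverage chunks x) (T.cover x)) (sym (partition x))))
    degrees′ : ∀ v {j a′} → j < S → a ≤ a′ → a′ + e ≤ n → degreeInClass j a′ (chunks ++ T.chunks) v ≤ 4 * 2 ^ (n ∸ a′)
    degrees′ v {j} {a′} j< a≤ le with m≤n⇒m<n∨m≡n a≤
    ... | inj₂ refl = ≤-trans (degreeInClass-≤ j a P (chunks ++ T.chunks) (Allₚ.++⁺ valid′ T.valid) (λ x → ≤-reflexive (cover′ x)) v) (low₀ v j<)
    ... | inj₁ a< = ≤-trans (degreeInClass-skip j cods a< T.chunks v) (T.degrees v j< a< le)

  inSome : V → Bool
  inSome x = 1 ≤ᵇ ∑ (range S) (λ j → ⟦ W j x ⟧)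

  inRest : V → Bool
  inRest x = 1 ≤ᵇ ∑ (range S) (λ j → ⟦ W j x ∧ isR j ⟧)

  -- Codimension `K` is cut in all slots at once, `family` keeping each chunk inside one slot. Only
  -- leftovers of the remainder are cut further.
  module Top = Level (level K inSome ≤-refl (<⇒≤ K+e<n))

  inRest-RestSet : RestSet (Top.left ∩ inRest)
  inRest-RestSet x h with ∑-< (range S) {λ _ → 0} {λ j → ⟦ W j x ∧ isR j ⟧}
    (subst (_< ∑ (range S) (λ j → ⟦ W j x ∧ isR j ⟧)) (sym (∑-zero (range S) λ _ → refl)) (≤ᵇ-true (proj₂ (∧-true {Top.left x} h))))
  ... | j , j∈ , lt = j , ∈-range⁻ j∈ , ∧-true (proj₁ (<⟦⟧ lt))

  module Bottom = Rest (rest (n ∸ (suc K + e)) (suc K) (Top.left ∩ inRest) (n≤1+n K) (m∸n+n≡m K+e<n) inRest-RestSet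
    λ v {j} j< → ≤-trans (deg-⊆ʳ v {W j} (λ x h → proj₁ (∧-true h))) (≤-trans (<⇒≤ (Top.low v j<)) (≤-trans (size≤ K)
      (≤-reflexive (pow-step K (≤-trans (s≤s (m≤m+n K e)) K+e<n))))))

  L : List Chunk
  L = Top.chunks ++ Bottom.chunks

  L-valid : All Valid L
  L-valid = Allₚ.++⁺ (Top.valid λ _ _ _ _ _ _ → refl) Bottom.valid

  L-sorted : AllPairs CoarserC L
  L-sorted = AllPairs-++ (AllPairs-all λ m m′ → ≤-reflexive (trans (All.lookup Top.cods m) (sym (All.lookup Top.cods m′)))) Bottom.sorted
    λ m m′ → ≤-trans (≤-reflexive (All.lookup Top.cods m)) (≤-trans (n≤1+n K) (All.lookup Bottom.cods m′))

  coverage-L : ∀ x → coverage L x ≡ coverage Top.chunks x + ⟦ (Top.left ∩ inRest) x ⟧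
  coverage-L x = trans (∑-++ Top.chunks Bottom.chunks _) (cong (coverage Top.chunks x +_) (Bottom.cover x))

  coverage-L≤ : ∀ x → coverage L x ≤ ⟦ inSome x ⟧
  coverage-L≤ x = ≤-trans (≤-reflexive (coverage-L x)) (≤-trans (+-monoʳ-≤ (coverage Top.chunks x)
    (⟦⟧-mono {(Top.left ∩ inRest) x} λ h → proj₁ (∧-true h))) (≤-reflexive (trans (+-comm _ ⟦ Top.left x ⟧) (sym (Top.partition x)))))

  disjoint-list : ∀ M → (∀ x → coverage M x ≤ 1) → AllPairs (λ C D → Disjoint (set C) (set D)) M
  disjoint-list [] h = []
  disjoint-list (C ∷ M) h = All.tabulate (λ {D} m x cx dx → <⇒≱ (≤-trans (≤-reflexive (cong₂ (λ a b → ⟦ a ⟧ + ⟦ b ⟧) (sym cx) (sym dx)))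
      (+-monoʳ-≤ ⟦ set C x ⟧ (∑-∈ (λ D → ⟦ set D x ⟧) m))) (h x))
    ∷ disjoint-list M λ x → ≤-trans (m≤n+m _ ⟦ set C x ⟧) (h x)

  L-disjoint : AllPairs (λ C D → Disjoint (set C) (set D)) L
  L-disjoint = disjoint-list L λ x → ≤-trans (coverage-L≤ x) (⟦⟧≤1 _)

  L-degrees : ∀ v {j a} → j < S → isR j ≡ true → K ≤ a → a + e ≤ n → degreeInClass j a L v ≤ 4 * 2 ^ (n ∸ a)
  L-degrees v {j} {a} j< isr K≤a le with m≤n⇒m<n∨m≡n K≤a
  ... | inj₂ refl = ≤-trans (degreeInClass-≤ j K inSome L L-valid coverage-L≤ v)
        (≤-trans (deg-mono v {W j ∩ inSome} {W j} λ x h → proj₁ (∧-true h)) (≤-trans (rest-slot j< isr v) (m≤n*m _ 4)))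
  ... | inj₁ a< = ≤-trans (degreeInClass-skip j Top.cods a< Bottom.chunks v) (Bottom.degrees v j< a< le)

  K<n : K < n
  K<n = ≤-trans (s≤s (m≤m+n K e)) K+e<n

  L-degrees-single : ∀ v {j} → j < S → degreeInClass j n L v ≤ 2 ^ e
  L-degrees-single v {j} j< = ≤-trans (degreeInClass-skip j Top.cods K<n Bottom.chunks v) (Bottom.degrees-single v j<)

  classWeight : ℕ → ℕ
  classWeight j = ∑ L λ C → ⟦ cls C ≡ᵇ j ⟧ * 2 ^ (n ∸ cod C)

  chunk-weight : ∀ {C} → Valid C → 2 ^ e * # (set C) ≤ 2 ^ (n ∸ cod C) * suc (2 ^ e)
  chunk-weight {C} v with kind v
  ... | inj₁ (sz , le , _) = ≤-reflexive (trans (cong (2 ^ e *_) sz) (trans (*-distribˡ-+ (2 ^ e) (2 ^ (n ∸ cod C)) _)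
          (trans (cong (2 ^ e * 2 ^ (n ∸ cod C) +_) (2^e*2^ (cod C) le))
            (solve 2 (λ a b → a :* b :+ b := b :* (con 1 :+ a)) refl (2 ^ e) (2 ^ (n ∸ cod C))))))
  ... | inj₂ (sz , refl , _) rewrite sz | n∸n≡0 n | *-identityʳ (2 ^ e) | +-identityʳ (2 ^ e) = n≤1+n _

  capacity : ∀ {j} → j < S → 2 ^ e * # (W j) ≤ classWeight j * suc (2 ^ e) + 2 ^ e * (⟦ not (isR j) ⟧ * (2 * q))
  capacity {j} j< = begin
    2 ^ e * # (W j) ≤⟨ *-monoʳ-≤ (2 ^ e) (∑-mono vs pointwise) ⟩
    2 ^ e * ∑ vs (λ x → ∑ L (λ C → c C * ⟦ set C x ⟧) + ⟦ not (isR j) ⟧ * ⟦ (W j ∩ Top.left) x ⟧)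
      ≡⟨ cong (2 ^ e *_) (trans (∑-+ vs _ _) (cong₂ _+_ (trans (∑-swap vs L _) (∑-cong L λ C → ∑-*ˡ vs (c C) _)) (∑-*ˡ vs ⟦ not (isR j) ⟧ _))) ⟩
    2 ^ e * (∑ L (λ C → c C * # (set C)) + ⟦ not (isR j) ⟧ * # (W j ∩ Top.left)) ≡⟨ *-distribˡ-+ (2 ^ e) (∑ L (λ C → c C * # (set C))) _ ⟩
    2 ^ e * ∑ L (λ C → c C * # (set C)) + 2 ^ e * (⟦ not (isR j) ⟧ * # (W j ∩ Top.left))
      ≤⟨ +-mono-≤ chunks-part (*-monoʳ-≤ (2 ^ e) left-part) ⟩
    classWeight j * suc (2 ^ e) + 2 ^ e * (⟦ not (isR j) ⟧ * (2 * q)) ∎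
    where
    open ≤-Reasoning
    c : Chunk → ℕ
    c C = ⟦ cls C ≡ᵇ j ⟧
    chunks-part : 2 ^ e * ∑ L (λ C → c C * # (set C)) ≤ classWeight j * suc (2 ^ e)
    chunks-part = begin
      2 ^ e * ∑ L (λ C → c C * # (set C)) ≡⟨ sym (∑-*ˡ L (2 ^ e) _) ⟩
      ∑ L (λ C → 2 ^ e * (c C * # (set C))) ≤⟨ ∑-mono∈ L (λ {C} m → ≤-trans
        (≤-reflexive (solve 3 (λ a b s → a :* (b :* s) := b :* (a :* s)) refl (2 ^ e) (c C) (# (set C))))
        (≤-trans (*-monoʳ-≤ (c C) (chunk-weight (All.lookup L-valid m))) (≤-reflexive (sym (*-assoc (c C) _ _))))) ⟩
      ∑ L (λ C → c C * 2 ^ (n ∸ cod C) * suc (2 ^ e)) ≡⟨ ∑-*ʳ L _ (suc (2 ^ e)) ⟩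
      classWeight j * suc (2 ^ e) ∎
    -- A clique slot lies in one neighbourhood, so its leftover is bounded by maximality: otherwise
    -- another chunk could be cut from it.
    left-part : ⟦ not (isR j) ⟧ * # (W j ∩ Top.left) ≤ ⟦ not (isR j) ⟧ * (2 * q)
    left-part = ⟦⟧*-mono (not (isR j)) λ h → case clique-slot j< (trans (sym (Bool.not-involutive (isR j))) (cong not h)) of λ { (v , sub) →
      ≤-trans (#-mono {W j ∩ Top.left} {adj v ∩ (W j ∩ Top.left)} λ x m → cong₂ _∧_ (sub x (proj₁ (∧-true m))) m)
        (≤-trans (≤-reflexive (sym (deg-∩ v (W j ∩ Top.left)))) (≤-trans (<⇒≤ (Top.low v j<)) (≤-trans (size≤ K) (*-monoʳ-≤ 2 cell≤q)))) }
    pointwise : ∀ x → ⟦ W j x ⟧ ≤ ∑ L (λ C → c C * ⟦ set C x ⟧) + ⟦ not (isR j) ⟧ * ⟦ (W j ∩ Top.left) x ⟧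
    pointwise x with W j x in wx
    ... | false = z≤n
    ... | true = subst (λ z → 1 ≤ z + ⟦ not (isR j) ⟧ * ⟦ Top.left x ⟧) cls-eq (subst (λ z → 1 ≤ z + ⟦ not (isR j) ⟧ * ⟦ Top.left x ⟧) (sym (coverage-L x)) (one (isR j) refl))
      where
      same : ∀ C → Valid C → ⟦ set C x ⟧ ≡ c C * ⟦ set C x ⟧
      same C v with set C x in sx
      ... | false = sym (*-zeroʳ (c C))
      ... | true rewrite slot-unique (cls< v) j< (inside v x sx) wx | ≡ᵇ-refl j = refl
      ∑-cong∈ : {A : Set} (xs : List A) {f g : A → ℕ} → (∀ {y} → y ∈ xs → f y ≡ g y) → ∑ xs f ≡ ∑ xs g
      ∑-cong∈ [] h = refl
      ∑-cong∈ (y ∷ xs) h = cong₂ _+_ (h (here refl)) (∑-cong∈ xs (h ∘ there))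
      cls-eq : coverage L x ≡ ∑ L (λ C → c C * ⟦ set C x ⟧)
      cls-eq = ∑-cong∈ L λ {C} m → same C (All.lookup L-valid m)
      some : 1 ≤ ⟦ Top.left x ⟧ + coverage Top.chunks x
      some = subst (1 ≤_) (Top.partition x) (≤-reflexive (cong ⟦_⟧ (sym (≤ᵇ-intro (≤-trans (≤-reflexive (cong ⟦_⟧ (sym wx))) (∑-∈ (λ j → ⟦ W j x ⟧) (∈-range⁺ j<)))))))
      one : ∀ r → isR j ≡ r → 1 ≤ coverage Top.chunks x + ⟦ (Top.left ∩ inRest) x ⟧ + ⟦ not r ⟧ * ⟦ Top.left x ⟧
      one false _ = ≤-trans some (≤-trans (≤-reflexive (+-comm ⟦ Top.left x ⟧ _))
        (+-mono-≤ (m≤m+n (coverage Top.chunks x) _) (≤-reflexive (sym (+-identityʳ _)))))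
      one true isr = ≤-trans some (≤-trans (≤-reflexive (trans (+-comm ⟦ Top.left x ⟧ _) (cong (λ z → coverage Top.chunks x + ⟦ z ⟧)
        (trans (sym (Bool.∧-identityʳ (Top.left x))) (cong (Top.left x ∧_) (sym rx)))))) (m≤m+n _ _))
        where
        rx : inRest x ≡ true
        rx = ≤ᵇ-intro (≤-trans (≤-reflexive (cong ⟦_⟧ (sym (trans (cong₂ _∧_ wx isr) refl)))) (∑-∈ (λ j → ⟦ W j x ∧ isR j ⟧) (∈-range⁺ j<)))

  chunkSystem : ChunkSystem
  chunkSystem = record
    { L = L ; L-valid = L-valid ; L-sorted = L-sorted ; L-disjoint = L-disjoint
    ; L-degrees = L-degrees ; L-degrees-single = L-degrees-single ; capacity = capacity }

-- The two alternatives are a direction blocked by a regular chunk, where the loss decays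
-- geometrically, and one blocked by a single vertex, where it is bounded but does not decay.
mixed-sum : ∀ n (ω : ℕ → ℕ) X Y → (∀ {i} → i < n → (ω i * 2 ^ q4 i ≤ X) ⊎ (ω i ≤ Y)) → ∑ (range n) ω ≤ 8 * X + n * Y
mixed-sum n ω X Y h = ≤-trans (∑-mono∈ (range n) λ m → pointwise (∈-range⁻ m)) (≤-trans (≤-reflexive (∑-+ (range n) ω₁ _))
  (+-mono-≤ (geometric-sum n ω₁ X λ {i} _ → small i) (≤-reflexive (trans (∑-const (range n) Y) (cong (_* Y) (length-range n))))))
  where
  ω₁ : ℕ → ℕ
  ω₁ i = if ω i * 2 ^ q4 i ≤ᵇ X then ω i else 0
  small : ∀ i → ω₁ i * 2 ^ q4 i ≤ X
  small i with ω i * 2 ^ q4 i ≤ᵇ X in eq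
  ... | true = ≤ᵇ-true eq
  ... | false = z≤n
  pointwise : ∀ {i} → i < n → ω i ≤ ω₁ i + Y
  pointwise {i} lt with h lt
  ... | inj₁ le rewrite ≤ᵇ-intro le = m≤m+n _ Y
  ... | inj₂ le = ≤-trans le (m≤n+m Y _)

-- Allocating a chunk to every vertex of the cube

module CubeFromSlots (H : Host) {π : Parameters} (sl : WithHost.Slots H π) where
  open WithHost H
  open Parameters π
  open Slots sl
  open Production sl
  open ChunkSystems H sl
  open Valid

  record Assignment : Set where
    field
      σ : ℕ → ℕ
      σ< : ∀ {w} → w ≤ K → σ w < S
      σ-step : ∀ {w} → w < K → (σ (suc w) ≡ σ w) ⊎ (σ (suc w) ≡ suc (σ w))
      -- The `2 * q` pays in a clique slot for what no chunk covers, in a remainder slot for the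
      -- discarded chunks.
      room : ∀ {j} → j < S →
        ∑ (cube n) (λ p → ⟦ σ (wt K p) ≡ᵇ j ⟧) * suc (2 ^ e) + 2 ^ e * (2 * q) ≤ 2 ^ e * # (W j)

  module WithChunks (system : ChunkSystem) (as : Assignment) where
    open ChunkSystem system
    open Assignment as

    cl : Vec Bool n → ℕ
    cl p = σ (wt K p)

    cl< : ∀ p → cl p < S
    cl< p = σ< (wt≤ K p)

    -- A pair of chunks adjacent in direction i may have density 1/tᵢ². The growth rate makes both the sum of 1/tᵢ
    -- (vertices unusable inside a chunk) and the sum of tᵢ²2⁻ⁱ (discarded chunks) converge.
    t : ℕ → ℕ
    t i = 2 ^ (τ + q4 i)

    t-bound : ∀ {i} → i < K → t i * t i ≤ 2 ^ (τ + K′) * 2 ^ (τ + K′)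
    t-bound {i} lt = *-mono-≤ le le
      where
      le : t i ≤ 2 ^ (τ + K′)
      le = ^-monoʳ-≤ 2 (+-monoʳ-≤ τ (<⇒≤ (*-cancelˡ-< 4 (q4 i) K′ (≤-<-trans (4*q4≤ i) lt))))

    Cmp : ℕ → Chunk → Chunk → Bool
    Cmp i C D = edges (set C) (set D) * (t i * t i) ≤ᵇ # (set C) * # (set D)

    Cmp-sym : ∀ i C D → Cmp i C D ≡ Cmp i D C
    Cmp-sym i C D = cong₂ (λ x y → x * (t i * t i) ≤ᵇ y) (edges-sym (set C) (set D)) (*-comm (# (set C)) _)

    -- A vertex of `C` has at most `d` neighbours in the whole slot of `D`, while `D` has
    -- codimension `K` and so at least 2^(n-K) vertices; `d-small` compares the two.
    sparse-compat : ∀ {i C D} → i < K → Valid C → Valid D →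
      Sparse d (W (cls C)) (W (cls D)) → isR (cls D) ≡ false → Cmp i C D ≡ true
    sparse-compat {i} {C} {D} lt vC vD sp isA = ≤ᵇ-intro (begin
      edges (set C) (set D) * (t i * t i) ≤⟨ *-mono-≤ (edges-≤ (set C) (set D) d λ x cx →
        ≤-trans (deg-mono x (inside vD)) (sp x (inside vC x cx))) (t-bound lt) ⟩
      # (set C) * d * (2 ^ (τ + K′) * 2 ^ (τ + K′)) ≡⟨ *-assoc (# (set C)) d _ ⟩
      # (set C) * (d * (2 ^ (τ + K′) * 2 ^ (τ + K′))) ≤⟨ *-monoʳ-≤ (# (set C)) d-small ⟩
      # (set C) * 2 ^ (n ∸ K) ≤⟨ *-monoʳ-≤ (# (set C)) (subst (λ z → 2 ^ (n ∸ z) ≤ # (set D)) (A-cod vD isA) (chunk-size vD)) ⟩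
      # (set C) * # (set D) ∎)
      where open ≤-Reasoning

    same-compat : ∀ {i C D} → Valid C → Valid D → cls C ≡ cls D → isR (cls C) ≡ false → Cmp i C D ≡ true
    same-compat {i} {C} {D} vC vD same isA = ≤ᵇ-intro (subst (λ z → z * (t i * t i) ≤ # (set C) * # (set D))
      (sym (n≤0⇒n≡0 (≤-trans (edges-≤ (set C) (set D) 0 none) (≤-reflexive (*-zeroʳ (# (set C))))))) z≤n)
      where
      nbr = clique-slot (cls< vC) isA
      none : ∀ x → set C x ≡ true → deg x (set D) ≤ 0
      none x cx = ≤-trans (deg-mono x (subst (λ z → set D ⊆ W z) (sym same) (inside vD)))
        (≤-reflexive (deg-independent (neighbourhood-independent (proj₂ nbr)) (inside vC x cx)))

    linked-compat : ∀ {i C D} → i < K → Valid C → Valid D → cls D ≡ suc (cls C) →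
      (isR (cls C) ≡ false) ⊎ (isR (cls D) ≡ false) → Cmp i C D ≡ true
    linked-compat {i} {C} {D} lt vC vD e a with subst (λ z → Linked d (slot (cls C)) (slot z)) (sym e) (linked (subst (_< S) e (cls< vD)))
    ... | inj₂ (inj₁ (sp , isA)) = sparse-compat lt vC vD sp isA
    ... | inj₂ (inj₂ (sp , isA)) = trans (Cmp-sym i C D) (sparse-compat lt vD vC sp isA)
    linked-compat lt vC vD e (inj₁ a) | inj₁ (r , r′) = true≢false r a
    linked-compat lt vC vD e (inj₂ a) | inj₁ (r , r′) = true≢false r′ a

    near : ∀ {u v} → v ≤ K → v ≡ suc u → (σ v ≡ σ u) ⊎ (σ v ≡ suc (σ u))
    near le refl = σ-step le

    -- A direction `i ≥ K` keeps the layer, and `i < K` changes the weight, hence the slot index, by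
    -- at most one. Inside a clique slot there are no blue edges; between consecutive slots the link
    -- applies.
    neighbour-compat : ∀ {i C D} p → Valid C → Valid D → cls C ≡ cl p → cls D ≡ cl (flip i p) →
      (isR (cls C) ≡ false) ⊎ (isR (cls D) ≡ false) → Cmp i C D ≡ true
    neighbour-compat {i} {C} {D} p vC vD cC cD a = go (i <? K) (wt-flip K i p)
      where
      stay : cl (flip i p) ≡ cl p → Cmp i C D ≡ true
      stay e = same-compat {i} vC vD CD (isA a)
        where
        CD : cls C ≡ cls D
        CD = trans cC (trans (sym e) (sym cD))
        isA : (isR (cls C) ≡ false) ⊎ (isR (cls D) ≡ false) → isR (cls C) ≡ false
        isA (inj₁ h) = h
        isA (inj₂ h) = trans (cong isR CD) h
      swap-⊎ : (isR (cls C) ≡ false) ⊎ (isR (cls D) ≡ false) → (isR (cls D) ≡ false) ⊎ (isR (cls C) ≡ false)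
      swap-⊎ (inj₁ h) = inj₂ h
      swap-⊎ (inj₂ h) = inj₁ h
      go : Dec (i < K) → Consecutive (wt K p) (wt K (flip i p)) → Cmp i C D ≡ true
      go (no K≤i) _ = stay (cong σ (sym (agree⇒wt K p (flip i p) (agree-flip-≥ p (≮⇒≥ K≤i)))))
      go (yes _) (inj₁ e) = stay (cong σ e)
      go (yes lt) (inj₂ (inj₁ e)) = case near (wt≤ K (flip i p)) e of λ
        { (inj₁ s) → stay s
        ; (inj₂ s) → linked-compat lt vC vD (trans cD (trans s (cong suc (sym cC)))) a }
      go (yes lt) (inj₂ (inj₂ e)) = case near (wt≤ K p) e of λ
        { (inj₁ s) → stay (sym s)
        ; (inj₂ s) → trans (Cmp-sym i C D) (linked-compat lt vD vC (trans cC (trans s (cong suc (sym cD)))) (swap-⊎ a)) }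

    module Pack = Packing n K cod cls Cmp Cmp-sym (λ C D → Disjoint (set C) (set D)) (λ h x dx cx → h x cx dx)
      cl (λ p q h → cong σ (agree⇒wt K p q h))

    packed : Pack.State L []
    packed = Pack.pack L (All.map K≤cod L-valid) L-sorted L-disjoint

    module FromState (st : Pack.State L []) where
      open Pack.State st

      al-valid : ∀ {p C} → al p ≡ just C → Valid C
      al-valid e = All.lookup L-valid (al-∈ e)

      #>0 : ∀ {C} → Valid C → 0 < # (set C)
      #>0 {C} v = ≤-trans (m^n>0 2 (n ∸ cod C)) (chunk-size v)

      -- If `p` is free, its class has more cube vertices than occupied ones. By `room` the slot has
      -- chunks for all of them, so much weight must have been discarded; but every discarded chunk
      -- of this class is blocked by a neighbour of `p`, which bounds that weight.
      module Unallocated (p : Vec Bool n) (free : al p ≡ nothing) where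
        j : ℕ
        j = cl p

        bad : Maybe Chunk → ℕ → Chunk → Bool
        bad nothing i C = false
        bad (just D) i C = not (Cmp i D C) ∧ ((suc i ≤ᵇ cod D) ∧ (cod D ≤ᵇ cod C))

        wasted : ℕ → Chunk → Chunk → ℕ
        wasted i D C = ⟦ (cls C ≡ᵇ j) ∧ bad (just D) i C ⟧ * # (set C)

        hit : ℕ → Chunk → Bool
        hit i C = (cls C ≡ᵇ j) ∧ bad (al (flip i p)) i C

        ω : ℕ → ℕ
        ω i = ∑ L λ C → ⟦ hit i C ⟧ * # (set C)

        X : ℕ
        X = 2 ^ (n + (2 * τ + 2) ∸ K′)

        -- The discarded chunks blocked by a coarser chunk D through direction i together have at most
        -- tᵢ² times the largest degree of D into them.
        regular-waste : ∀ {i D} → Valid D → Regular D → isR j ≡ true → i < cod D →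
          ∑ L (wasted i D) * 2 ^ q4 i ≤ X
        regular-waste {i} {D} vD (sz , le , _) isr i< = begin
          A * 2 ^ q4 i ≤⟨ *-monoˡ-≤ (2 ^ q4 i) cancelled ⟩
          t i * t i * (4 * 2 ^ (n ∸ a)) * 2 ^ q4 i
            ≡⟨ cong₂ (λ x y → x * (4 * 2 ^ (n ∸ a)) * y) (sym (^-distribˡ-+-* 2 (τ + q4 i) (τ + q4 i))) refl ⟩
          2 ^ ((τ + q4 i) + (τ + q4 i)) * (4 * 2 ^ (n ∸ a)) * 2 ^ q4 i
            ≡⟨ cong (λ z → 2 ^ ((τ + q4 i) + (τ + q4 i)) * z * 2 ^ q4 i) (sym (^-distribˡ-+-* 2 2 (n ∸ a))) ⟩
          2 ^ ((τ + q4 i) + (τ + q4 i)) * 2 ^ (2 + (n ∸ a)) * 2 ^ q4 i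
            ≡⟨ trans (cong (_* 2 ^ q4 i) (sym (^-distribˡ-+-* 2 ((τ + q4 i) + (τ + q4 i)) (2 + (n ∸ a))))) (sym (^-distribˡ-+-* 2 ((τ + q4 i) + (τ + q4 i) + (2 + (n ∸ a))) (q4 i))) ⟩
          2 ^ (((τ + q4 i) + (τ + q4 i) + (2 + (n ∸ a))) + q4 i) ≤⟨ ^-monoʳ-≤ 2 exponent ⟩
          X ∎
          where
          open ≤-Reasoning
          a = cod D
          A = ∑ L (wasted i D)
          pointwise : ∀ C → wasted i D C * # (set D)
            ≤ ∑ vs (λ x → ⟦ set D x ⟧ * (⟦ (cls C ≡ᵇ j) ∧ (a ≤ᵇ cod C) ⟧ * deg x (set C))) * (t i * t i)
          pointwise C with cls C ≡ᵇ j | Cmp i D C in c | suc i ≤ᵇ cod D | cod D ≤ᵇ cod C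
          ... | false | _ | _ | _ = z≤n
          ... | true | true | _ | _ = z≤n
          ... | true | false | false | _ = z≤n
          ... | true | false | true | false = z≤n
          ... | true | false | true | true = ≤-trans (≤-reflexive (trans (cong (_* # (set D)) (+-identityʳ (# (set C)))) (*-comm (# (set C)) _)))
            (≤-trans (<⇒≤ (≤ᵇ-false c)) (≤-reflexive (cong (_* (t i * t i)) (∑-cong vs λ x → cong (⟦ set D x ⟧ *_) (sym (+-identityʳ _))))))
          multiplied : A * # (set D) ≤ (t i * t i * (4 * 2 ^ (n ∸ a))) * # (set D)
          multiplied = begin
            A * # (set D) ≡⟨ sym (∑-*ʳ L _ (# (set D))) ⟩
            ∑ L (λ C → wasted i D C * # (set D)) ≤⟨ ∑-mono L pointwise ⟩
            ∑ L (λ C → ∑ vs (λ x → ⟦ set D x ⟧ * (⟦ (cls C ≡ᵇ j) ∧ (a ≤ᵇ cod C) ⟧ * deg x (set C))) * (t i * t i)) ≡⟨ ∑-*ʳ L _ (t i * t i) ⟩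
            ∑ L (λ C → ∑ vs (λ x → ⟦ set D x ⟧ * (⟦ (cls C ≡ᵇ j) ∧ (a ≤ᵇ cod C) ⟧ * deg x (set C)))) * (t i * t i)
              ≡⟨ cong (_* (t i * t i)) (trans (∑-swap L vs _) (∑-cong vs λ x → ∑-*ˡ L ⟦ set D x ⟧ _)) ⟩
            ∑ vs (λ x → ⟦ set D x ⟧ * degreeInClass j a L x) * (t i * t i)
              ≤⟨ *-monoˡ-≤ (t i * t i) (∑-mono vs λ x → *-monoʳ-≤ ⟦ set D x ⟧ (L-degrees x (cl< p) isr (K≤cod vD) le)) ⟩
            ∑ vs (λ x → ⟦ set D x ⟧ * (4 * 2 ^ (n ∸ a))) * (t i * t i) ≡⟨ cong (_* (t i * t i)) (∑-*ʳ vs _ (4 * 2 ^ (n ∸ a))) ⟩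
            # (set D) * (4 * 2 ^ (n ∸ a)) * (t i * t i)
              ≡⟨ solve 3 (λ x y z → x :* y :* z := (z :* y) :* x) refl (# (set D)) (4 * 2 ^ (n ∸ a)) (t i * t i) ⟩
            (t i * t i * (4 * 2 ^ (n ∸ a))) * # (set D) ∎
          cancelled : A ≤ t i * t i * (4 * 2 ^ (n ∸ a))
          cancelled = *-cancelʳ-≤ _ _ (# (set D)) {{>-nonZero (#>0 vD)}} multiplied
          -- Two of the three `q4 i` come from tᵢ², one from the decay wanted by `mixed-sum`. Both
          -- `4 * K′` and `4 * q4 i` are at most `a`, so the larger of `K′` and `q4 i` can stand for
          -- the other.
          three : 3 * q4 i + K′ ≤ a
          three with ≤-total (q4 i) K′
          ... | inj₁ le′ = ≤-trans (≤-trans (+-monoˡ-≤ K′ (*-monoʳ-≤ 3 le′)) (≤-reflexive (+-comm (3 * K′) K′))) (K≤cod vD)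
          ... | inj₂ le′ = ≤-trans (≤-trans (+-monoʳ-≤ (3 * q4 i) le′) (≤-reflexive (+-comm (3 * q4 i) (q4 i)))) (≤-trans (4*q4≤ i) (<⇒≤ i<))
          a≤n : a ≤ n
          a≤n = ≤-trans (m≤m+n a e) le
          exponent : ((τ + q4 i) + (τ + q4 i) + (2 + (n ∸ a))) + q4 i ≤ n + (2 * τ + 2) ∸ K′
          exponent = m+n≤o⇒m≤o∸n _ (begin
            (((τ + q4 i) + (τ + q4 i) + (2 + (n ∸ a))) + q4 i) + K′
              ≡⟨ solve 4 (λ t q m k → ((t :+ q) :+ (t :+ q) :+ (con 2 :+ m)) :+ q :+ k := (m :+ (con 3 :* q :+ k)) :+ (con 2 :* t :+ con 2)) refl τ (q4 i) (n ∸ a) K′ ⟩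
            ((n ∸ a) + (3 * q4 i + K′)) + (2 * τ + 2) ≤⟨ +-monoˡ-≤ (2 * τ + 2) (≤-trans (+-monoʳ-≤ (n ∸ a) three) (≤-reflexive (m∸n+n≡m a≤n))) ⟩
            n + (2 * τ + 2) ∎)

        -- A chunk blocked by a single vertex is no coarser, hence itself a single vertex, and
        -- incompatible means adjacent. So only neighbours of one vertex are wasted.
        single-waste : ∀ {i D} → Valid D → Single D →
          ∑ L (wasted i D) ≤ 2 ^ e
        single-waste {i} {D} vD (sz , refl , _ , unique) = begin
          ∑ L (wasted i D) ≤⟨ ∑-mono∈ L (λ m → pointwise (All.lookup L-valid m)) ⟩
          ∑ L (λ C → ∑ vs (λ x → ⟦ set D x ⟧ * (⟦ (cls C ≡ᵇ j) ∧ (n ≤ᵇ cod C) ⟧ * deg x (set C)))) ≡⟨ trans (∑-swap L vs _) (∑-cong vs λ x → ∑-*ˡ L ⟦ set D x ⟧ _) ⟩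
          ∑ vs (λ x → ⟦ set D x ⟧ * degreeInClass j n L x) ≤⟨ ∑-mono vs (λ x → *-monoʳ-≤ ⟦ set D x ⟧ (L-degrees-single x (cl< p))) ⟩
          ∑ vs (λ x → ⟦ set D x ⟧ * 2 ^ e) ≡⟨ ∑-*ʳ vs _ (2 ^ e) ⟩
          # (set D) * 2 ^ e ≡⟨ trans (cong (_* 2 ^ e) sz) (*-identityˡ (2 ^ e)) ⟩
          2 ^ e ∎
          where
          open ≤-Reasoning
          pointwise : ∀ {C} → Valid C → wasted i D C
            ≤ ∑ vs (λ x → ⟦ set D x ⟧ * (⟦ (cls C ≡ᵇ j) ∧ (n ≤ᵇ cod C) ⟧ * deg x (set C)))
          pointwise {C} vC with cls C ≡ᵇ j | Cmp i D C in c | suc i ≤ᵇ n | n ≤ᵇ cod C in nc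
          ... | false | _ | _ | _ = z≤n
          ... | true | true | _ | _ = z≤n
          ... | true | false | false | _ = z≤n
          ... | true | false | true | false = z≤n
          ... | true | false | true | true = ≤-trans (≤-reflexive (+-identityʳ _)) (≤-trans (≤-reflexive #C≡1)
                  (≤-trans (edges>0 (≤-<-trans z≤n (≤ᵇ-false c))) (≤-reflexive (∑-cong vs λ x → cong (⟦ set D x ⟧ *_) (sym (+-identityʳ _))))))
            where
            edges>0 : ∀ {m k} → 0 < m * k → 1 ≤ m
            edges>0 {suc m} _ = s≤s z≤n
            #C≡1 : # (set C) ≡ 1
            #C≡1 with kind vC
            ... | inj₂ (one , _) = one
            ... | inj₁ (_ , le , _) = contradiction (≤-trans (≤-reflexive (+-comm 1 (cod C))) (≤-trans (+-monoʳ-≤ (cod C) e≥1) le)) (<⇒≱ (s≤s (≤ᵇ-true nc)))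

        ω-bound : isR j ≡ true → ∀ {i} → i < n → (ω i * 2 ^ q4 i ≤ X) ⊎ (ω i ≤ 2 ^ e)
        ω-bound isr {i} lt with al (flip i p) in eq
        ... | nothing = inj₂ (≤-trans (≤-reflexive (∑-zero L λ {C} _ → cong (λ z → ⟦ z ⟧ * # (set C)) (Bool.∧-zeroʳ (cls C ≡ᵇ j)))) z≤n)
        ... | just D with kind (al-valid eq) | i <? cod D
        ... | inj₂ single | _ = inj₂ (single-waste {i} (al-valid eq) single)
        ... | inj₁ regular | yes i< = inj₁ (regular-waste (al-valid eq) regular isr i<)
        ... | inj₁ regular | no i≮ = inj₂ (≤-trans (≤-reflexive (∑-zero L λ {C} _ → none C)) z≤n)
          where
          none : ∀ C → wasted i D C ≡ 0
          none C rewrite ¬true (λ h → i≮ (≤ᵇ-true {suc i} {cod D} h)) | Bool.∧-zeroʳ (not (Cmp i D C)) | Bool.∧-zeroʳ (cls C ≡ᵇ j) = refl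

        -- A chunk of a clique slot is compatible with whatever may lie next to a vertex of its
        -- class, so nothing can block it at the free vertex `p`.
        discarded-A : isR j ≡ false → ∑ discarded (Pack.weight j) ≡ 0
        discarded-A isA = ∑-zero discarded λ {C} m → none C m
          where
          none : ∀ C → C ∈ discarded → Pack.weight j C ≡ 0
          none C m with cls C ≡ᵇ j in c
          ... | false = refl
          ... | true with blocked m p free (sym (≡ᵇ-true c))
          ... | i , D , lt , eq , no-cmp , _ = true≢false
                (neighbour-compat {i} p (All.lookup L-valid (discarded-∈ m)) (al-valid eq) (≡ᵇ-true c) (al-cls eq)
                  (inj₁ (subst (λ z → isR z ≡ false) (sym (≡ᵇ-true c)) isA)))
                (trans (Cmp-sym i C D) no-cmp)

        discarded-R : isR j ≡ true → ∑ discarded (Pack.weight j) ≤ q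
        discarded-R isr = begin
          ∑ discarded (Pack.weight j) ≤⟨ ∑-mono∈ discarded pointwise ⟩
          ∑ discarded all-hits ≤⟨ ≤-trans (≤-reflexive (sym (+-identityʳ _))) (discarded-sub all-hits) ⟩
          ∑ L all-hits ≡⟨ ∑-swap L (range n) _ ⟩
          ∑ (range n) ω ≤⟨ mixed-sum n ω X (2 ^ e) (ω-bound isr) ⟩
          8 * X + n * 2 ^ e ≤⟨ waste≤q ⟩
          q ∎
          where
          open ≤-Reasoning
          all-hits : Chunk → ℕ
          all-hits C = ∑ (range n) λ i → ⟦ hit i C ⟧ * # (set C)
          pointwise : ∀ {C} → C ∈ discarded → Pack.weight j C ≤ all-hits C
          pointwise {C} m with cls C ≡ᵇ j in c
          ... | false = z≤n
          ... | true with blocked m p free (sym (≡ᵇ-true c))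
          ... | i , D , lt , eq , no-cmp , i< , D≤C = ≤-trans (≤-reflexive (+-identityʳ _)) (≤-trans (chunk-size (All.lookup L-valid (discarded-∈ m)))
                (≤-trans (≤-reflexive (trans (sym (+-identityʳ _)) (cong (λ z → ⟦ z ⟧ * # (set C)) (sym hits))))
                  (∑-∈ (λ i → ⟦ bad (al (flip i p)) i C ⟧ * # (set C)) (∈-range⁺ lt))))
            where
            hits : bad (al (flip i p)) i C ≡ true
            hits rewrite eq | no-cmp | ≤ᵇ-intro i< | ≤ᵇ-intro D≤C = refl

        occ : ℕ
        occ = ∑ (cube n) λ r → ⟦ Pack.occupied al j r ⟧

        pos : ℕ
        pos = ∑ (cube n) λ r → ⟦ cl r ≡ᵇ j ⟧

        occ<pos : suc occ ≤ pos
        occ<pos = ≤-trans (≤-reflexive (trans (+-comm 1 occ) (trans (cong (occ +_) (sym (cube-enum n p))) (sym (∑-+ (cube n) _ _)))))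
          (∑-mono (cube n) pointwise)
          where
          pointwise : ∀ r → ⟦ Pack.occupied al j r ⟧ + ⟦ does (p ≟q r) ⟧ ≤ ⟦ cl r ≡ᵇ j ⟧
          pointwise r with p ≟q r
          ... | yes refl rewrite free | ≡ᵇ-refl j = ≤-refl
          ... | no _ = ≤-trans (≤-reflexive (+-identityʳ _)) (⟦⟧-mono {Pack.occupied al j r} λ h → proj₂ (∧-true {is-just (al r)} h))

        E : ℕ
        E = suc (2 ^ e)

        chain : suc occ * E + 2 ^ e * (2 * q) ≤ (occ + ∑ discarded (Pack.weight j)) * E + 2 ^ e * (⟦ not (isR j) ⟧ * (2 * q))
        chain = ≤-trans (+-monoˡ-≤ _ (*-monoˡ-≤ E occ<pos)) (≤-trans (room (cl< p)) (≤-trans (capacity (cl< p))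
          (+-monoˡ-≤ _ (*-monoˡ-≤ E (total j)))))

        impossible : ⊥
        impossible with isR j in r
        ... | false = <⇒≱ (+-monoˡ-< (2 ^ e * (2 * q)) (m<n+m (occ * E) {E} (s≤s z≤n)))
              (subst₂ (λ x y → suc occ * E + 2 ^ e * (2 * q) ≤ x * E + 2 ^ e * y) (trans (cong (occ +_) (discarded-A r)) (+-identityʳ occ))
                (trans (cong (λ b → ⟦ not b ⟧ * (2 * q)) r) (+-identityʳ (2 * q))) chain)
        -- The discarded weight is at most `q`, and `q * E ≤ 2 ^ e * (2 * q)` is covered by the
        -- reserve in `room`.
        ... | true = <⇒≱ (m<n+m (occ * E + 2 ^ e * (2 * q)) {E} (s≤s z≤n)) (begin
              E + (occ * E + 2 ^ e * (2 * q)) ≡⟨ sym (+-assoc E (occ * E) _) ⟩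
              suc occ * E + 2 ^ e * (2 * q) ≤⟨ subst (λ y → suc occ * E + 2 ^ e * (2 * q) ≤ (occ + ∑ discarded (Pack.weight j)) * E + 2 ^ e * (⟦ not y ⟧ * (2 * q))) r chain ⟩
              (occ + ∑ discarded (Pack.weight j)) * E + 2 ^ e * 0 ≡⟨ trans (cong ((occ + ∑ discarded (Pack.weight j)) * E +_) (*-zeroʳ (2 ^ e))) (+-identityʳ _) ⟩
              (occ + ∑ discarded (Pack.weight j)) * E ≤⟨ *-monoˡ-≤ E (+-monoʳ-≤ occ (discarded-R r)) ⟩
              (occ + q) * E ≡⟨ *-distribʳ-+ E occ q ⟩
              occ * E + q * E ≤⟨ +-monoʳ-≤ (occ * E) (≤-trans (*-monoʳ-≤ q (≤-trans (+-monoˡ-≤ (2 ^ e) (m^n>0 2 e)) (≤-reflexive (cong (2 ^ e +_) (sym (+-identityʳ _))))))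
                (≤-reflexive (solve 2 (λ a b → a :* (con 2 :* b) := b :* (con 2 :* a)) refl q (2 ^ e)))) ⟩
              occ * E + 2 ^ e * (2 * q) ∎)
          where open ≤-Reasoning

      alloc : ∀ p → ∃[ C ] al p ≡ just C
      alloc p with al p in eq
      ... | just C = C , refl
      ... | nothing = ⊥-elim (Unallocated.impossible p eq)

      allocated : Vec Bool n → Chunk
      allocated p = proj₁ (alloc p)

      allocated-valid : ∀ p → Valid (allocated p)
      allocated-valid p = al-valid (proj₂ (alloc p))

      -- For a regular chunk each sum is at most 16·2^(n-a)/2^τ, a quarter of the surplus 2^(n-a-e).
      -- A single vertex has |C| = 1 < tᵢ, so both counts vanish.
      room-in-chunk : ∀ {C} → Valid C → ∀ κ₁ κ₂ → (∀ {i} → i < n → κ₁ i * t i ≤ # (set C)) → (∀ {i} → i < n → κ₂ i * t i ≤ # (set C)) →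
        2 ^ (n ∸ cod C) + (∑ (range n) κ₁ + ∑ (range n) κ₂) ≤ # (set C)
      room-in-chunk {C} v κ₁ κ₂ h₁ h₂ with kind v
      ... | inj₂ (sz , refl , _) rewrite sz | n∸n≡0 n = ≤-reflexive (cong suc (cong₂ _+_ (none κ₁ h₁) (none κ₂ h₂)))
        where
        none : ∀ κ → (∀ {i} → i < n → κ i * t i ≤ 1) → ∑ (range n) κ ≡ 0
        none κ h = ∑-zero (range n) λ m → zero′ (h (∈-range⁻ m))
          where
          zero′ : ∀ {k i} → k * t i ≤ 1 → k ≡ 0
          zero′ {zero} _ = refl
          zero′ {suc k} {i} le = contradiction (≤-trans (≤-trans (^-monoʳ-≤ 2 (≤-trans (m≤n+m 1 e) (≤-trans (+-monoʳ-≤ e (s≤s z≤n)) (m≤m+n τ (q4 i))))) (m≤m+n (t i) _)) le) λ { (s≤s ()) }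
      ... | inj₁ (sz , le , _) = subst (2 ^ (n ∸ cod C) + (∑ (range n) κ₁ + ∑ (range n) κ₂) ≤_) (sym sz) (+-monoʳ-≤ _ both)
        where
        a = cod C
        s = 2 ^ (n ∸ (a + e))
        half : ∀ κ → (∀ {i} → i < n → κ i * t i ≤ # (set C)) → 64 * ∑ (range n) κ ≤ 16 * s
        half κ h = *-cancelˡ-≤ (2 ^ e) {{m^n≢0 2 e}} (begin
          2 ^ e * (64 * ∑ (range n) κ) ≡⟨ trans (sym (*-assoc (2 ^ e) 64 _)) (cong (_* ∑ (range n) κ) (sym (^-distribˡ-+-* 2 e 6))) ⟩
          2 ^ τ * ∑ (range n) κ ≡⟨ sym (∑-*ˡ (range n) (2 ^ τ) κ) ⟩
          ∑ (range n) (λ i → 2 ^ τ * κ i) ≤⟨ geometric-sum n (λ i → 2 ^ τ * κ i) (2 * 2 ^ (n ∸ a)) (λ {i} lt → ≤-trans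
            (≤-reflexive (trans (solve 3 (λ x y z → x :* y :* z := y :* (x :* z)) refl (2 ^ τ) (κ i) (2 ^ q4 i)) (cong (κ i *_) (sym (^-distribˡ-+-* 2 τ (q4 i))))))
            (≤-trans (h lt) (≤-trans (≤-reflexive sz) (size≤ a)))) ⟩
          8 * (2 * 2 ^ (n ∸ a)) ≡⟨ cong (λ z → 8 * (2 * z)) (sym (2^e*2^ a le)) ⟩
          8 * (2 * (2 ^ e * s)) ≡⟨ solve 2 (λ x y → con 8 :* (con 2 :* (x :* y)) := x :* (con 16 :* y)) refl (2 ^ e) s ⟩
          2 ^ e * (16 * s) ∎)
          where open ≤-Reasoning
        both : ∑ (range n) κ₁ + ∑ (range n) κ₂ ≤ s
        both = *-cancelˡ-≤ 64 (begin
          64 * (∑ (range n) κ₁ + ∑ (range n) κ₂) ≡⟨ *-distribˡ-+ 64 (∑ (range n) κ₁) _ ⟩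
          64 * ∑ (range n) κ₁ + 64 * ∑ (range n) κ₂ ≤⟨ +-mono-≤ (half κ₁ h₁) (half κ₂ h₂) ⟩
          16 * s + 16 * s ≡⟨ solve 1 (λ x → con 16 :* x :+ con 16 :* x := con 32 :* x) refl s ⟩
          32 * s ≤⟨ *-monoˡ-≤ s (m≤m+n 32 32) ⟩
          64 * s ∎)
          where open ≤-Reasoning

      red-cube : FreeCube n
      red-cube = EmbedInChunks.embed n τ allocated
        (λ p r h → just-injective (trans (sym (proj₂ (alloc r))) (al-cell (proj₂ (alloc p)) h)))
        (λ p r h → al-disj (proj₂ (alloc p)) (proj₂ (alloc r)) h)
        (λ i p lt h → ≤ᵇ-true (al-cmp lt (proj₂ (alloc p)) (proj₂ (alloc (flip i p))) h))
        (λ p → independent (allocated-valid p))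
        (λ p → #>0 (allocated-valid p))
        (λ p → room-in-chunk (allocated-valid p))
        where
        independent : ∀ {C} → Valid C → Independent (set C)
        independent v with kind v
        ... | inj₁ (_ , _ , _ , sub) = neighbourhood-independent sub
        ... | inj₂ (_ , _ , _ , unique) = λ cx cy → ¬true λ a → case unique cx cy of λ { refl → triangle-free a a a }

  red-cube : Assignment → FreeCube n
  red-cube as = FromState.red-cube packed
    where open WithChunks (ChunkList.chunkSystem H sl) as

-- Filling slots with layers

-- Next fit: a layer that does not fit opens the next slot. Layers are at most `B` and capacities at
-- least `B`, so no slot is skipped and a closed slot wastes less than `B`.
module FillSlots (cap ℓ : ℕ → ℕ) (B S : ℕ) where

  state : ℕ → ℕ × ℕ
  state zero = 0 , ℓ 0
  state (suc w) with state w
  ... | s , u = if u + ℓ (suc w) ≤ᵇ cap s then (s , u + ℓ (suc w)) else (suc s , ℓ (suc w))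

  σ used : ℕ → ℕ
  σ w = proj₁ (state w)
  used w = proj₂ (state w)

  load : ℕ → ℕ → ℕ
  load m j = ∑ (range m) λ w → ⟦ σ w ≡ᵇ j ⟧ * ℓ w

  load-suc : ∀ m j → load (suc m) j ≡ load m j + ⟦ σ m ≡ᵇ j ⟧ * ℓ m
  load-suc m j = ∑-range-suc m λ w → ⟦ σ w ≡ᵇ j ⟧ * ℓ w

  ≡ᵇ-≢ : ∀ {m n} → m ≢ n → (m ≡ᵇ n) ≡ false
  ≡ᵇ-≢ ne = ¬true λ h → ne (≡ᵇ-true h)

  load-here : ∀ m {j} → σ m ≡ j → load (suc m) j ≡ load m j + ℓ m
  load-here m {j} refl = trans (load-suc m j) (cong (load m j +_) (trans (cong (λ b → ⟦ b ⟧ * ℓ m) (≡ᵇ-refl (σ m))) (+-identityʳ _)))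

  load-elsewhere : ∀ m {j} → σ m ≢ j → load (suc m) j ≡ load m j
  load-elsewhere m {j} ne = trans (load-suc m j) (trans (cong (λ b → load m j + ⟦ b ⟧ * ℓ m) (≡ᵇ-≢ ne)) (+-identityʳ _))

  load-mono : ∀ m {j} → load m j ≤ load (suc m) j
  load-mono m {j} = ≤-trans (m≤m+n _ _) (≤-reflexive (sym (load-suc m j)))

  data Move (w : ℕ) : Set where
    fits : σ (suc w) ≡ σ w → used (suc w) ≡ used w + ℓ (suc w) → used w + ℓ (suc w) ≤ cap (σ w) → Move w
    full : σ (suc w) ≡ suc (σ w) → used (suc w) ≡ ℓ (suc w) → cap (σ w) < used w + ℓ (suc w) → Move w

  move : ∀ w → Move w
  move w with proj₂ (state w) + ℓ (suc w) ≤ᵇ cap (proj₁ (state w)) in eq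
  ... | true = fits (cong (λ b → proj₁ (if b then (σ w , used w + ℓ (suc w)) else (suc (σ w) , ℓ (suc w)))) eq)
      (cong (λ b → proj₂ (if b then (σ w , used w + ℓ (suc w)) else (suc (σ w) , ℓ (suc w)))) eq) (≤ᵇ-true eq)
  ... | false = full (cong (λ b → proj₁ (if b then (σ w , used w + ℓ (suc w)) else (suc (σ w) , ℓ (suc w)))) eq)
      (cong (λ b → proj₂ (if b then (σ w , used w + ℓ (suc w)) else (suc (σ w) , ℓ (suc w)))) eq) (≤ᵇ-false eq)

  module _ (ℓ≤B : ∀ w → ℓ w ≤ B) (B≤cap : ∀ {j} → j < S → B ≤ cap j) where

    record Invariant (w : ℕ) : Set where
      field
        current : load (suc w) (σ w) ≡ used w
        later : ∀ {j} → σ w < j → load (suc w) j ≡ 0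
        nearly-full : ∀ {j} → j < σ w → cap j < load (suc w) j + B
        bounded : ∀ {j} → j ≤ σ w → j < S → load (suc w) j ≤ cap j

    invariant : ∀ w → Invariant w
    invariant zero = record
      { current = trans (+-identityʳ _) (+-identityʳ _)
      ; later = λ { {suc j} _ → refl }
      ; nearly-full = λ ()
      ; bounded = λ { z≤n lt → ≤-trans (≤-reflexive (trans (+-identityʳ _) (+-identityʳ _))) (≤-trans (ℓ≤B 0) (B≤cap lt)) } }
    invariant (suc w) with move w | invariant w
    ... | fits eσ eu fit | I = record
      { current = trans (load-here (suc w) refl) (trans (cong (_+ ℓ (suc w)) (trans (cong (load (suc w)) eσ) current)) (sym eu))
      ; later = λ {j} lt → trans (load-elsewhere (suc w) (<⇒≢ lt)) (later (subst (_< j) eσ lt))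
      ; nearly-full = λ {j} lt → <-≤-trans (nearly-full (subst (j <_) eσ lt)) (+-monoˡ-≤ B (load-mono (suc w)))
      ; bounded = λ {j} le lt → bound lt (m≤n⇒m<n∨m≡n (subst (j ≤_) eσ le)) }
      where
      open Invariant I
      bound : ∀ {j} → j < S → (j < σ w) ⊎ (j ≡ σ w) → load (suc (suc w)) j ≤ cap j
      bound lt (inj₁ j<) = ≤-trans (≤-reflexive (load-elsewhere (suc w) λ e → <⇒≢ j< (trans (sym e) eσ))) (bounded (<⇒≤ j<) lt)
      bound _ (inj₂ refl) = ≤-trans (≤-reflexive (trans (load-here (suc w) eσ) (cong (_+ ℓ (suc w)) current))) fit
    ... | full eσ eu over | I = record
      { current = trans (load-here (suc w) refl) (trans (cong (_+ ℓ (suc w)) (later (subst (σ w <_) (sym eσ) ≤-refl))) (sym eu))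
      ; later = λ {j} lt → trans (load-elsewhere (suc w) (<⇒≢ lt)) (later (<-trans (n<1+n (σ w)) (subst (_< j) eσ lt)))
      ; nearly-full = λ {j} lt → <-≤-trans (almost (m≤n⇒m<n∨m≡n (≤-pred (subst (j <_) eσ lt)))) (+-monoˡ-≤ B (load-mono (suc w)))
      ; bounded = λ {j} le lt → bound lt (m≤n⇒m<n∨m≡n (subst (j ≤_) eσ le)) }
      where
      open Invariant I
      almost : ∀ {j} → (j < σ w) ⊎ (j ≡ σ w) → cap j < load (suc w) j + B
      almost (inj₁ lt) = nearly-full lt
      almost (inj₂ refl) = <-≤-trans over (+-mono-≤ (≤-reflexive (sym current)) (ℓ≤B (suc w)))
      bound : ∀ {j} → j < S → (j < suc (σ w)) ⊎ (j ≡ suc (σ w)) → load (suc (suc w)) j ≤ cap j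
      bound lt (inj₁ j<) = ≤-trans (≤-reflexive (load-elsewhere (suc w) λ e → <⇒≢ j< (trans (sym e) eσ))) (bounded (≤-pred j<) lt)
      bound lt (inj₂ refl) = ≤-trans (≤-reflexive (trans (load-here (suc w) eσ) (cong (_+ ℓ (suc w)) (later (n<1+n (σ w))))))
        (≤-trans (ℓ≤B (suc w)) (B≤cap lt))

    σ-step : ∀ w → (σ (suc w) ≡ σ w) ⊎ (σ (suc w) ≡ suc (σ w))
    σ-step w with move w
    ... | fits e _ _ = inj₁ e
    ... | full e _ _ = inj₂ e

    load≤cap : ∀ w {j} → j < S → load (suc w) j ≤ cap j
    load≤cap w {j} lt with j ≤? σ w
    ... | yes le = Invariant.bounded (invariant w) le lt
    ... | no nle = ≤-trans (≤-reflexive (Invariant.later (invariant w) (≰⇒> nle))) z≤n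

    -- Reaching index `S` would mean that all `S` slots are filled up to less than `B` each, and
    -- then the layers would exceed their total.
    σ<S : ∀ M → 0 < S → ∑ (range (suc M)) ℓ + S * B ≤ ∑ (range S) cap → ∀ {w} → w ≤ M → σ w < S
    σ<S M S>0 enough {w} w≤M = ≰⇒> λ S≤ → <⇒≱ (overfull S≤) enough
      where
      open ≤-Reasoning
      range-prefix : ∀ m k (f : ℕ → ℕ) → ∑ (range m) f ≤ ∑ (range (k + m)) f
      range-prefix m zero f = ≤-refl
      range-prefix m (suc k) f = ≤-trans (range-prefix m k f) (≤-trans (m≤m+n _ _) (≤-reflexive (sym (∑-range-suc (k + m) f))))
      loads : ∑ (range S) (load (suc w)) ≤ ∑ (range (suc w)) ℓ
      loads = begin
        ∑ (range S) (load (suc w)) ≡⟨ ∑-swap (range S) (range (suc w)) _ ⟩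
        ∑ (range (suc w)) (λ v → ∑ (range S) (λ j → ⟦ σ v ≡ᵇ j ⟧ * ℓ v)) ≡⟨ ∑-cong (range (suc w)) (λ v → ∑-*ʳ (range S) _ (ℓ v)) ⟩
        ∑ (range (suc w)) (λ v → ∑ (range S) (λ j → ⟦ σ v ≡ᵇ j ⟧) * ℓ v) ≤⟨ ∑-mono (range (suc w)) (λ v → ≤-trans (*-monoˡ-≤ (ℓ v) (at-most-one v)) (≤-reflexive (+-identityʳ _))) ⟩
        ∑ (range (suc w)) ℓ ∎
        where
        at-most-one : ∀ v → ∑ (range S) (λ j → ⟦ σ v ≡ᵇ j ⟧) ≤ 1
        at-most-one v with σ v <? S
        ... | yes lt = ≤-reflexive (range-enum S (σ v) lt)
        ... | no nlt = ≤-trans (≤-reflexive (∑-zero (range S) λ {j} m → cong ⟦_⟧ (≡ᵇ-≢ {σ v} {j} λ { refl → nlt (∈-range⁻ m) }))) z≤n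
      overfull : S ≤ σ w → ∑ (range S) cap < ∑ (range (suc M)) ℓ + S * B
      overfull S≤ = begin-strict
        ∑ (range S) cap <⟨ m<m+n _ S>0 ⟩
        ∑ (range S) cap + S ≡⟨ cong (∑ (range S) cap +_) (sym (trans (∑-const (range S) 1) (trans (*-identityʳ _) (length-range S)))) ⟩
        ∑ (range S) cap + ∑ (range S) (λ _ → 1) ≡⟨ sym (∑-+ (range S) cap _) ⟩
        ∑ (range S) (λ j → cap j + 1) ≤⟨ ∑-mono∈ (range S) (λ {j} m → ≤-trans (≤-reflexive (+-comm (cap j) 1)) (Invariant.nearly-full (invariant w) (<-≤-trans (∈-range⁻ m) S≤))) ⟩
        ∑ (range S) (λ j → load (suc w) j + B) ≡⟨ trans (∑-+ (range S) (load (suc w)) _) (cong (∑ (range S) (load (suc w)) +_) (trans (∑-const (range S) B) (cong (_* B) (length-range S)))) ⟩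
        ∑ (range S) (load (suc w)) + S * B ≤⟨ +-monoˡ-≤ (S * B) (≤-trans loads (subst (λ m → ∑ (range (suc w)) ℓ ≤ ∑ (range m) ℓ) (trans (+-suc (M ∸ w) w) (cong suc (m∸n+n≡m w≤M))) (range-prefix (suc w) (M ∸ w) ℓ))) ⟩
        ∑ (range (suc M)) ℓ + S * B ∎

#-levels : ∀ n K (g : ℕ → ℕ) → K ≤ n → ∑ (cube n) (λ p → g (wt K p)) ≡ ∑ (range (suc K)) (λ w → g w * (bin K w * 2 ^ (n ∸ K)))
#-levels n K g K≤n = begin
  ∑ (cube n) (λ p → g (wt K p)) ≡⟨ ∑-cong (cube n) (λ p → sym (expand p)) ⟩
  ∑ (cube n) (λ p → ∑ (range (suc K)) (λ w → g w * ⟦ wt K p ≡ᵇ w ⟧)) ≡⟨ ∑-swap (cube n) (range (suc K)) _ ⟩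
  ∑ (range (suc K)) (λ w → ∑ (cube n) (λ p → g w * ⟦ wt K p ≡ᵇ w ⟧)) ≡⟨ ∑-cong (range (suc K)) (λ w → trans (∑-*ˡ (cube n) (g w) _) (cong (g w *_) (#-wt n K w K≤n))) ⟩
  ∑ (range (suc K)) (λ w → g w * (bin K w * 2 ^ (n ∸ K))) ∎
  where
  open ≡-Reasoning
  expand : ∀ p → ∑ (range (suc K)) (λ w → g w * ⟦ wt K p ≡ᵇ w ⟧) ≡ g (wt K p)
  expand p = trans (∑-cong (range (suc K)) eq) (trans (∑-*ˡ (range (suc K)) (g (wt K p)) _)
    (trans (cong (g (wt K p) *_) (range-enum (suc K) (wt K p) (s≤s (wt≤ K p)))) (*-identityʳ _)))
    where
    eq : ∀ w → g w * ⟦ wt K p ≡ᵇ w ⟧ ≡ g (wt K p) * ⟦ wt K p ≡ᵇ w ⟧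
    eq w with wt K p ≡ᵇ w in e
    ... | true = cong (λ z → g z * 1) (sym (≡ᵇ-true {wt K p} e))
    ... | false = trans (*-zeroʳ (g w)) (sym (*-zeroʳ (g (wt K p))))

nth : {A : Set} → A → List A → ℕ → A
nth x₀ [] _ = x₀
nth x₀ (x ∷ xs) zero = x
nth x₀ (x ∷ xs) (suc j) = nth x₀ xs j

∑-nth : {A : Set} (x₀ : A) (xs : List A) (f : A → ℕ) → ∑ (range (length xs)) (λ j → f (nth x₀ xs j)) ≡ ∑ xs f
∑-nth x₀ [] f = refl
∑-nth x₀ (x ∷ xs) f = cong (f x +_) (trans (∑-map suc (range (length xs)) _) (∑-nth x₀ xs f))

nth-∈ : {A : Set} (x₀ : A) (xs : List A) {j : ℕ} → j < length xs → nth x₀ xs j ∈ xs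
nth-∈ x₀ (x ∷ xs) {zero} _ = here refl
nth-∈ x₀ (x ∷ xs) {suc j} (s≤s lt) = there (nth-∈ x₀ xs lt)

chain-nth : {A : Set} {R : A → A → Set} (x₀ : A) {xs : List A} → Chain R xs → ∀ {j} → suc j < length xs →
  R (nth x₀ xs j) (nth x₀ xs (suc j))
chain-nth x₀ [-] (s≤s ())
chain-nth x₀ (r ∷ c) {zero} _ = r
chain-nth x₀ (r ∷ c) {suc j} (s≤s lt) = chain-nth x₀ c lt

module FromSlotList (H : Host) (π : Parameters) where
  open WithHost H
  open Parameters π

  record SlotList : Set where
    field
      ss : List Slot
      nonempty : 0 < length ss
      disjoint-ss : ∀ x → ∑ ss (λ s → ⟦ proj₁ s x ⟧) ≤ 1
      large : ∀ {s} → s ∈ ss → 4 * q ≤ # (proj₁ s)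
      clique-ss : ∀ {s} → s ∈ ss → proj₂ s ≡ false → ∃[ v ] proj₁ s ⊆ adj v
      rest-ss : ∀ {s} → s ∈ ss → proj₂ s ≡ true → ∀ v → deg v (proj₁ s) ≤ 2 ^ (n ∸ K)
      chain : Chain (Linked d) ss
      -- The factor 2 absorbs 1 + 2^e ≤ 2·2^e, as layers are measured together with the surplus of
      -- their chunks.
      thin-levels : ∀ w → bin K w * 2 ^ (n ∸ K) * 2 ≤ q
      -- Of the `3 * q` per slot, `2 * q` is the reserve in `room` and `q` is lost when next fit
      -- closes the slot.
      total-size : 2 ^ n * suc (2 ^ e) + 2 ^ e * (length ss * (3 * q)) ≤ 2 ^ e * ∑ ss (λ s → # (proj₁ s))

  module _ (sl : SlotList) where
    open SlotList sl

    no-slot : Slot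
    no-slot = (λ _ → false) , true

    slots : Slots π
    slots = record
      { S = length ss
      ; slot = nth no-slot ss
      ; disjoint-slots = λ x → ≤-trans (≤-reflexive (∑-nth no-slot ss (λ s → ⟦ proj₁ s x ⟧))) (disjoint-ss x)
      ; clique-slot = λ lt → clique-ss (nth-∈ no-slot ss lt)
      ; rest-slot = λ lt → rest-ss (nth-∈ no-slot ss lt)
      ; linked = chain-nth no-slot chain }

    open Slots slots using (S; W)

    cap ℓ : ℕ → ℕ
    cap j = 2 ^ e * (# (W j) ∸ 2 * q)
    ℓ w = bin K w * 2 ^ (n ∸ K) * suc (2 ^ e)

    B : ℕ
    B = 2 ^ e * q

    E≤ : suc (2 ^ e) ≤ 2 * 2 ^ e
    E≤ = ≤-trans (+-monoˡ-≤ (2 ^ e) (m^n>0 2 e)) (≤-reflexive (cong (2 ^ e +_) (sym (+-identityʳ (2 ^ e)))))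

    ℓ≤B : ∀ w → ℓ w ≤ B
    ℓ≤B w = begin
      bin K w * 2 ^ (n ∸ K) * suc (2 ^ e) ≤⟨ *-monoʳ-≤ (bin K w * 2 ^ (n ∸ K)) E≤ ⟩
      bin K w * 2 ^ (n ∸ K) * (2 * 2 ^ e) ≡⟨ solve 2 (λ x y → x :* (con 2 :* y) := y :* (x :* con 2)) refl (bin K w * 2 ^ (n ∸ K)) (2 ^ e) ⟩
      2 ^ e * (bin K w * 2 ^ (n ∸ K) * 2) ≤⟨ *-monoʳ-≤ (2 ^ e) (thin-levels w) ⟩
      2 ^ e * q ∎
      where open ≤-Reasoning

    4q≤ : ∀ {j} → j < S → 4 * q ≤ # (W j)
    4q≤ lt = large (nth-∈ no-slot ss lt)

    2q≤ : ∀ {j} → j < S → 2 * q ≤ # (W j)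
    2q≤ lt = ≤-trans (*-monoˡ-≤ q {2} {4} (s≤s (s≤s z≤n))) (4q≤ lt)

    B≤cap : ∀ {j} → j < S → B ≤ cap j
    B≤cap {j} lt = *-monoʳ-≤ (2 ^ e) (m+n≤o⇒m≤o∸n q (≤-trans (≤-trans (≤-reflexive (cong (_+ 2 * q) (sym (+-identityʳ q))))
      (≤-trans (≤-reflexive (sym (*-distribʳ-+ q 1 2))) (*-monoˡ-≤ q {3} {4} (s≤s (s≤s (s≤s z≤n)))))) (4q≤ lt)))

    K≤n : K ≤ n
    K≤n = ≤-trans (m≤m+n K e) (<⇒≤ K+e<n)

    enough : ∑ (range (suc K)) ℓ + S * B ≤ ∑ (range S) cap
    enough = +-cancelʳ-≤ (S * (2 ^ e * (2 * q))) _ _ (begin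
      (∑ (range (suc K)) ℓ + S * B) + S * (2 ^ e * (2 * q)) ≡⟨ cong (λ z → (z + S * B) + S * (2 ^ e * (2 * q))) sum-ℓ ⟩
      (2 ^ n * suc (2 ^ e) + S * (2 ^ e * q)) + S * (2 ^ e * (2 * q))
        ≡⟨ solve 4 (λ m s t q → (m :+ s :* (t :* q)) :+ s :* (t :* (con 2 :* q)) := m :+ t :* (s :* (con 3 :* q))) refl (2 ^ n * suc (2 ^ e)) S (2 ^ e) q ⟩
      2 ^ n * suc (2 ^ e) + 2 ^ e * (S * (3 * q)) ≤⟨ total-size ⟩
      2 ^ e * ∑ ss (λ s → # (proj₁ s)) ≡⟨ cong (2 ^ e *_) (sym (∑-nth no-slot ss (λ s → # (proj₁ s)))) ⟩
      2 ^ e * ∑ (range S) (λ j → # (W j)) ≡⟨ sym (∑-*ˡ (range S) (2 ^ e) _) ⟩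
      ∑ (range S) (λ j → 2 ^ e * # (W j)) ≤⟨ ∑-mono∈ (range S) (λ {j} m → ≤-reflexive (trans
        (cong (2 ^ e *_) (sym (m∸n+n≡m (2q≤ (∈-range⁻ m))))) (*-distribˡ-+ (2 ^ e) (# (W j) ∸ 2 * q) _))) ⟩
      ∑ (range S) (λ j → cap j + 2 ^ e * (2 * q)) ≡⟨ trans (∑-+ (range S) cap _) (cong (∑ (range S) cap +_)
        (trans (∑-const (range S) (2 ^ e * (2 * q))) (cong (_* (2 ^ e * (2 * q))) (length-range S)))) ⟩
      ∑ (range S) cap + S * (2 ^ e * (2 * q)) ∎)
      where
      open ≤-Reasoning
      sum-ℓ : ∑ (range (suc K)) ℓ ≡ 2 ^ n * suc (2 ^ e)
      sum-ℓ = trans (∑-*ʳ (range (suc K)) (λ w → bin K w * 2 ^ (n ∸ K)) (suc (2 ^ e))) (cong (_* suc (2 ^ e))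
        (trans (∑-cong (range (suc K)) λ w → sym (+-identityʳ _)) (trans (sym (#-levels n K (λ _ → 1) K≤n)) (∑-cube-1 n))))

    open FillSlots cap ℓ B S

    assignment : CubeFromSlots.Assignment H slots
    assignment = record
      { σ = σ
      ; σ< = σ<S ℓ≤B B≤cap K nonempty enough
      ; σ-step = λ {w} _ → σ-step ℓ≤B B≤cap w
      ; room = λ {j} lt → begin
          ∑ (cube n) (λ p → ⟦ σ (wt K p) ≡ᵇ j ⟧) * suc (2 ^ e) + 2 ^ e * (2 * q)
            ≡⟨ cong (λ z → z * suc (2 ^ e) + 2 ^ e * (2 * q)) (#-levels n K (λ w → ⟦ σ w ≡ᵇ j ⟧) K≤n) ⟩
          ∑ (range (suc K)) (λ w → ⟦ σ w ≡ᵇ j ⟧ * (bin K w * 2 ^ (n ∸ K))) * suc (2 ^ e) + 2 ^ e * (2 * q)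
            ≡⟨ cong (_+ 2 ^ e * (2 * q)) (trans (sym (∑-*ʳ (range (suc K)) (λ w → ⟦ σ w ≡ᵇ j ⟧ * (bin K w * 2 ^ (n ∸ K))) (suc (2 ^ e))))
              (∑-cong (range (suc K)) λ w → *-assoc ⟦ σ w ≡ᵇ j ⟧ (bin K w * 2 ^ (n ∸ K)) (suc (2 ^ e)))) ⟩
          load (suc K) j + 2 ^ e * (2 * q) ≤⟨ +-monoˡ-≤ _ (load≤cap ℓ≤B B≤cap K lt) ⟩
          2 ^ e * (# (W j) ∸ 2 * q) + 2 ^ e * (2 * q) ≡⟨ sym (*-distribˡ-+ (2 ^ e) (# (W j) ∸ 2 * q) _) ⟩
          2 ^ e * (# (W j) ∸ 2 * q + 2 * q) ≡⟨ cong (2 ^ e *_) (m∸n+n≡m (2q≤ lt)) ⟩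
          2 ^ e * # (W j) ∎ }
      where open ≤-Reasoning

    red-cube : FreeCube n
    red-cube = CubeFromSlots.red-cube H slots assignment

-- Paths of pieces

-- No three members are pairwise unrelated, unfolded along the list for the induction in
-- `pathCover`.
data Triples {A : Set} (R : A → A → Set) : List A → Set where
  [] : Triples R []
  _∷_ : ∀ {v xs} → (∀ {p r} → p ∈ xs → r ∈ xs → R v p ⊎ R v r ⊎ R p r) → Triples R xs → Triples R (v ∷ xs)

-- `∑-paths` replaces a permutation: taking for `f` the sizes, an indicator or the constant 1 bounds
-- total size, overlap and number of pieces.
record PathCover {A : Set} (R : A → A → Set) (xs : List A) : Set₁ where
  field
    path₁ path₂ : List A
    chain₁ : Chain R path₁
    chain₂ : Chain R path₂
    ∑-paths : ∀ (f : A → ℕ) → ∑ path₁ f + ∑ path₂ f ≡ ∑ xs f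
    ∈₁ : ∀ {z} → z ∈ path₁ → z ∈ xs
    ∈₂ : ∀ {z} → z ∈ path₂ → z ∈ xs

∑-ʳ++ : {A : Set} (xs ys : List A) (f : A → ℕ) → ∑ (xs ʳ++ ys) f ≡ ∑ xs f + ∑ ys f
∑-ʳ++ [] ys f = refl
∑-ʳ++ (x ∷ xs) ys f = trans (∑-ʳ++ xs (x ∷ ys) f)
  (solve 3 (λ a b c → b :+ (a :+ c) := (a :+ b) :+ c) refl (f x) (∑ xs f) (∑ ys f))

∈-ʳ++ : {A : Set} (xs : List A) {ys : List A} {z : A} → z ∈ xs ʳ++ ys → (z ∈ xs) ⊎ (z ∈ ys)
∈-ʳ++ [] m = inj₂ m
∈-ʳ++ (x ∷ xs) m with ∈-ʳ++ xs m
... | inj₁ i = inj₁ (there i)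
... | inj₂ (here e) = inj₁ (here e)
... | inj₂ (there i) = inj₂ i

chain-ʳ++ : {A : Set} {R : A → A → Set} → (∀ {x y} → R x y → R y x) → ∀ {x xs y ys} →
  Chain R (x ∷ xs) → R x y → Chain R (y ∷ ys) → Chain R ((x ∷ xs) ʳ++ (y ∷ ys))
chain-ʳ++ R-sym {xs = []} c r c′ = r ∷ c′
chain-ʳ++ R-sym {xs = x′ ∷ xs} (s ∷ c) r c′ = chain-ʳ++ R-sym c (R-sym s) (r ∷ c′)

-- A graph without three independent vertices is covered by two paths: a new vertex extends
-- one of them unless their first vertices are adjacent, in which case the two paths merge.
pathCover : {A : Set} {R : A → A → Set} → (∀ {x y} → R x y → R y x) → ∀ {xs} → Triples R xs → PathCover R xs
pathCover R-sym [] = record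
  { path₁ = [] ; path₂ = [] ; chain₁ = [] ; chain₂ = [] ; ∑-paths = λ f → refl ; ∈₁ = λ () ; ∈₂ = λ () }
pathCover {R = R} R-sym {v ∷ xs} (h ∷ hs) with pathCover R-sym hs
... | record { path₁ = [] ; path₂ = Q ; chain₂ = cQ ; ∑-paths = s ; ∈₂ = ∈Q } = record
  { path₁ = v ∷ [] ; path₂ = Q ; chain₁ = [-] ; chain₂ = cQ
  ; ∑-paths = λ f → trans (cong (_+ ∑ Q f) (+-identityʳ (f v))) (cong (f v +_) (s f))
  ; ∈₁ = λ { (here e) → here e } ; ∈₂ = there ∘ ∈Q }
... | record { path₁ = p ∷ P ; path₂ = [] ; chain₁ = cP ; ∑-paths = s ; ∈₁ = ∈P } = record
  { path₁ = p ∷ P ; path₂ = v ∷ [] ; chain₁ = cP ; chain₂ = [-]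
  ; ∑-paths = λ f → trans (cong (∑ (p ∷ P) f +_) (+-identityʳ (f v))) (trans (+-comm (∑ (p ∷ P) f) (f v)) (cong (f v +_) (trans (sym (+-identityʳ _)) (s f))))
  ; ∈₁ = there ∘ ∈P ; ∈₂ = λ { (here e) → here e } }
... | record { path₁ = p ∷ P ; path₂ = r ∷ Q ; chain₁ = cP ; chain₂ = cQ ; ∑-paths = s ; ∈₁ = ∈P ; ∈₂ = ∈Q }
  with h (∈P (here refl)) (∈Q (here refl))
... | inj₁ vp = record
  { path₁ = v ∷ p ∷ P ; path₂ = r ∷ Q ; chain₁ = vp ∷ cP ; chain₂ = cQ
  ; ∑-paths = λ f → trans (+-assoc (f v) (∑ (p ∷ P) f) _) (cong (f v +_) (s f))
  ; ∈₁ = λ { (here e) → here e ; (there m) → there (∈P m) } ; ∈₂ = there ∘ ∈Q }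
... | inj₂ (inj₁ vr) = record
  { path₁ = p ∷ P ; path₂ = v ∷ r ∷ Q ; chain₁ = cP ; chain₂ = vr ∷ cQ
  ; ∑-paths = λ f → trans (solve 3 (λ a b c → b :+ (a :+ c) := a :+ (b :+ c)) refl (f v) (∑ (p ∷ P) f) (∑ (r ∷ Q) f)) (cong (f v +_) (s f))
  ; ∈₁ = there ∘ ∈P ; ∈₂ = λ { (here e) → here e ; (there m) → there (∈Q m) } }
... | inj₂ (inj₂ pr) = record
  { path₁ = (p ∷ P) ʳ++ (r ∷ Q) ; path₂ = v ∷ [] ; chain₁ = chain-ʳ++ R-sym cP pr cQ ; chain₂ = [-]
  ; ∑-paths = λ f → trans (cong₂ _+_ (∑-ʳ++ (p ∷ P) (r ∷ Q) f) (+-identityʳ (f v))) (trans (+-comm _ (f v)) (cong (f v +_) (s f)))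
  ; ∈₁ = λ m → case ∈-ʳ++ (p ∷ P) m of λ { (inj₁ i) → there (∈P i) ; (inj₂ i) → there (∈Q i) }
  ; ∈₂ = λ { (here e) → here e } }

module Paths (H : Host) (c d : ℕ) where
  open WithHost H

  -- The parts have `2 * c` vertices because the exit set, of size `c`, must avoid an entry set of
  -- size `c` chosen earlier in the same piece. By symmetry either part can be the exit.
  Link : Slot → Slot → Set
  Link (P , r) (P′ , r′) = ∃[ X ] ∃[ Y ] (X ⊆ P) × (Y ⊆ P′) × (2 * c ≤ # X) × (2 * c ≤ # Y) ×
    ((Sparse d X Y × r′ ≡ false) ⊎ (Sparse d Y X × r ≡ false))

  Link-sym : ∀ {s s′} → Link s s′ → Link s′ s
  Link-sym (X , Y , sx , sy , lx , ly , inj₁ h) = Y , X , sy , sx , ly , lx , inj₂ h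
  Link-sym (X , Y , sx , sy , lx , ly , inj₂ h) = Y , X , sy , sx , ly , lx , inj₁ h

  record Node (s : Slot) : Set where
    field
      node-size : 3 * c ≤ # (proj₁ s)
      node-clique : proj₂ s ≡ false → ∃[ v ] proj₁ s ⊆ adj v
  open Node

  -- Every piece of the path becomes three slots. The entry set `I` of the first piece is a
  -- parameter, as the preceding link dictates it.
  record Expansion (I : V → Bool) (s : Slot) (rest : List Slot) : Set where
    field
      tail : List Slot
    ss : List Slot
    ss = (I , proj₂ s) ∷ tail
    field
      sums : ∀ x → ∑ ss (λ s → ⟦ proj₁ s x ⟧) ≡ ∑ (s ∷ rest) (λ s → ⟦ proj₁ s x ⟧)
      sizes : ∀ {u} → u ∈ ss → c ≤ # (proj₁ u)
      origin : ∀ {u} → u ∈ ss → ∃[ z ] (z ∈ s ∷ rest) × (proj₁ u ⊆ proj₁ z) × (proj₂ u ≡ proj₂ z)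
      chain : Chain (Linked d) ss
      count : length ss ≡ 3 * suc (length rest)

  same-node : ∀ {P r A B} → Node (P , r) → A ⊆ P → B ⊆ P → Linked d (A , r) (B , r)
  same-node {r = true} _ _ _ = inj₁ (refl , refl)
  same-node {P} {false} {A} {B} nd subA subB = inj₂ (inj₁ ((λ x ax → ≤-trans (deg-mono x subB)
    (≤-trans (≤-reflexive (deg-independent (neighbourhood-independent (proj₂ (node-clique nd refl))) (subA x ax))) z≤n)) , refl))

  ∖-⊆ : ∀ {P R : V → Bool} → P ∖ R ⊆ P
  ∖-⊆ x h = proj₁ (∧-true h)

  -- The entry set I, the exit set O and the bulk between them.
  module Split {P : V → Bool} {r : Bool} {I O : V → Bool} (nd : Node (P , r))
    (I⊆ : I ⊆ P) (#I : # I ≡ c) (O⊆ : O ⊆ P ∖ I) (#O : # O ≡ c) where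

    bulk : V → Bool
    bulk = (P ∖ I) ∖ O

    bulk-size : c ≤ # bulk
    bulk-size = +-cancelʳ-≤ (c + c) c (# bulk) (begin
      c + (c + c) ≡⟨ solve 1 (λ x → x :+ (x :+ x) := con 3 :* x) refl c ⟩
      3 * c ≤⟨ node-size nd ⟩
      # P ≡⟨ #-∖ P I I⊆ ⟩
      # (P ∖ I) + # I ≡⟨ cong₂ _+_ (#-∖ (P ∖ I) O O⊆) #I ⟩
      (# bulk + # O) + c ≡⟨ trans (cong (λ z → (# bulk + z) + c) #O) (+-assoc (# bulk) c c) ⟩
      # bulk + (c + c) ∎)
      where open ≤-Reasoning

    split : ∀ x → ⟦ P x ⟧ ≡ ⟦ I x ⟧ + (⟦ bulk x ⟧ + ⟦ O x ⟧)
    split x = trans (∖-split P I I⊆ x) (trans (+-comm _ ⟦ I x ⟧) (cong (⟦ I x ⟧ +_) (∖-split (P ∖ I) O O⊆ x)))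

    O⊆P : O ⊆ P
    O⊆P x h = ∖-⊆ {P} {I} x (O⊆ x h)

    bulk⊆P : bulk ⊆ P
    bulk⊆P x h = ∖-⊆ {P} {I} x (∖-⊆ {P ∖ I} {O} x h)

    I-bulk : Linked d (I , r) (bulk , r)
    I-bulk = same-node nd I⊆ bulk⊆P

    bulk-O : Linked d (bulk , r) (O , r)
    bulk-O = same-node nd bulk⊆P O⊆P

  leave-room : ∀ {X I : V → Bool} → 2 * c ≤ # X → # I ≡ c → c ≤ # (X ∖ I)
  leave-room {X} {I} le eq = +-cancelʳ-≤ c c (# (X ∖ I)) (≤-trans (≤-reflexive (cong (c +_) (sym (+-identityʳ c))))
    (≤-trans le (≤-trans (≤-reflexive (#-∩ X I)) (+-monoʳ-≤ (# (X ∖ I))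
      (≤-trans (#-mono {X ∩ I} {I} λ x h → proj₂ (∧-true {X x} h)) (≤-reflexive eq))))))

  -- The bulks of consecutive pieces may be dense to each other; only the exit set, chosen in `X`,
  -- faces the next entry set, chosen in `Y`.
  expand : ∀ {I P r} rest → I ⊆ P → # I ≡ c → Node (P , r) → (∀ {u} → u ∈ rest → Node u) → Chain Link ((P , r) ∷ rest) →
    Expansion I (P , r) rest
  expand {I} {P} {r} [] I⊆ #I nd _ [-] = record
    { tail = (bulk , r) ∷ (O , r) ∷ []
    ; sums = λ x → trans (cong (⟦ I x ⟧ +_) (cong (⟦ bulk x ⟧ +_) (+-identityʳ _))) (trans (sym (split x)) (sym (+-identityʳ _)))
    ; sizes = λ { (here refl) → ≤-reflexive (sym #I) ; (there (here refl)) → bulk-size ; (there (there (here refl))) → ≤-reflexive (sym #O) }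
    ; origin = λ { (here refl) → _ , here refl , I⊆ , refl ; (there (here refl)) → _ , here refl , bulk⊆P , refl
                 ; (there (there (here refl))) → _ , here refl , O⊆P , refl }
    ; chain = I-bulk ∷ bulk-O ∷ [-]
    ; count = refl }
    where
    picked = pick (P ∖ I) c (leave-room {P} {I} (≤-trans (*-monoˡ-≤ c {2} {3} (s≤s (s≤s z≤n))) (node-size nd)) #I)
    O : V → Bool
    O = proj₁ picked
    #O : # O ≡ c
    #O = proj₂ (proj₂ picked)
    open Split nd I⊆ #I (proj₁ (proj₂ picked)) #O
  expand {I} {P} {r} ((P′ , r′) ∷ rest) I⊆ #I nd nds ((X , Y , X⊆ , Y⊆ , 2c≤X , 2c≤Y , sparse) ∷ ch) = record
    { tail = (bulk , r) ∷ (O , r) ∷ E.ss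
    ; sums = λ x → trans (cong (λ z → ⟦ I x ⟧ + (⟦ bulk x ⟧ + (⟦ O x ⟧ + z))) (E.sums x))
        (trans (solve 4 (λ a b c d → a :+ (b :+ (c :+ d)) := (a :+ (b :+ c)) :+ d) refl ⟦ I x ⟧ ⟦ bulk x ⟧ ⟦ O x ⟧ _)
          (cong (_+ ∑ ((P′ , r′) ∷ rest) (λ s → ⟦ proj₁ s x ⟧)) (sym (split x))))
    ; sizes = λ { (here refl) → ≤-reflexive (sym #I) ; (there (here refl)) → bulk-size
                ; (there (there (here refl))) → ≤-reflexive (sym #O) ; (there (there (there m))) → E.sizes m }
    ; origin = λ { (here refl) → _ , here refl , I⊆ , refl ; (there (here refl)) → _ , here refl , bulk⊆P , refl
                 ; (there (there (here refl))) → _ , here refl , O⊆P , refl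
                 ; (there (there (there m))) → case E.origin m of λ { (z , i , s , e) → z , there i , s , e } }
    ; chain = I-bulk ∷ bulk-O ∷ cross sparse ∷ E.chain
    ; count = trans (cong (3 +_) E.count) (sym (*-suc 3 (suc (length rest)))) }
    where
    picked = pick (X ∖ I) c (leave-room {X} {I} 2c≤X #I)
    O : V → Bool
    O = proj₁ picked
    O⊆X : O ⊆ X
    O⊆X x h = ∖-⊆ {X} {I} x (proj₁ (proj₂ picked) x h)
    O⊆ : O ⊆ P ∖ I
    O⊆ x h with ∧-true {X x} (proj₁ (proj₂ picked) x h)
    ... | a , b = cong₂ _∧_ (X⊆ x a) b
    #O : # O ≡ c
    #O = proj₂ (proj₂ picked)
    open Split nd I⊆ #I O⊆ #O
    picked′ = pick Y c (≤-trans (m≤m+n c _) 2c≤Y)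
    I′ : V → Bool
    I′ = proj₁ picked′
    module E = Expansion (expand rest (λ x h → Y⊆ x (proj₁ (proj₂ picked′) x h)) (proj₂ (proj₂ picked′)) (nds (here refl)) (nds ∘ there) ch)
    cross : ((Sparse d X Y × r′ ≡ false) ⊎ (Sparse d Y X × r ≡ false)) → Linked d (O , r) (I′ , r′)
    cross (inj₁ (sp , e)) = inj₂ (inj₁ ((λ x ox → ≤-trans (deg-mono x (proj₁ (proj₂ picked′))) (sp x (O⊆X x ox))) , e))
    cross (inj₂ (sp , e)) = inj₂ (inj₂ ((λ x ix → ≤-trans (deg-mono x O⊆X) (sp x (proj₁ (proj₂ picked′) x ix))) , e))

  -- The useless degrees: too large for a sparse link and too small for a vertex with two large
  -- neighbourhoods.
  mid : ℕ → V → (V → Bool) → Bool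
  mid hi x B = (suc d ≤ᵇ deg x B) ∧ (deg x B ≤ᵇ hi)

  weak : ℕ → (V → Bool) → (V → Bool) → V → Bool
  weak hi B₁ B x = B₁ x ∧ (deg x B ≤ᵇ hi)

  -- At least half of `B₁` has degree at most `hi` into `B`; dropping the at most `μ` vertices with
  -- a useless degree leaves `2 * c` of degree at most `d`.
  sparse-link : ∀ {hi μ B₁ r₁ B} → 4 * c + 2 * μ ≤ # B₁ → 2 * c ≤ # B →
    # (λ x → B₁ x ∧ mid hi x B) ≤ μ → # B₁ ≤ 2 * # (weak hi B₁ B) → Link (B₁ , r₁) (B , false)
  sparse-link {hi} {μ} {B₁} {r₁} {B} big bigB few le =
    weak d B₁ B , B , (λ x h → proj₁ (∧-true h)) , (λ _ h → h) , large , bigB ,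
    inj₁ ((λ x h → ≤ᵇ-true (proj₂ (∧-true {B₁ x} h))) , refl)
    where
    open ≤-Reasoning
    pointwise : ∀ x → ⟦ weak hi B₁ B x ⟧ ≤ ⟦ weak d B₁ B x ⟧ + ⟦ B₁ x ∧ mid hi x B ⟧
    pointwise x with B₁ x
    ... | false = z≤n
    ... | true with deg x B ≤? d
    ... | yes le′ rewrite ≤ᵇ-intro le′ = ≤-trans (⟦⟧≤1 _) (m≤m+n 1 _)
    ... | no nle rewrite ≤ᵇ-intro (≰⇒> nle) = m≤n+m _ ⟦ deg x B ≤ᵇ d ⟧
    large : 2 * c ≤ # (weak d B₁ B)
    large = *-cancelˡ-≤ 2 (+-cancelʳ-≤ (2 * μ) (2 * (2 * c)) (2 * # (weak d B₁ B)) (begin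
      2 * (2 * c) + 2 * μ ≡⟨ cong (_+ 2 * μ) (sym (*-assoc 2 2 c)) ⟩
      4 * c + 2 * μ ≤⟨ big ⟩
      # B₁ ≤⟨ le ⟩
      2 * # (weak hi B₁ B) ≤⟨ *-monoʳ-≤ 2 (≤-trans (∑-mono vs pointwise) (≤-reflexive (∑-+ vs _ _))) ⟩
      2 * (# (weak d B₁ B) + # (λ x → B₁ x ∧ mid hi x B)) ≤⟨ *-monoʳ-≤ 2 (+-monoʳ-≤ (# (weak d B₁ B)) few) ⟩
      2 * (# (weak d B₁ B) + μ) ≡⟨ *-distribˡ-+ 2 (# (weak d B₁ B)) μ ⟩
      2 * # (weak d B₁ B) + 2 * μ ∎))

  -- Either many vertices of B₁ see little of B₂ (or of B₃), or some x ∈ B₁ has large neighbourhoods in both,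
  -- between which there is no edge as the graph is triangle-free.
  triple : ∀ {hi μ B₁ r₁ B₂ B₃} → 2 * c ≤ hi → 4 * c + 2 * μ ≤ # B₁ → 2 * c ≤ # B₂ → 2 * c ≤ # B₃ →
    # (λ x → B₁ x ∧ mid hi x B₂) ≤ μ → # (λ x → B₁ x ∧ mid hi x B₃) ≤ μ →
    Link (B₁ , r₁) (B₂ , false) ⊎ Link (B₁ , r₁) (B₃ , false) ⊎ Link (B₂ , false) (B₃ , false)
  triple {hi} {μ} {B₁} {r₁} {B₂} {B₃} 2c≤hi big big₂ big₃ few₂ few₃
    with # B₁ ≤? 2 * # (weak hi B₁ B₂) | # B₁ ≤? 2 * # (weak hi B₁ B₃)
  ... | yes le | _ = inj₁ (sparse-link big big₂ few₂ le)
  ... | no _ | yes le = inj₂ (inj₁ (sparse-link big big₃ few₃ le))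
  ... | no nle₂ | no nle₃ with ∑-< vs {λ x → ⟦ weak hi B₁ B₂ x ⟧ + ⟦ weak hi B₁ B₃ x ⟧} {λ x → ⟦ B₁ x ⟧} few
    where
    few : ∑ vs (λ x → ⟦ weak hi B₁ B₂ x ⟧ + ⟦ weak hi B₁ B₃ x ⟧) < # B₁
    few = *-cancelˡ-< 2 _ _ (subst₂ _<_ (trans (sym (*-distribˡ-+ 2 (# (weak hi B₁ B₂)) _)) (cong (2 *_) (sym (∑-+ vs _ _))))
      (cong (# B₁ +_) (sym (+-identityʳ (# B₁)))) (+-mono-< (≰⇒> nle₂) (≰⇒> nle₃)))
  ... | x , _ , lt = inj₂ (inj₂ (adj x ∩ B₂ , adj x ∩ B₃ ,
      (λ y h → proj₂ (∧-true {adj x y} h)) , (λ y h → proj₂ (∧-true {adj x y} h)) ,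
      large (m+n≡0⇒m≡0 _ (proj₂ (<⟦⟧ lt))) , large (m+n≡0⇒n≡0 ⟦ weak hi B₁ B₂ x ⟧ (proj₂ (<⟦⟧ lt))) ,
      inj₁ ((λ y yP → ≤-trans (≤-reflexive (∑-zero vs λ {z} _ → none y z (proj₁ (∧-true yP)))) z≤n) , refl)))
    where
    strong : ∀ b m → b ≡ true → ⟦ b ∧ (m ≤ᵇ hi) ⟧ ≡ 0 → hi < m
    strong true m _ e = ≤ᵇ-false (zero-false e)
      where
      zero-false : ∀ {b} → ⟦ b ⟧ ≡ 0 → b ≡ false
      zero-false {false} _ = refl
    large : ∀ {B} → ⟦ weak hi B₁ B x ⟧ ≡ 0 → 2 * c ≤ # (adj x ∩ B)
    large {B} e = ≤-trans 2c≤hi (≤-trans (<⇒≤ (strong (B₁ x) (deg x B) (proj₁ (<⟦⟧ lt)) e)) (≤-reflexive (deg-∩ x B)))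
    none : ∀ y z → adj x y ≡ true → ⟦ (adj x ∩ B₃) z ⟧ * ⟦ adj y z ⟧ ≡ 0
    none y z xy with adj x z in xz | B₃ z | adj y z in yz
    ... | false | _ | _ = refl
    ... | true | false | _ = refl
    ... | true | true | false = refl
    ... | true | true | true = ⊥-elim (triangle-free xy xz yz)

module FromNodes (H : Host) (π : Parameters) where
  open WithHost H
  open Parameters π
  open Paths H (4 * q) d
  open FromSlotList H π

  record NodeList : Set where
    field
      nodes : List Slot
      node : ∀ {u} → u ∈ nodes → Node u
      rest-node : ∀ {u} → u ∈ nodes → proj₂ u ≡ true → ∀ v → deg v (proj₁ u) ≤ 2 ^ (n ∸ K)
      disjoint-nodes : ∀ x → ∑ nodes (λ u → ⟦ proj₁ u x ⟧) ≤ 1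
      triples : Triples Link nodes
      thin : ∀ w → bin K w * 2 ^ (n ∸ K) * 2 ≤ q
      -- The factor 2 allows for keeping only the longer of two paths; each piece gives three slots,
      -- each costing `3 * q`.
      ample : 2 * (2 ^ n * suc (2 ^ e) + 2 ^ e * ((3 * length nodes) * (3 * q))) ≤ 2 ^ e * ∑ nodes (λ u → # (proj₁ u))

  module _ (nl : NodeList) where
    open NodeList nl

    total : List Slot → ℕ
    total us = ∑ us λ u → # (proj₁ u)

    total-pointwise : ∀ us → total us ≡ ∑ vs (λ x → ∑ us (λ u → ⟦ proj₁ u x ⟧))
    total-pointwise us = ∑-swap us vs _

    need : ℕ
    need = 2 ^ n * suc (2 ^ e) + 2 ^ e * ((3 * length nodes) * (3 * q))

    length-∑ : ∀ {A : Set} (us : List A) → ∑ us (λ _ → 1) ≡ length us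
    length-∑ us = trans (∑-const us 1) (*-identityʳ _)

    along : ∀ path → Chain Link path → (∀ {u} → u ∈ path → u ∈ nodes) → (∀ f → ∑ path f ≤ ∑ nodes f) →
      need ≤ 2 ^ e * total path → FreeCube n
    along [] _ _ _ big = contradiction (≤-trans big (≤-reflexive (*-zeroʳ (2 ^ e)))) (<⇒≱
      (≤-trans (*-mono-≤ (m^n>0 2 n) (s≤s z≤n)) (m≤m+n (2 ^ n * suc (2 ^ e)) _)))
    along ((P , r) ∷ rest) ch ⊆nodes ≤nodes big = red-cube (record
      { ss = E.ss
      ; nonempty = s≤s z≤n
      ; disjoint-ss = λ x → ≤-trans (≤-reflexive (E.sums x)) (≤-trans (≤nodes (λ u → ⟦ proj₁ u x ⟧)) (disjoint-nodes x))
      ; large = E.sizes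
      ; clique-ss = λ m r≡ → case E.origin m of λ { (z , z∈ , sub , e) →
          case Node.node-clique (node (⊆nodes z∈)) (trans (sym e) r≡) of λ { (v , sub′) → v , λ x h → sub′ x (sub x h) } }
      ; rest-ss = λ m r≡ v → case E.origin m of λ { (z , z∈ , sub , e) →
          ≤-trans (deg-mono v sub) (rest-node (⊆nodes z∈) (trans (sym e) r≡) v) }
      ; chain = E.chain
      ; thin-levels = thin
      ; total-size = ≤-trans (+-monoʳ-≤ (2 ^ n * suc (2 ^ e)) (*-monoʳ-≤ (2 ^ e) (*-monoˡ-≤ (3 * q)
          (≤-trans (≤-reflexive E.count) (*-monoʳ-≤ 3 short)))))
          (≤-trans big (*-monoʳ-≤ (2 ^ e) (≤-reflexive (trans (total-pointwise ((P , r) ∷ rest))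
            (trans (∑-cong vs λ x → sym (E.sums x)) (sym (total-pointwise E.ss))))))) })
      where
      short : suc (length rest) ≤ length nodes
      short = subst₂ _≤_ (length-∑ ((P , r) ∷ rest)) (length-∑ nodes) (≤nodes λ _ → 1)
      nd : Node (P , r)
      nd = node (⊆nodes (here refl))
      picked = pick P (4 * q) (≤-trans (m≤n*m (4 * q) 3) (Node.node-size nd))
      module E = Expansion (expand rest (proj₁ (proj₂ picked)) (proj₂ (proj₂ picked)) nd (node ∘ ⊆nodes ∘ there) ch)

    red-cube-from-nodes : FreeCube n
    red-cube-from-nodes with pathCover Link-sym triples
    ... | record { path₁ = P₁ ; path₂ = P₂ ; chain₁ = c₁ ; chain₂ = c₂ ; ∑-paths = s ; ∈₁ = i₁ ; ∈₂ = i₂ } with need ≤? 2 ^ e * total P₁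
    ... | yes big = along P₁ c₁ i₁ (λ f → ≤-trans (m≤m+n _ _) (≤-reflexive (s f))) big
    ... | no small = along P₂ c₂ i₂ (λ f → ≤-trans (m≤n+m _ (∑ P₁ f)) (≤-reflexive (s f)))
      (+-cancelˡ-≤ (2 ^ e * total P₁) _ _ (≤-trans (+-monoˡ-≤ need (<⇒≤ (≰⇒> small)))
        (≤-trans (≤-reflexive (cong (need +_) (sym (+-identityʳ need)))) (≤-trans ample
          (≤-reflexive (trans (cong (2 ^ e *_) (sym (s (λ u → # (proj₁ u))))) (*-distribˡ-+ (2 ^ e) (total P₁) _)))))))

-- Scales

2*y≤2^y : ∀ y → 2 * y ≤ 2 ^ y
2*y≤2^y zero = z≤n
2*y≤2^y (suc zero) = ≤-refl
2*y≤2^y (suc (suc y)) = begin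
  2 * suc (suc y) ≡⟨ solve 1 (λ y → con 2 :* (con 2 :+ y) := con 2 :+ con 2 :* (con 1 :+ y)) refl y ⟩
  2 + 2 * suc y ≤⟨ +-mono-≤ (*-monoʳ-≤ 2 (m^n>0 2 y)) (2*y≤2^y (suc y)) ⟩
  2 ^ suc y + 2 ^ suc y ≡⟨ cong (2 ^ suc y +_) (sym (+-identityʳ _)) ⟩
  2 ^ suc (suc y) ∎
  where open ≤-Reasoning

n≤2^[n∸x] : ∀ n x → 2 * x ≤ n → n ≤ 2 ^ (n ∸ x)
n≤2^[n∸x] n x le = ≤-trans (+-cancelʳ-≤ x n (2 * (n ∸ x)) (begin
  n + x ≡⟨ cong (_+ x) (sym (m∸n+n≡m x≤n)) ⟩
  (n ∸ x) + x + x ≡⟨ solve 2 (λ a b → (a :+ b) :+ b := a :+ con 2 :* b) refl (n ∸ x) x ⟩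
  (n ∸ x) + 2 * x ≤⟨ +-monoʳ-≤ (n ∸ x) (≤-trans le (≤-reflexive (sym (m∸n+n≡m x≤n)))) ⟩
  (n ∸ x) + ((n ∸ x) + x) ≡⟨ solve 2 (λ a b → a :+ (a :+ b) := con 2 :* a :+ b) refl (n ∸ x) x ⟩
  2 * (n ∸ x) + x ∎)) (2*y≤2^y (n ∸ x))
  where
  open ≤-Reasoning
  x≤n : x ≤ n
  x≤n = ≤-trans (m≤n*m x 2) le

n≤4^n : ∀ n → n ≤ 4 ^ n
n≤4^n zero = z≤n
n≤4^n (suc n) = ≤-trans (+-mono-≤ (m^n>0 4 n) (n≤4^n n)) (≤-trans (≤-reflexive (cong (4 ^ n +_) (sym (+-identityʳ (4 ^ n)))))
  (*-monoˡ-≤ (4 ^ n) {2} {4} (s≤s (s≤s z≤n))))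

2^-cancel : ∀ {n} a → a ≤ n → 2 ^ a * 2 ^ (n ∸ a) ≡ 2 ^ n
2^-cancel {n} a le = trans (sym (^-distribˡ-+-* 2 a (n ∸ a))) (cong (2 ^_) (m+[n∸m]≡n le))

2^*2^∸ : ∀ {n} c a b → c + a ≤ b → b ≤ n → 2 ^ c * 2 ^ (n ∸ b) ≤ 2 ^ (n ∸ a)
2^*2^∸ {n} c a b le b≤n = ≤-trans (≤-reflexive (sym (^-distribˡ-+-* 2 c (n ∸ b)))) (^-monoʳ-≤ 2 {c + (n ∸ b)} {n ∸ a}
  (m+n≤o⇒m≤o∸n (c + (n ∸ b)) (≤-trans (≤-reflexive (solve 3 (λ c m a → (c :+ m) :+ a := m :+ (c :+ a)) refl c (n ∸ b) a))
    (≤-trans (+-monoʳ-≤ (n ∸ b) le) (≤-reflexive (m∸n+n≡m b≤n))))))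

module Constants (r : ℕ) where
  e τ : ℕ
  e = r
  τ = e + 6

  -- The layers of the K f-dimensional cube are thin against 2^(n ∸ f), and degrees 2^(n ∸ φ f) are negligible
  -- against its cells. The fs b t are candidate scales below b, enough of them for a pigeonhole over pairs of a
  -- vertex and a clique of size 2^(n ∸ b); the bs u are scales for the sizes of the cliques.
  g K′ K φ : ℕ → ℕ
  g f = f + 2 * τ + 10
  K′ f = 2 * 4 ^ g f
  K f = 4 * K′ f
  φ f = 2 * (τ + K′ f) + K f

  g≤K′ : ∀ f → g f ≤ K′ f
  g≤K′ f = ≤-trans (n≤4^n (g f)) (m≤n*m _ 2)

  f≤g : ∀ f → f + 10 ≤ g f
  f≤g f = +-monoˡ-≤ 10 (m≤m+n f (2 * τ))

  K≤φ : ∀ f → K f ≤ φ f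
  K≤φ f = m≤n+m (K f) (2 * (τ + K′ f))

  f≤K : ∀ f → f + 10 ≤ K f
  f≤K f = ≤-trans (f≤g f) (≤-trans (g≤K′ f) (m≤n*m (K′ f) 4))

  f≤φ : ∀ f → f ≤ φ f
  f≤φ f = ≤-trans (≤-trans (m≤m+n f 10) (f≤K f)) (K≤φ f)

  fs : ℕ → ℕ → ℕ
  -- At most 2^(b+3) pieces lose a multiple of 2^(n-f-4) each; `b + r ≤ f` keeps the total of order
  -- 2^(n-r).
  fs b zero = b + r + 3
  fs b (suc t) = φ (fs b t)

  T : ℕ → ℕ
  T b = 2 ^ (2 * b + 6)

  bs : ℕ → ℕ
  bs zero = r
  bs (suc u) = fs (bs u) (T (bs u))

  U : ℕ
  U = 2 ^ (r + 2)

  fs-mono : ∀ b {t t′} → t ≤ t′ → fs b t ≤ fs b t′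
  fs-mono b {t} {t′} le = subst (λ z → fs b t ≤ fs b z) (m∸n+n≡m le) (go (t′ ∸ t))
    where
    go : ∀ k → fs b t ≤ fs b (k + t)
    go zero = ≤-refl
    go (suc k) = ≤-trans (go k) (f≤φ _)

  fs-start : ∀ b t → b + r + 3 ≤ fs b t
  fs-start b t = fs-mono b {0} {t} z≤n

  bs-step : ∀ u → bs u ≤ bs (suc u)
  bs-step u = ≤-trans (≤-trans (m≤m+n (bs u) r) (m≤m+n (bs u + r) 3)) (fs-start (bs u) (T (bs u)))

  bs-mono : ∀ {u u′} → u ≤ u′ → bs u ≤ bs u′
  bs-mono {u} {u′} le = subst (λ z → bs u ≤ bs z) (m∸n+n≡m le) (go (u′ ∸ u))
    where
    go : ∀ k → bs u ≤ bs (k + u)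
    go zero = ≤-refl
    go (suc k) = ≤-trans (go k) (bs-step (k + u))

  r≤bs : ∀ u → r ≤ bs u
  r≤bs u = bs-mono {0} {u} z≤n

  -- The factor 2 is for `n≤2^[n∸x]`, by which the term `n * 2 ^ e` of the waste becomes a power of
  -- two.
  n₀ : ℕ
  n₀ = 2 * (e + bs U + 5)

  module AtScale (n f : ℕ) (r≥1 : 1 ≤ r) (big : 2 * (e + φ f + 5) ≤ n) where
    open ≤-Reasoning

    φ+≤n : e + φ f + 5 ≤ n
    φ+≤n = ≤-trans (m≤n*m _ 2) big

    φ≤n : φ f ≤ n
    φ≤n = ≤-trans (m≤n+m (φ f) e) (≤-trans (m≤m+n _ 5) φ+≤n)

    f+5≤n : f + 5 ≤ n
    f+5≤n = ≤-trans (+-monoʳ-≤ f (m≤m+n 5 5)) (≤-trans (f≤K f) (≤-trans (K≤φ f) φ≤n))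

    f+4≤n : f + 4 ≤ n
    f+4≤n = ≤-trans (+-monoʳ-≤ f (n≤1+n 4)) f+5≤n

    q d : ℕ
    q = 2 ^ (n ∸ (f + 4))
    d = 2 ^ (n ∸ φ f)

    waste : 8 * 2 ^ (n + (2 * τ + 2) ∸ K′ f) + n * 2 ^ e ≤ q
    waste = begin
      8 * 2 ^ (n + (2 * τ + 2) ∸ K′ f) + n * 2 ^ e ≤⟨ +-mono-≤ first second ⟩
      2 ^ (n ∸ (f + 5)) + 2 ^ (n ∸ (f + 5)) ≡⟨ cong (2 ^ (n ∸ (f + 5)) +_) (sym (+-identityʳ _)) ⟩
      2 * 2 ^ (n ∸ (f + 5)) ≤⟨ 2^*2^∸ 1 (f + 4) (f + 5) (≤-reflexive (sym (+-suc f 4))) f+5≤n ⟩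
      q ∎
      where
      X = n + (2 * τ + 2)
      K′≤n : K′ f ≤ n
      K′≤n = ≤-trans (m≤n*m (K′ f) 4) (≤-trans (K≤φ f) φ≤n)
      -- The exponents 3, 2τ + 2 and f + 5 add up to `g f`, which explains this constant.
      first : 8 * 2 ^ (X ∸ K′ f) ≤ 2 ^ (n ∸ (f + 5))
      first = ≤-trans (≤-reflexive (sym (^-distribˡ-+-* 2 3 (X ∸ K′ f)))) (^-monoʳ-≤ 2 {3 + (X ∸ K′ f)} {n ∸ (f + 5)} (m+n≤o⇒m≤o∸n (3 + (X ∸ K′ f)) (+-cancelʳ-≤ (K′ f) (3 + (X ∸ K′ f) + (f + 5)) n (begin
        (3 + (X ∸ K′ f)) + (f + 5) + K′ f ≡⟨ solve 3 (λ x f k → (con 3 :+ x) :+ (f :+ con 5) :+ k := (x :+ k) :+ (f :+ con 8)) refl (X ∸ K′ f) f (K′ f) ⟩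
        (X ∸ K′ f + K′ f) + (f + 8) ≡⟨ cong (_+ (f + 8)) (m∸n+n≡m (≤-trans K′≤n (m≤m+n n _))) ⟩
        X + (f + 8) ≡⟨ solve 3 (λ n t f → (n :+ (con 2 :* t :+ con 2)) :+ (f :+ con 8) := n :+ (f :+ con 2 :* t :+ con 10)) refl n τ f ⟩
        n + g f ≤⟨ +-monoʳ-≤ n (g≤K′ f) ⟩
        n + K′ f ∎))))
      x = e + f + 5
      x≤ : x ≤ e + φ f + 5
      x≤ = +-monoˡ-≤ 5 (+-monoʳ-≤ e (f≤φ f))
      second : n * 2 ^ e ≤ 2 ^ (n ∸ (f + 5))
      second = ≤-trans (*-monoˡ-≤ (2 ^ e) (n≤2^[n∸x] n x (≤-trans (*-monoʳ-≤ 2 x≤) big)))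
        (≤-trans (≤-reflexive (*-comm (2 ^ (n ∸ x)) (2 ^ e))) (2^*2^∸ e (f + 5) x (≤-reflexive (sym (+-assoc e f 5))) (≤-trans x≤ φ+≤n)))

    parameters : Parameters
    parameters = record
      { n = n ; K′ = K′ f ; e = e ; q = q ; d = d
      ; e≥1 = r≥1
      ; K+e<n = ≤-trans (≤-trans (≤-reflexive (trans (cong suc (+-comm (K f) e)) (+-comm 1 _))) (+-mono-≤ (+-monoʳ-≤ e (K≤φ f)) (m≤m+n 1 4))) φ+≤n
      ; cell≤q = ^-monoʳ-≤ 2 (∸-monoʳ-≤ n (≤-trans (+-monoʳ-≤ f (m≤m+n 4 6)) (f≤K f)))
      ; waste≤q = waste
      ; d-small = begin
          2 ^ (n ∸ φ f) * (2 ^ (τ + K′ f) * 2 ^ (τ + K′ f)) ≡⟨ cong (2 ^ (n ∸ φ f) *_) (sym (^-distribˡ-+-* 2 (τ + K′ f) (τ + K′ f))) ⟩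
          2 ^ (n ∸ φ f) * 2 ^ ((τ + K′ f) + (τ + K′ f)) ≡⟨ *-comm (2 ^ (n ∸ φ f)) _ ⟩
          2 ^ ((τ + K′ f) + (τ + K′ f)) * 2 ^ (n ∸ φ f) ≤⟨ 2^*2^∸ ((τ + K′ f) + (τ + K′ f)) (K f) (φ f) (≤-reflexive (cong (λ z → (τ + K′ f) + z + K f) (sym (+-identityʳ (τ + K′ f))))) φ≤n ⟩
          2 ^ (n ∸ K f) ∎ }

    thin-levels : ∀ w → bin (K f) w * 2 ^ (n ∸ K f) * 2 ≤ q
    thin-levels w = *-cancelˡ-≤ (2 ^ (f + 4)) {{m^n≢0 2 (f + 4)}} (begin
      2 ^ (f + 4) * (bin (K f) w * 2 ^ (n ∸ K f) * 2)
        ≡⟨ solve 3 (λ a b c → a :* (b :* c :* con 2) := (b :* (con 2 :* a)) :* c) refl (2 ^ (f + 4)) (bin (K f) w) (2 ^ (n ∸ K f)) ⟩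
      (bin (K f) w * 2 ^ suc (f + 4)) * 2 ^ (n ∸ K f) ≤⟨ *-monoˡ-≤ (2 ^ (n ∸ K f)) bin-bound ⟩
      2 ^ K f * 2 ^ (n ∸ K f) ≡⟨ trans (2^-cancel (K f) (≤-trans (K≤φ f) φ≤n)) (sym (2^-cancel (f + 4) f+4≤n)) ⟩
      2 ^ (f + 4) * q ∎)
      where
      -- One number in two forms: a multiple of four for the tolerances, twice a power of four for
      -- `bin-small`.
      K-shape : K f ≡ 2 * 4 ^ suc (g f)
      K-shape = solve 1 (λ x → con 4 :* (con 2 :* x) := con 2 :* (con 4 :* x)) refl (4 ^ g f)
      bin-bound : bin (K f) w * 2 ^ suc (f + 4) ≤ 2 ^ K f
      bin-bound = ≤-trans (*-monoʳ-≤ (bin (K f) w) (^-monoʳ-≤ 2 {suc (f + 4)} {suc (g f)} (s≤s (≤-trans (+-monoʳ-≤ f (m≤m+n 4 6)) (f≤g f)))))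
        (subst (λ z → bin z w * 2 ^ suc (g f) ≤ 2 ^ z) (sym K-shape) (bin-small (suc (g f)) w))

triples-all : {A : Set} {R : A → A → Set} (xs : List A) →
  (∀ {v p r} → v ∈ xs → p ∈ xs → r ∈ xs → R v p ⊎ R v r ⊎ R p r) → Triples R xs
triples-all [] h = []
triples-all (x ∷ xs) h = (λ p r → h (here refl) (there p) (there r)) ∷ triples-all xs λ v p r → h (there v) (there p) (there r)

window : (ℕ → ℕ) → ℕ → ℕ → Bool
window θ t m = (suc (θ (suc t)) ≤ᵇ m) ∧ (m ≤ᵇ θ t)

-- As θ decreases, the indicator of a window is at most the difference of those of θ (t+1) < m and θ
-- t < m, and these differences telescope.
windows-disjoint : (θ : ℕ → ℕ) → (∀ t → θ (suc t) ≤ θ t) → ∀ m T → ∑ (range T) (λ t → ⟦ window θ t m ⟧) ≤ 1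
windows-disjoint θ mono m T = ≤-trans (≤-trans (m≤m+n _ ⟦ suc (θ 0) ≤ᵇ m ⟧) (telescope T)) (⟦⟧≤1 _)
  where
  step : ∀ t → ⟦ window θ t m ⟧ + ⟦ suc (θ t) ≤ᵇ m ⟧ ≤ ⟦ suc (θ (suc t)) ≤ᵇ m ⟧
  step t with suc (θ t) ≤? m | m ≤? θ t
  ... | yes a | yes b = contradiction b (<⇒≱ a)
  ... | yes a | no b rewrite ≤ᵇ-intro a | ≤ᵇ-intro (≤-trans (s≤s (mono t)) a) | ¬true {m ≤ᵇ θ t} (b ∘ ≤ᵇ-true) = ≤-refl
  ... | no a | _ rewrite ¬true {suc (θ t) ≤ᵇ m} (λ h → a (≤ᵇ-true {suc (θ t)} h)) =
    ≤-trans (≤-reflexive (+-identityʳ _)) (⟦⟧-mono {window θ t m} λ h → proj₁ (∧-true h))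
  telescope : ∀ T → ∑ (range T) (λ t → ⟦ window θ t m ⟧) + ⟦ suc (θ 0) ≤ᵇ m ⟧ ≤ ⟦ suc (θ T) ≤ᵇ m ⟧
  telescope zero = ≤-refl
  telescope (suc T) = begin
    ∑ (range (suc T)) w + z ≡⟨ cong (_+ z) (∑-range-suc T w) ⟩
    (∑ (range T) w + w T) + z ≡⟨ solve 3 (λ a b c → (a :+ b) :+ c := b :+ (a :+ c)) refl (∑ (range T) w) (w T) z ⟩
    w T + (∑ (range T) w + z) ≤⟨ +-monoʳ-≤ (w T) (telescope T) ⟩
    w T + ⟦ suc (θ T) ≤ᵇ m ⟧ ≤⟨ step T ⟩
    ⟦ suc (θ (suc T)) ≤ᵇ m ⟧ ∎
    where
    open ≤-Reasoning
    w : ℕ → ℕ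
    w t = ⟦ window θ t m ⟧
    z = ⟦ suc (θ 0) ≤ᵇ m ⟧

-- Extracting cliques and choosing the scales

module Sequences (H : Host) where
  open WithHost H

  everything : V → Bool
  everything _ = true

  record Sequence (h : ℕ → ℕ) : Set where
    field
      rem : ℕ → V → Bool
      pieces : ℕ → List (V → Bool)
      initially : ∀ x → rem 0 x ≡ true
      partition : ∀ u x → ⟦ rem u x ⟧ ≡ ⟦ rem (suc u) x ⟧ + ∑ (pieces u) (λ C → ⟦ C x ⟧)
      piece-size : ∀ u {C} → C ∈ pieces u → # C ≡ h u
      piece-clique : ∀ u {C} → C ∈ pieces u → ∃[ v ] C ⊆ adj v
      low : ∀ u v → deg v (rem (suc u)) ≤ h u

  sequence : (h : ℕ → ℕ) → (∀ u → 0 < h u) → Sequence h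
  sequence h pos = record
    { rem = λ u → proj₁ (run u)
    ; pieces = λ u → map proj₂ (E.pieces u)
    ; initially = λ _ → refl
    ; partition = λ u x → trans (E.partition u x) (cong (⟦ E.left u x ⟧ +_) (sym (∑-map proj₂ (E.pieces u) _)))
    ; piece-size = λ u m → case ∈-map⁻ proj₂ m of λ { (C , i , refl) → proj₁ (E.piece u i) }
    ; piece-clique = λ u m → case ∈-map⁻ proj₂ m of λ { ((v , C) , i , refl) → v , proj₁ (proj₂ (E.piece u i)) }
    ; low = λ u v → ≤-trans (≤-reflexive (deg-∩ v (E.left u))) (<⇒≤ (E.maximal u (∈-all v))) }
    where
    run : ∀ u → Σ (V → Bool) λ P → Extraction adj vs (h u) P
    run zero = everything , extract adj vs (h 0) (pos 0) (# everything) everything ≤-refl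
    run (suc u) = Extraction.left (proj₂ (run u)) ,
      extract adj vs (h (suc u)) (pos (suc u)) (# (Extraction.left (proj₂ (run u)))) _ ≤-refl
    module E (u : ℕ) = Extraction (proj₂ (run u))

module Coarse (H : Host) (r : ℕ) (r≥3 : 3 ≤ r) (n : ℕ) (n₀≤n : Constants.n₀ r ≤ n)
  (order : FiniteSet.# (Host._≟ᵥ_ H) (Host.vs H) (Host.enum H) (Sequences.everything H) ≡ 2 * 2 ^ n + 16 * 2 ^ (n ∸ r)) where
  open WithHost H
  open Sequences H
  open Constants r
  open ≤-Reasoning

  h : ℕ → ℕ
  h u = 2 ^ (n ∸ bs u)

  N : ℕ
  N = # everything

  bU≤n : bs U ≤ n
  bU≤n = ≤-trans (≤-trans (≤-trans (m≤n+m (bs U) e) (m≤m+n _ 5)) (m≤n*m _ 2)) n₀≤n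

  r≤n : r ≤ n
  r≤n = ≤-trans (r≤bs U) bU≤n

  y : ℕ
  y = 2 ^ (n ∸ r)

  2^n≡ : 2 ^ n ≡ 2 ^ r * y
  2^n≡ = sym (2^-cancel r r≤n)

  N≤ : N ≤ 2 ^ (2 + n)
  N≤ = begin
    N ≡⟨ order ⟩
    2 * 2 ^ n + 16 * y ≤⟨ +-monoʳ-≤ (2 * 2 ^ n) (≤-trans (*-monoˡ-≤ y (*-monoʳ-≤ 2 (^-monoʳ-≤ 2 r≥3))) (≤-reflexive (*-assoc 2 (2 ^ r) y))) ⟩
    2 * 2 ^ n + 2 * (2 ^ r * y) ≡⟨ cong (λ z → 2 * 2 ^ n + 2 * z) (sym 2^n≡) ⟩
    2 * 2 ^ n + 2 * 2 ^ n ≡⟨ solve 1 (λ x → con 2 :* x :+ con 2 :* x := con 2 :* (con 2 :* x)) refl (2 ^ n) ⟩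
    2 ^ (2 + n) ∎

  module _ (sq : Sequence h) where
    open Sequence sq

    mass : ℕ → ℕ
    mass u = ∑ (pieces u) #

    mass-step : ∀ u → # (rem u) ≡ # (rem (suc u)) + mass u
    mass-step u = trans (∑-cong vs (partition u)) (trans (∑-+ vs _ _) (cong (# (rem (suc u)) +_) (∑-swap vs (pieces u) _)))

    masses : ∀ k → ∑ (range k) (λ u → mass (suc u)) + # (rem (suc k)) ≡ # (rem 1)
    masses zero = refl
    masses (suc k) = trans (cong (_+ # (rem (2 + k))) (∑-range-suc k (λ u → mass (suc u))))
      (trans (trans (+-assoc (∑ (range k) (λ u → mass (suc u))) _ _) (cong (∑ (range k) (λ u → mass (suc u)) +_)
        (trans (+-comm (mass (suc k)) _) (sym (mass-step (suc k)))))) (masses k))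

    rem≤N : ∀ u → # (rem u) ≤ N
    rem≤N u = #-mono {rem u} {everything} λ _ _ → refl

    -- The pieces of different steps are disjoint and `N` is at most 2^(n+2) = U·y, so one of `U`
    -- steps removes at most `y` vertices.
    light-step : ∃[ u ] (u ∈ range U) × mass (suc u) ≤ y
    light-step = pigeonhole (range U) (λ u → mass (suc u)) y
      (subst (0 <_) (sym (length-range U)) (m^n>0 2 (r + 2)))
      (≤-trans (≤-trans (≤-trans (m≤m+n _ _) (≤-reflexive (masses U))) (≤-trans (rem≤N 1) N≤)) (≤-reflexive (begin-equality
        2 ^ (2 + n) ≡⟨ ^-distribˡ-+-* 2 2 n ⟩
        4 * 2 ^ n ≡⟨ cong (4 *_) 2^n≡ ⟩
        4 * (2 ^ r * y) ≡⟨ solve 2 (λ a b → con 4 :* (a :* b) := (a :* con 4) :* b) refl (2 ^ r) y ⟩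
        2 ^ r * 4 * y ≡⟨ cong (_* y) (sym (^-distribˡ-+-* 2 r 2)) ⟩
        U * y ≡⟨ cong (_* y) (sym (length-range U)) ⟩
        length (range U) * y ∎)))

    cliques : ℕ → List (V → Bool)
    cliques zero = []
    cliques (suc u) = pieces u ++ cliques u

    cliques-partition : ∀ u x → ⟦ rem u x ⟧ + ∑ (cliques u) (λ C → ⟦ C x ⟧) ≡ 1
    cliques-partition zero x = trans (+-identityʳ _) (cong ⟦_⟧ (initially x))
    cliques-partition (suc u) x = trans (cong (⟦ rem (suc u) x ⟧ +_) (∑-++ (pieces u) (cliques u) _))
      (trans (sym (+-assoc ⟦ rem (suc u) x ⟧ _ _)) (trans (cong (_+ ∑ (cliques u) (λ C → ⟦ C x ⟧)) (sym (partition u x))) (cliques-partition u x)))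

    cliques-size : ∀ u {C} → C ∈ cliques (suc u) → h u ≤ # C
    cliques-size u m with ∈-++⁻ (pieces u) m
    ... | inj₁ i = ≤-reflexive (sym (piece-size u i))
    cliques-size (suc u) m | inj₂ i = ≤-trans (^-monoʳ-≤ 2 (∸-monoʳ-≤ n (bs-step u))) (cliques-size u i)

    cliques-clique : ∀ u {C} → C ∈ cliques u → ∃[ v ] C ⊆ adj v
    cliques-clique (suc u) m with ∈-++⁻ (pieces u) m
    ... | inj₁ i = piece-clique u i
    ... | inj₂ i = cliques-clique u i

    cliques-total : ∀ u → # (rem u) + ∑ (cliques u) # ≡ N
    cliques-total u = trans (cong (# (rem u) +_) (∑-swap (cliques u) vs _)) (trans (sym (∑-+ vs _ _)) (∑-cong vs (cliques-partition u)))

    -- The pieces of step `u + 1` are given up at a cost of at most `y`. This opens a gap: the kept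
    -- cliques have at least 2^(n-b) vertices, while degrees into `R` are at most the last threshold
    -- `θ (T b)`.
    module AtStep (u : ℕ) (u<U : u < U) (light : mass (suc u) ≤ y) where
      b : ℕ
      b = bs u
      A : List (V → Bool)
      A = cliques (suc u)
      R : V → Bool
      R = rem (2 + u)

      θ : ℕ → ℕ
      θ t = 2 ^ (n ∸ fs b t)

      θ-mono : ∀ t → θ (suc t) ≤ θ t
      θ-mono t = ^-monoʳ-≤ 2 (∸-monoʳ-≤ n (f≤φ (fs b t)))

      b≤n : b ≤ n
      b≤n = ≤-trans (bs-mono (<⇒≤ u<U)) bU≤n

      fs≤bU : ∀ {t} → t ≤ T b → fs b t ≤ bs U
      fs≤bU le = ≤-trans (fs-mono b le) (bs-mono u<U)

      length-A : length A ≤ 2 ^ (2 + b)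
      length-A = *-cancelʳ-≤ _ _ (h u) {{m^n≢0 2 (n ∸ b)}} (begin
        length A * h u ≡⟨ sym (∑-const A (h u)) ⟩
        ∑ A (λ _ → h u) ≤⟨ ∑-mono∈ A (cliques-size u) ⟩
        ∑ A # ≤⟨ ≤-trans (m≤n+m _ (# (rem (suc u)))) (≤-reflexive (cliques-total (suc u))) ⟩
        N ≤⟨ N≤ ⟩
        2 ^ (2 + n) ≡⟨ trans (^-distribˡ-+-* 2 2 n) (cong (4 *_) (sym (2^-cancel b b≤n))) ⟩
        4 * (2 ^ b * h u) ≡⟨ sym (*-assoc 4 (2 ^ b) (h u)) ⟩
        4 * 2 ^ b * h u ≡⟨ cong (_* h u) (sym (^-distribˡ-+-* 2 2 b)) ⟩
        2 ^ (2 + b) * h u ∎)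

      μ : ℕ
      μ = 2 ^ (n ∸ (b + 2))

      b+2≤n : b + 2 ≤ n
      b+2≤n = ≤-trans (≤-trans (≤-trans (+-monoˡ-≤ 2 (m≤m+n b r)) (+-monoʳ-≤ (b + r) (m≤m+n 2 1))) (fs-start b 0)) (≤-trans (fs≤bU {0} z≤n) bU≤n)

      inWindow : ℕ → ℕ
      inWindow t = ∑ A λ B → # (λ x → window θ t (deg x B))

      -- At most 2^(b+2) cliques and 2^(n+2) vertices make at most `T b * μ` pairs, each lying in at
      -- most one window.
      light-window : ∃[ t ] (t ∈ range (T b)) × inWindow t ≤ μ
      light-window = pigeonhole (range (T b)) inWindow μ (subst (0 <_) (sym (length-range (T b))) (m^n>0 2 (2 * b + 6))) (begin
        ∑ (range (T b)) inWindow ≡⟨ ∑-swap (range (T b)) A _ ⟩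
        ∑ A (λ B → ∑ (range (T b)) (λ t → # (λ x → window θ t (deg x B)))) ≡⟨ ∑-cong A (λ B → ∑-swap (range (T b)) vs _) ⟩
        ∑ A (λ B → ∑ vs (λ x → ∑ (range (T b)) (λ t → ⟦ window θ t (deg x B) ⟧)))
          ≤⟨ ∑-mono A (λ B → ∑-mono vs λ x → windows-disjoint θ θ-mono (deg x B) (T b)) ⟩
        ∑ A (λ B → N) ≡⟨ ∑-const A N ⟩
        length A * N ≤⟨ *-mono-≤ length-A N≤ ⟩
        2 ^ (2 + b) * 2 ^ (2 + n) ≡⟨ cong (λ z → 2 ^ (2 + b) * (2 * (2 * z))) (sym (2^-cancel (b + 2) b+2≤n)) ⟩
        2 ^ (2 + b) * (2 * (2 * (2 ^ (b + 2) * μ))) ≡⟨ solve 3 (λ p q m → p :* (con 2 :* (con 2 :* (q :* m))) := (p :* (con 4 :* q)) :* m) refl (2 ^ (2 + b)) (2 ^ (b + 2)) μ ⟩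
        2 ^ (2 + b) * (4 * 2 ^ (b + 2)) * μ ≡⟨ cong (λ z → 2 ^ (2 + b) * z * μ) (sym (^-distribˡ-+-* 2 2 (b + 2))) ⟩
        2 ^ (2 + b) * 2 ^ (2 + (b + 2)) * μ ≡⟨ cong (_* μ) (sym (^-distribˡ-+-* 2 (2 + b) (2 + (b + 2)))) ⟩
        2 ^ ((2 + b) + (2 + (b + 2))) * μ ≡⟨ cong (λ z → 2 ^ z * μ) (solve 1 (λ b → (con 2 :+ b) :+ (con 2 :+ (b :+ con 2)) := con 2 :* b :+ con 6) refl b) ⟩
        T b * μ ≡⟨ cong (_* μ) (sym (length-range (T b))) ⟩
        length (range (T b)) * μ ∎)

      module AtWindow (t : ℕ) (t<T : t < T b) (few : inWindow t ≤ μ) where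
        f : ℕ
        f = fs b t

        φ≤bU : φ f ≤ bs U
        φ≤bU = fs≤bU {suc t} t<T

        big : 2 * (e + φ f + 5) ≤ n
        big = ≤-trans (*-monoʳ-≤ 2 (+-monoˡ-≤ 5 (+-monoʳ-≤ e φ≤bU))) n₀≤n

        r≥1 : 1 ≤ r
        r≥1 = ≤-trans (s≤s z≤n) r≥3

        open AtScale n f r≥1 big

        open Paths H (4 * q) d

        b+1≤f : b + 1 ≤ f
        b+1≤f = ≤-trans (+-monoʳ-≤ b (≤-trans (s≤s z≤n) (m≤n+m 3 r))) (≤-trans (≤-reflexive (sym (+-assoc b r 3))) (fs-start b t))

        16q≤θ : 16 * q ≤ θ t
        16q≤θ = 2^*2^∸ 4 f (f + 4) (≤-reflexive (+-comm 4 f)) (f+4≤n)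

        16q+2μ≤h : 4 * (4 * q) + 2 * μ ≤ h u
        16q+2μ≤h = begin
          4 * (4 * q) + 2 * μ ≡⟨ cong (_+ 2 * μ) (sym (*-assoc 4 4 q)) ⟩
          16 * q + 2 * μ ≤⟨ +-mono-≤ (≤-trans 16q≤θ (^-monoʳ-≤ 2 (∸-monoʳ-≤ n b+1≤f))) (2^*2^∸ 1 (b + 1) (b + 2) (≤-reflexive (sym (+-suc b 1))) b+2≤n) ⟩
          2 ^ (n ∸ (b + 1)) + 2 ^ (n ∸ (b + 1)) ≡⟨ cong (2 ^ (n ∸ (b + 1)) +_) (sym (+-identityʳ _)) ⟩
          2 * 2 ^ (n ∸ (b + 1)) ≤⟨ 2^*2^∸ 1 b (b + 1) (≤-reflexive (+-comm 1 b)) (≤-trans (+-monoʳ-≤ b (n≤1+n 1)) b+2≤n) ⟩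
          h u ∎

        kc≤h : ∀ k → k ≤ 4 → k * (4 * q) ≤ h u
        kc≤h k le = ≤-trans (*-monoˡ-≤ (4 * q) le) (≤-trans (m≤m+n _ (2 * μ)) 16q+2μ≤h)

        cliqueNodes : List Slot
        cliqueNodes = map (λ B → B , false) A

        few-mid : ∀ {B} (B₁ : V → Bool) → B ∈ A → # (λ x → B₁ x ∧ mid (θ t) x B) ≤ μ
        few-mid {B} B₁ m = ≤-trans (#-mono {λ x → B₁ x ∧ mid (θ t) x B} {λ x → window θ t (deg x B)} λ x k → proj₂ (∧-true {B₁ x} k))
          (≤-trans (∑-∈ (λ B → # (λ x → window θ t (deg x B))) m) few)

        2c≤θ : 2 * (4 * q) ≤ θ t
        2c≤θ = ≤-trans (≤-trans (≤-reflexive (sym (*-assoc 2 4 q))) (*-monoˡ-≤ q (m≤m+n 8 8))) 16q≤θ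

        triple-at : ∀ {B₁ r₁ p s} → h u ≤ # B₁ → p ∈ cliqueNodes → s ∈ cliqueNodes →
          Link (B₁ , r₁) p ⊎ Link (B₁ , r₁) s ⊎ Link p s
        triple-at {B₁} large p∈ s∈ with ∈-map⁻ (λ B → B , false) p∈ | ∈-map⁻ (λ B → B , false) s∈
        ... | B₂ , i , refl | B₃ , j , refl = triple {θ t} {μ} {B₁} {_} {B₂} {B₃} 2c≤θ (≤-trans 16q+2μ≤h large)
          (≤-trans (kc≤h 2 (s≤s (s≤s z≤n))) (cliques-size u i)) (≤-trans (kc≤h 2 (s≤s (s≤s z≤n))) (cliques-size u j))
          (few-mid B₁ i) (few-mid B₁ j)

        clique-triples : Triples Link cliqueNodes
        clique-triples = triples-all cliqueNodes λ v∈ p∈ s∈ → case ∈-map⁻ (λ B → B , false) v∈ of λ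
          { (B₁ , i , refl) → triple-at (cliques-size u i) p∈ s∈ }

        clique-node : ∀ {z} → z ∈ cliqueNodes → Node z × proj₂ z ≡ false
        clique-node m with ∈-map⁻ (λ B → B , false) m
        ... | B , i , refl = record { node-size = ≤-trans (kc≤h 3 (n≤1+n 3)) (cliques-size u i)
                                    ; node-clique = λ _ → cliques-clique (suc u) i } , refl

        rest-degree : ∀ v → deg v R ≤ 2 ^ (n ∸ K f)
        rest-degree v = ≤-trans (low (suc u) v) (^-monoʳ-≤ 2 (∸-monoʳ-≤ n (≤-trans (K≤φ f) (fs-mono b {suc t} {T b} t<T))))

        big-node : h u ≤ # R → Node (R , true)
        big-node le = record { node-size = ≤-trans (kc≤h 3 (n≤1+n 3)) le ; node-clique = λ () }

        nodes-cover : ∀ x → ⟦ R x ⟧ + ∑ A (λ C → ⟦ C x ⟧) ≤ 1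
        nodes-cover x = ≤-trans (+-monoˡ-≤ (∑ A (λ C → ⟦ C x ⟧)) (≤-trans (m≤m+n _ _) (≤-reflexive (sym (partition (suc u) x)))))
          (≤-reflexive (cliques-partition (suc u) x))

        clique-sum : ∀ (g : (V → Bool) → ℕ) → ∑ cliqueNodes (λ s → g (proj₁ s)) ≡ ∑ A g
        clique-sum g = ∑-map (λ B → B , false) A (λ s → g (proj₁ s))

        total-≥ : N ≤ y + # R + ∑ A #
        total-≥ = ≤-trans (≤-reflexive (sym (cliques-total (suc u)))) (+-monoˡ-≤ (∑ A #)
          (≤-trans (≤-reflexive (trans (mass-step (suc u)) (+-comm (# R) _))) (+-monoˡ-≤ (# R) light)))

        -- Here the 16 in the order is spent, in units of `y`: 2 on discarded vertices, 2 on the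
        -- surplus of chunks (as 2^n = 2^e·y), 9 on the slots (as `2 * (k * q) ≤ y`); 3 are spare.
        ample-for : ∀ (k Z : ℕ) → k ≤ suc (length A) → N ≤ 2 * y + Z →
          2 * (2 ^ n * suc (2 ^ e) + 2 ^ e * ((3 * k) * (3 * q))) ≤ 2 ^ e * Z
        ample-for k Z k≤ N≤Z = begin
          2 * (2 ^ n * suc (2 ^ e) + 2 ^ e * ((3 * k) * (3 * q))) ≡⟨ cong (λ m → 2 * (m * suc (2 ^ e) + 2 ^ e * ((3 * k) * (3 * q)))) 2^n≡ ⟩
          2 * (2 ^ e * y * suc (2 ^ e) + 2 ^ e * ((3 * k) * (3 * q)))
            ≡⟨ solve 4 (λ a y k q → con 2 :* (a :* y :* (con 1 :+ a) :+ a :* ((con 3 :* k) :* (con 3 :* q))) := a :* (con 2 :* (a :* y) :+ con 2 :* y :+ con 9 :* (con 2 :* (k :* q)))) refl (2 ^ e) y k q ⟩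
          2 ^ e * (2 * (2 ^ e * y) + 2 * y + 9 * (2 * (k * q))) ≤⟨ *-monoʳ-≤ (2 ^ e) (+-cancelˡ-≤ (2 * y) _ _ (begin
            2 * y + (2 * (2 ^ e * y) + 2 * y + 9 * (2 * (k * q))) ≤⟨ +-monoʳ-≤ (2 * y) (+-monoʳ-≤ (2 * (2 ^ e * y) + 2 * y) (*-monoʳ-≤ 9 kq≤y)) ⟩
            2 * y + (2 * (2 ^ e * y) + 2 * y + 9 * y) ≤⟨ m≤m+n _ (3 * y) ⟩
            2 * y + (2 * (2 ^ e * y) + 2 * y + 9 * y) + 3 * y ≡⟨ solve 2 (λ m y → con 2 :* y :+ (con 2 :* m :+ con 2 :* y :+ con 9 :* y) :+ con 3 :* y := con 2 :* m :+ con 16 :* y) refl (2 ^ e * y) y ⟩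
            2 * (2 ^ e * y) + 16 * y ≡⟨ cong (λ m → 2 * m + 16 * y) (sym 2^n≡) ⟩
            2 * 2 ^ n + 16 * y ≡⟨ sym order ⟩
            N ≤⟨ N≤Z ⟩
            2 * y + Z ∎)) ⟩
          2 ^ e * Z ∎
          where
          k≤2^ : k ≤ 2 ^ (3 + b)
          k≤2^ = ≤-trans k≤ (≤-trans (+-mono-≤ (m^n>0 2 (2 + b)) length-A) (≤-reflexive (cong (2 ^ (2 + b) +_) (sym (+-identityʳ _)))))
          kq≤y : 2 * (k * q) ≤ y
          kq≤y = ≤-trans (*-monoʳ-≤ 2 (*-monoˡ-≤ q k≤2^)) (≤-trans (≤-reflexive (sym (*-assoc 2 (2 ^ (3 + b)) q)))
            (2^*2^∸ (4 + b) r (f + 4) (≤-trans (≤-reflexive (solve 2 (λ b r → (con 4 :+ b) :+ r := (b :+ r) :+ con 4) refl b r))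
              (+-monoˡ-≤ 4 (≤-trans (m≤m+n (b + r) 3) (fs-start b t)))) (f+4≤n)))

        open FromNodes H parameters using (NodeList; red-cube-from-nodes)

        length-cliqueNodes : length cliqueNodes ≡ length A
        length-cliqueNodes = trans (sym (trans (∑-const cliqueNodes 1) (*-identityʳ _))) (trans (∑-map (λ B → B , false) A (λ _ → 1))
          (trans (∑-const A 1) (*-identityʳ _)))

        without-rest : # R ≤ y → NodeList
        without-rest small = record
          { nodes = cliqueNodes
          ; node = proj₁ ∘ clique-node
          ; rest-node = λ m isR → true≢false isR (proj₂ (clique-node m))
          ; disjoint-nodes = λ x → ≤-trans (≤-reflexive (clique-sum λ C → ⟦ C x ⟧)) (≤-trans (m≤n+m _ ⟦ R x ⟧) (nodes-cover x))
          ; triples = clique-triples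
          ; thin = thin-levels
          ; ample = ample-for (length cliqueNodes) (∑ cliqueNodes (λ s → # (proj₁ s))) (≤-trans (≤-reflexive length-cliqueNodes) (n≤1+n _))
              (≤-trans total-≥ (+-mono-≤ (≤-trans (+-monoʳ-≤ y small) (≤-reflexive (cong (y +_) (sym (+-identityʳ y))))) (≤-reflexive (sym (clique-sum #))))) }

        with-rest : y ≤ # R → NodeList
        with-rest large = record
          { nodes = (R , true) ∷ cliqueNodes
          ; node = λ { (here refl) → big-node h≤R ; (there m) → proj₁ (clique-node m) }
          ; rest-node = λ { (here refl) _ v → rest-degree v ; (there m) isR → true≢false isR (proj₂ (clique-node m)) }
          ; disjoint-nodes = λ x → ≤-trans (≤-reflexive (cong (⟦ R x ⟧ +_) (clique-sum λ C → ⟦ C x ⟧))) (nodes-cover x)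
          ; triples = triple-at h≤R ∷ clique-triples
          ; thin = thin-levels
          ; ample = ample-for (suc (length cliqueNodes)) (# R + ∑ cliqueNodes (λ s → # (proj₁ s))) (s≤s (≤-reflexive length-cliqueNodes))
              (≤-trans total-≥ (≤-trans (≤-reflexive (+-assoc y (# R) _)) (+-mono-≤ (m≤m+n y _) (≤-reflexive (cong (# R +_) (sym (clique-sum #))))))) }
          where
          h≤R : h u ≤ # R
          h≤R = ≤-trans (^-monoʳ-≤ 2 (∸-monoʳ-≤ n (r≤bs u))) large

        result : FreeCube n
        -- Since `h u ≤ y`, a remainder of at least `y` vertices is large enough for a node; a
        -- smaller one is dropped at the cost of a second `y`.
        result with ≤-total y (# R)
        ... | inj₁ large = red-cube-from-nodes (with-rest large)
        ... | inj₂ small = red-cube-from-nodes (without-rest small)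

    from-sequence : FreeCube n
    from-sequence with light-step
    ... | u , u∈ , light with AtStep.light-window u (∈-range⁻ u∈) light
    ... | t , t∈ , few = AtStep.AtWindow.result u (∈-range⁻ u∈) light t (∈-range⁻ t∈) few

  red-cube : FreeCube n
  red-cube = from-sequence (sequence h λ u → m^n>0 2 (n ∸ bs u))

-- Decidability and the lower bound

finList : ∀ N → List (Fin N)
finList zero = []
finList (suc N) = Fin.zero ∷ map Fin.suc (finList N)

fin-enum : ∀ N → Enumerates Fin._≟_ (finList N)
fin-enum (suc N) Fin.zero = cong suc (trans (∑-map Fin.suc (finList N) _) (∑-zero (finList N) λ _ → refl))
fin-enum (suc N) (Fin.suc x) = trans (∑-map Fin.suc (finList N) _) (fin-enum N x)

∑-fin-1 : ∀ N → ∑ (finList N) (λ _ → 1) ≡ N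
∑-fin-1 zero = refl
∑-fin-1 (suc N) = cong suc (trans (∑-map Fin.suc (finList N) _) (∑-fin-1 N))

∈-finList : ∀ {N} (x : Fin N) → x ∈ finList N
∈-finList {N} = FiniteSet.∈-all Fin._≟_ (finList N) (fin-enum N)

decide : {A : Set} {P : A → Set} → (∀ x → Dec (P x)) → ∀ x → P x ⊎ (¬ P x)
decide d x with d x
... | yes p = inj₁ p
... | no np = inj₂ np

dec-∀ : {A : Set} {P : A → Set} (xs : List A) → (∀ x → x ∈ xs) → (∀ x → Dec (P x)) → Dec (∀ x → P x)
dec-∀ xs all d with search (decide d) xs
... | inj₁ h = yes λ x → h (all x)
... | inj₂ (x , _ , np) = no λ h → np (h x)

dec-∃ : {A : Set} {P : A → Set} (xs : List A) → (∀ x → x ∈ xs) → (∀ x → Dec (P x)) → Dec (∃[ x ] P x)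
dec-∃ xs all d with search (decide (λ x → ¬? (d x))) xs
... | inj₁ h = no λ { (x , p) → h (all x) p }
... | inj₂ (x , _ , nnp) with d x
... | yes p = yes (x , p)
... | no np = contradiction np nnp

-- Functions are listed only up to pointwise equality, which is why `P` has to respect it below;
-- `default` fills in values outside the given list.
module Functions {A B : Set} (_≟ₐ_ : DecidableEquality A) (ys : List B) (all-ys : ∀ y → y ∈ ys) (default : A → B) where

  update : A → B → (A → B) → A → B
  update x y g z = if does (x ≟ₐ z) then y else g z

  functions : List A → List (A → B)
  functions [] = default ∷ []
  functions (x ∷ xs) = map (λ { (g , y) → update x y g }) (cartesianProduct (functions xs) ys)

  functions-complete : ∀ xs (f : A → B) → ∃[ g ] (g ∈ functions xs) × (∀ {x} → x ∈ xs → g x ≡ f x)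
  functions-complete [] f = default , here refl , λ ()
  functions-complete (x ∷ xs) f with functions-complete xs f
  ... | g , g∈ , eq = update x (f x) g , ∈-map⁺ _ (∈-cartesianProduct⁺ g∈ (all-ys (f x))) , agrees
    where
    agrees : ∀ {z} → z ∈ x ∷ xs → update x (f x) g z ≡ f z
    agrees {z} m with x ≟ₐ z
    ... | yes refl = refl
    agrees (here refl) | no ne = contradiction refl ne
    agrees (there m) | no _ = eq m

  dec-∃-function : (P : (A → B) → Set) (xs : List A) → (∀ x → x ∈ xs) → (∀ {f g} → (∀ x → f x ≡ g x) → P f → P g) →
    (∀ f → Dec (P f)) → Dec (∃[ f ] P f)
  dec-∃-function P xs all resp d with search (decide (λ f → ¬? (d f))) (functions xs)
  ... | inj₁ h = no λ { (f , p) → case functions-complete xs f of λ { (g , g∈ , eq) → h g∈ (resp (λ x → sym (eq (all x))) p) } }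
  ... | inj₂ (f , _ , nnp) with d f
  ... | yes p = yes (f , p)
  ... | no np = contradiction np nnp

module _ (n : ℕ) where

  IsRedCube : ∀ {N} → (Fin N → Fin N → Bool) → (Vec Bool n → Fin N) → Set
  IsRedCube c f = Injective _≡_ _≡_ f × (∀ u v → QAdj u v → c (f u) (f v) ≡ true)

  isRedCube? : ∀ {N} (c : Fin N → Fin N → Bool) f → Dec (IsRedCube c f)
  isRedCube? c f = map′ (λ h {u} {v} → h u v) (λ h u v → h)
      (dec-∀ (cube n) ∈-cube λ u → dec-∀ (cube n) ∈-cube λ v → (f u Fin.≟ f v) →-dec (u ≟q v))
    ×-dec dec-∀ (cube n) ∈-cube λ u → dec-∀ (cube n) ∈-cube λ v → (diffCount u v ≟ 1) →-dec (c (f u) (f v) Bool.≟ true)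

  redQ? : ∀ {N} (c : Fin N → Fin N → Bool) → Dec (RedQ n c)
  redQ? {zero} c = no λ { (f , _) → case f (replicate n false) of λ () }
  redQ? {suc N} c = Functions.dec-∃-function _≟q_ (finList (suc N)) ∈-finList (λ _ → Fin.zero) (IsRedCube c) (cube n) ∈-cube
    (λ { eq (inj , red) → (λ {u} {v} e → inj (trans (eq u) (trans e (sym (eq v))))) ,
         λ u v a → trans (cong₂ c (sym (eq u)) (sym (eq v))) (red u v a) })
    (isRedCube? c)

  blueTriangle? : ∀ {N} (c : Fin N → Fin N → Bool) → Dec (BlueTriangle c)
  blueTriangle? {N} c = dec-∃ (finList N) ∈-finList λ i → dec-∃ (finList N) ∈-finList λ j → dec-∃ (finList N) ∈-finList λ k →
    ¬? (i Fin.≟ j) ×-dec ¬? (j Fin.≟ k) ×-dec ¬? (i Fin.≟ k) ×-dec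
    (c i j Bool.≟ false) ×-dec (c j k Bool.≟ false) ×-dec (c i k Bool.≟ false)

  Good : ∀ {N} → (Fin N → Fin N → Bool) → Set
  Good c = RedQ n c ⊎ BlueTriangle c

  good-resp : ∀ {N} {c c′ : Fin N → Fin N → Bool} → (∀ i j → c i j ≡ c′ i j) → Good c → Good c′
  good-resp eq (inj₁ (f , inj , red)) = inj₁ (f , inj , λ u v a → trans (sym (eq _ _)) (red u v a))
  good-resp eq (inj₂ (i , j , k , a , b , d , x , y , z)) =
    inj₂ (i , j , k , a , b , d , trans (sym (eq _ _)) x , trans (sym (eq _ _)) y , trans (sym (eq _ _)) z)

  Counterexample : ∀ N → (Fin N × Fin N → Bool) → Set
  Counterexample N g = (∀ i j → g (i , j) ≡ g (j , i)) × ¬ Good (λ i j → g (i , j))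

  -- There are finitely many colourings, so the least `N` is found by search instead of excluded
  -- middle.
  arrows? : ∀ N → Dec (Arrows n N)
  arrows? N with Functions.dec-∃-function (×-≡-dec Fin._≟_ Fin._≟_) (true ∷ false ∷ [])
      (λ { true → here refl ; false → there (here refl) }) (λ _ → true) (Counterexample N)
      (cartesianProduct (finList N) (finList N)) (λ { (i , j) → ∈-cartesianProduct⁺ (∈-finList i) (∈-finList j) })
      (λ { eq (s , bad) → (λ i j → trans (sym (eq (i , j))) (trans (s i j) (eq (j , i)))) ,
           λ good → bad (good-resp (λ i j → sym (eq (i , j))) good) })
      (λ g → dec-∀ (finList N) ∈-finList (λ i → dec-∀ (finList N) ∈-finList λ j → g (i , j) Bool.≟ g (j , i))
        ×-dec ¬? (redQ? (λ i j → g (i , j)) ⊎-dec blueTriangle? (λ i j → g (i , j))))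
  ... | yes (g , s , bad) = no λ arrows → bad (arrows ((λ i j → g (i , j)) , s))
  ... | no none = yes λ { (c , s) → decidable-good c λ bad → none ((λ { (i , j) → c i j }) , s , bad) }
    where
    decidable-good : ∀ c → ¬ (¬ Good c) → Good c
    decidable-good c nn with redQ? c ⊎-dec blueTriangle? c
    ... | yes g = g
    ... | no ng = contradiction ng nn

least : {P : ℕ → Set} → (∀ m → Dec (P m)) → ∀ m → P m → ∃[ N ] (N ≤ m) × P N × (∀ M → M < N → ¬ P M)
least {P} d m pm with below m
  where
  below : ∀ m → (∃[ N ] (N < m) × P N × (∀ M → M < N → ¬ P M)) ⊎ (∀ M → M < m → ¬ P M)
  below zero = inj₂ λ _ ()
  below (suc m) with below m
  ... | inj₁ (N , lt , r) = inj₁ (N , ≤-trans lt (n≤1+n m) , r)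
  ... | inj₂ none with d m
  ... | yes p = inj₁ (m , ≤-refl , p , none)
  ... | no np = inj₂ λ M lt → case m≤n⇒m<n∨m≡n (≤-pred lt) of λ { (inj₁ l) → none M l ; (inj₂ refl) → np }
... | inj₁ (N , lt , r) = N , <⇒≤ lt , r
... | inj₂ none = m , ≤-refl , pm , none

arrows-upper : ∀ r n → 3 ≤ r → Constants.n₀ r ≤ n → Arrows n (2 * 2 ^ n + 16 * 2 ^ (n ∸ r))
arrows-upper r n r≥3 n₀≤n (c , c-sym) with blueTriangle? n c
... | yes triangle = inj₂ triangle
... | no none = inj₁ (conclude (Coarse.red-cube host r r≥3 n n₀≤n (∑-fin-1 N)))
  where
  N = 2 * 2 ^ n + 16 * 2 ^ (n ∸ r)
  -- The diagonal of a colouring is arbitrary; a blue loop would contradict `triangle-free`, so it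
  -- is removed.
  blue : Fin N → Fin N → Bool
  blue i j = not (c i j) ∧ not (does (i Fin.≟ j))
  blue-false : ∀ {i j} → blue i j ≡ true → (c i j ≡ false) × (i ≢ j)
  blue-false {i} {j} h with c i j | i Fin.≟ j
  ... | false | no ne = refl , ne
  blue-sym : ∀ i j → blue i j ≡ blue j i
  blue-sym i j rewrite c-sym i j with i Fin.≟ j
  ... | yes refl rewrite dec-true (i Fin.≟ i) refl = refl
  ... | no ne rewrite dec-false (j Fin.≟ i) (ne ∘ sym) = refl
  host : Host
  host = record
    { V = Fin N ; _≟ᵥ_ = Fin._≟_ ; vs = finList N ; enum = fin-enum N ; adj = blue ; adj-sym = blue-sym
    ; triangle-free = λ {x} {y} {z} xy xz yz → case blue-false {x} {y} xy , blue-false {x} {z} xz , blue-false {y} {z} yz of λ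
        { ((a , ne) , (b , ne′) , (d , ne″)) → none (x , y , z , ne , ne″ , ne′ , a , d , b) } }
  conclude : Degrees.FreeCube host n → RedQ n c
  conclude (f , inj , not-blue) = f , inj , red
    where
    red : ∀ u v → QAdj u v → c (f u) (f v) ≡ true
    red u v a with QAdj⇒flip u v a
    ... | i , lt , refl with c (f u) (f (flip i u)) | f u Fin.≟ f (flip i u) | not-blue i u lt
    ... | true | _ | _ = refl
    ... | false | yes e | _ = case trans (sym (diffCount-refl u)) (trans (cong (diffCount u) (inj e)) a) of λ ()

#-injective : ∀ {n N} (f : Vec Bool n → Fin N) → Injective _≡_ _≡_ f → (P : Fin N → Bool) → (∀ p → P (f p) ≡ true) →
  2 ^ n ≤ ∑ (finList N) (λ x → ⟦ P x ⟧)
#-injective {n} {N} f inj P all = begin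
  2 ^ n ≡⟨ sym (∑-cube-1 n) ⟩
  ∑ (cube n) (λ _ → 1) ≡⟨ ∑-cong (cube n) (λ p → trans (cong ⟦_⟧ (sym (all p))) (sym (FiniteSet.∑-point Fin._≟_ (finList N) (fin-enum N) (f p) (λ x → ⟦ P x ⟧)))) ⟩
  ∑ (cube n) (λ p → ∑ (finList N) (λ x → ⟦ does (f p Fin.≟ x) ⟧ * ⟦ P x ⟧)) ≡⟨ ∑-swap (cube n) (finList N) _ ⟩
  ∑ (finList N) (λ x → ∑ (cube n) (λ p → ⟦ does (f p Fin.≟ x) ⟧ * ⟦ P x ⟧)) ≡⟨ ∑-cong (finList N) (λ x → ∑-*ʳ (cube n) (λ p → ⟦ does (f p Fin.≟ x) ⟧) ⟦ P x ⟧) ⟩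
  ∑ (finList N) (λ x → ∑ (cube n) (λ p → ⟦ does (f p Fin.≟ x) ⟧) * ⟦ P x ⟧) ≤⟨ ∑-mono (finList N) (λ x → ≤-trans (*-monoˡ-≤ ⟦ P x ⟧ (fibre x)) (≤-reflexive (+-identityʳ _))) ⟩
  ∑ (finList N) (λ x → ⟦ P x ⟧) ∎
  where
  open ≤-Reasoning
  fibre : ∀ x → ∑ (cube n) (λ p → ⟦ does (f p Fin.≟ x) ⟧) ≤ 1
  fibre x with dec-∃ (cube n) ∈-cube (λ p → f p Fin.≟ x)
  ... | no none = ≤-trans (≤-reflexive (∑-zero (cube n) λ {p} _ → cong ⟦_⟧ (dec-false (f p Fin.≟ x) λ e → none (p , e)))) z≤n
  ... | yes (p₀ , refl) = ≤-trans (∑-mono (cube n) λ p → ⟦⟧-mono (point p)) (≤-reflexive (cube-enum n p₀))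
    where
    point : ∀ p → does (f p Fin.≟ f p₀) ≡ true → does (p₀ ≟q p) ≡ true
    point p h with f p Fin.≟ f p₀
    ... | yes e = dec-true (p₀ ≟q p) (sym (inj e))
    ... | no _ = case h of λ ()

-- Connectivity of the cube, which confines a red copy to one clique.
flip-invariant : ∀ {n} {B : Set} (g : Vec Bool n → B) → (∀ i p → i < n → g p ≡ g (flip i p)) → ∀ p q → g p ≡ g q
flip-invariant g h [] [] = refl
flip-invariant g h (x ∷ p) (y ∷ q) = trans (flip-invariant (λ r → g (x ∷ r)) (λ i r lt → h (suc i) (x ∷ r) (s≤s lt)) p q) (heads x y)
  where
  heads : ∀ x y → g (x ∷ q) ≡ g (y ∷ q)
  heads true true = refl
  heads false false = refl
  heads true false = h 0 (true ∷ q) (s≤s z≤n)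
  heads false true = h 0 (false ∷ q) (s≤s z≤n)

#-below : ∀ M s → ∑ (finList M) (λ i → ⟦ suc (toℕ i) ≤ᵇ s ⟧) ≤ s
#-below zero s = z≤n
#-below (suc M) zero = ≤-reflexive (∑-zero (finList (suc M)) λ _ → refl)
#-below (suc M) (suc s) = s≤s (≤-trans (≤-reflexive (∑-map Fin.suc (finList M) _)) (#-below M s))

#-above : ∀ M s → ∑ (finList M) (λ i → ⟦ not (suc (toℕ i) ≤ᵇ s) ⟧) ≤ M ∸ s
#-above zero s = z≤n
#-above (suc M) zero = ≤-reflexive (∑-fin-1 (suc M))
#-above (suc M) (suc s) = ≤-trans (≤-reflexive (∑-map Fin.suc (finList M) _)) (#-above M s)

arrows-lower : ∀ n M → M + 2 ≤ 2 ^ suc n → ¬ Arrows n M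
arrows-lower n M small arrows = case arrows (colour , colour-sym) of λ { (inj₁ red) → no-cube red ; (inj₂ blue) → no-triangle blue }
  where
  s : ℕ
  s = 2 ^ n ∸ 1
  1+s : suc s ≡ 2 ^ n
  1+s = m+[n∸m]≡n (m^n>0 2 n)
  side : Fin M → Bool
  side i = suc (toℕ i) ≤ᵇ s
  colour : Fin M → Fin M → Bool
  colour i j = side i == side j
  colour-sym : ∀ i j → colour i j ≡ colour j i
  colour-sym i j with side i | side j
  ... | true | true = refl
  ... | true | false = refl
  ... | false | true = refl
  ... | false | false = refl
  no-triangle : ¬ BlueTriangle colour
  no-triangle (i , j , k , _ , _ , _ , a , b , d) with side i | side j | side k
  ... | true | false | true = case d of λ ()
  ... | true | false | false = case b of λ ()
  ... | false | true | true = case b of λ ()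
  ... | false | true | false = case d of λ ()
  M≤2s : M ∸ s ≤ s
  M≤2s = ≤-trans (∸-monoˡ-≤ s (+-cancelʳ-≤ 2 M (s + s) (≤-trans small (≤-reflexive (trans (cong (2 *_) (sym 1+s))
    (solve 1 (λ x → con 2 :* (con 1 :+ x) := (x :+ x) :+ con 2) refl s)))))) (≤-reflexive (m+n∸n≡m s s))
  no-cube : ¬ RedQ n colour
  no-cube (f , inj , red) = case side-of (side (f origin)) refl of λ h → <⇒≱ (≤-reflexive 1+s) h
    where
    origin : Vec Bool n
    origin = replicate n false
    constant : ∀ p → side (f p) ≡ side (f origin)
    constant p = flip-invariant (side ∘ f) (λ i r lt → ==⇒≡ _ _ (red r (flip i r) (flip⇒QAdj i r lt))) p origin
    side-of : ∀ b → side (f origin) ≡ b → 2 ^ n ≤ s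
    side-of true e = ≤-trans (#-injective f inj side λ p → trans (constant p) e) (#-below M s)
    side-of false e = ≤-trans (#-injective f inj (not ∘ side) λ p → cong not (trans (constant p) e)) (≤-trans (#-above M s) M≤2s)

theorem1p1 : (k : ℕ) → k ≥ 1 → Σ ℕ λ n₀ → (n : ℕ) → n ≥ n₀ →
    Σ ℕ λ N → IsRamseyK3Q n N × (k * ∣ N - 2 ^ suc n ∣ ≤ 2 ^ suc n)
theorem1p1 k k≥1 = Constants.n₀ r , λ n n₀≤n → ramsey n n₀≤n (least (arrows? n) _ (arrows-upper r n (m≤n+m 3 k) n₀≤n))
  where
  open ≤-Reasoning
  -- The 3 turns the excess 16·2^(n-r) into 2^(n+1)/2^k, at most a k-th part of 2^(n+1).
  r : ℕ
  r = k + 3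
  k≤2^k : k ≤ 2 ^ k
  k≤2^k = ≤-trans (m≤n*m k 2) (2*y≤2^y k)
  ramsey : ∀ n → Constants.n₀ r ≤ n → (∃[ N ] (N ≤ 2 * 2 ^ n + 16 * 2 ^ (n ∸ r)) × Arrows n N × (∀ M → M < N → ¬ Arrows n M)) →
    Σ ℕ λ N → IsRamseyK3Q n N × (k * ∣ N - 2 ^ suc n ∣ ≤ 2 ^ suc n)
  ramsey n n₀≤n (N , upper , arrows , minimal) = N , (arrows , minimal) , close
    where
    r≤n : r ≤ n
    r≤n = ≤-trans (Constants.r≤bs r (Constants.U r)) (≤-trans (≤-trans (m≤n+m _ r) (m≤m+n _ 5)) (≤-trans (m≤n*m _ 2) n₀≤n))
    near-below : 2 ^ suc n ∸ N ≤ 1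
    near-below = ≮⇒≥ λ lt → arrows-lower n N (subst (_≤ 2 ^ suc n) (+-comm 2 N) (m≤o∸n⇒m+n≤o 2 (<⇒≤ (≰⇒> λ le → case subst (1 <_) (m≤n⇒m∸n≡0 le) lt of λ ())) lt)) arrows
    close : k * ∣ N - 2 ^ suc n ∣ ≤ 2 ^ suc n
    close with ≤-total N (2 ^ suc n)
    ... | inj₁ le = begin
      k * ∣ N - 2 ^ suc n ∣ ≡⟨ cong (k *_) (m≤n⇒∣m-n∣≡n∸m le) ⟩
      k * (2 ^ suc n ∸ N) ≤⟨ *-monoʳ-≤ k near-below ⟩
      k * 1 ≡⟨ *-identityʳ k ⟩
      k ≤⟨ k≤2^k ⟩
      2 ^ k ≤⟨ ^-monoʳ-≤ 2 (≤-trans (m≤m+n k 3) (≤-trans r≤n (n≤1+n n))) ⟩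
      2 ^ suc n ∎
    ... | inj₂ ge = begin
      k * ∣ N - 2 ^ suc n ∣ ≡⟨ cong (k *_) (m≤n⇒∣n-m∣≡n∸m ge) ⟩
      k * (N ∸ 2 ^ suc n) ≤⟨ *-mono-≤ k≤2^k (≤-trans (∸-monoˡ-≤ (2 ^ suc n) upper) (≤-reflexive (m+n∸m≡n (2 ^ suc n) _))) ⟩
      2 ^ k * (16 * 2 ^ (n ∸ r)) ≡⟨ solve 2 (λ a b → a :* (con 16 :* b) := con 2 :* ((a :* con 8) :* b)) refl (2 ^ k) (2 ^ (n ∸ r)) ⟩
      2 * ((2 ^ k * 8) * 2 ^ (n ∸ r)) ≡⟨ cong (λ z → 2 * (z * 2 ^ (n ∸ r))) (sym (^-distribˡ-+-* 2 k 3)) ⟩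
      2 * (2 ^ r * 2 ^ (n ∸ r)) ≡⟨ cong (2 *_) (2^-cancel r r≤n) ⟩
      2 ^ suc n ∎
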